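{- Let $r\ge 1$. Let $X$ be an $(r+1)$-partite $r$-dimensional simplicial complex, with partite sets $V_1,\ldots,V_{r+1}$. Let $1\le k\le f_{r-1}(X)$. Then \[ \sum_{i=1}^k \lambda_i(L^+_{r-1}(X))\le \sum_{j=1}^{r+1} \; \sum_{i=1}^{\min\{k,|X(r-1;j)|\}} d_{i}^{(r)}(X;j). \]
   Context: A simplicial complex $X$ on a finite vertex set $V$ is a family of subsets of $V$ closed under inclusion; its elements are called simplices (or faces), $\dim(\sigma)=|\sigma|-1$ for $\sigma\in X$, and $\dim(X)$ is the maximal dimension of a simplex. $X(i)$ is the set of $i$-dimensional simplices (with $X(-1)=\{\emptyset\}$) and $f_i(X)=|X(i)|$. For $\sigma\in X$ and $1\le r\le\dim(X)$, the $r$-degree $\deg_X^{(r)}(\sigma)$ is the number of $r$-dimensional simplices of $X$ containing $\sigma$. An $r$-dimensional simplicial complex $X$ is $(r+1)$-partite with partite sets $V_1,\ldots,V_{r+1}$ if $V_1,\ldots,V_{r+1}$ is a partition of $V$ such that $|\sigma\cap V_i|\le 1$ for every $\sigma\in X$ and $1\le i\le r+1$. For $1\le j\le r+1$, $X(r-1;j)$ is the set of $(r-1)$-dimensional simplices of $X$ that do not intersect $V_j$, and for $1\le i\le |X(r-1;j)|$, $d_i^{(r)}(X;j)$ is the $i$-th largest (with multiplicity) $r$-degree of a simplex in $X(r-1;j)$. Fix an arbitrary linear order $<$ on $V$. For $\sigma\in X(s-1)$, $\tau\in X(s)$ with $\sigma\subset\tau$ ($0\le s\le \dim(X)$), let $u$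 be the unique vertex of $\tau\setminus\sigma$ and set $(\tau:\sigma)=(-1)^{|\{v\in\tau:\,v<u\}|}$. For $1\le r\le\dim(X)$, the upper Laplacian $L_{r-1}^+(X)\in\mathbb{R}^{f_{r-1}(X)\times f_{r-1}(X)}$ is the matrix indexed by $X(r-1)$ with $L_{r-1}^+(X)_{\tau,\tau}=\deg_X^{(r)}(\tau)$; $L_{r-1}^+(X)_{\tau,\eta}=-(\tau:\tau\cap\eta)(\eta:\tau\cap\eta)$ if $|\tau\cap\eta|=r-1$ and $\tau\cup\eta\in X$; and all other entries $0$. For a symmetric real matrix $M$, $\lambda_i(M)$ is its $i$-th largest eigenvalue (with multiplicity). -}

module Defs where

open import Data.Bool.Properties using () renaming (_≟_ to _≟ᵇ_)
open import Data.Fin.Base using (Fin; zero; suc; toℕ; punchIn; inject≤) renaming (_≤_ to _≤ᶠ_)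
open import Data.Fin.Subset using (Subset; inside; outside; _∈_; _⊆_; _∩_; _∪_; _─_; ∣_∣)
open import Data.Fin.Subset.Properties using (_∈?_; _⊆?_; nonempty?)
open import Data.Integer.Base using (ℤ; +_; 0ℤ; -1ℤ)
import Data.Integer.Base as ℤ
open import Data.List.Base using (List; []; _∷_; _++_; map; filter; length; lookup; take; allFin)
import Data.List.Sort
open import Data.Nat.Base using (ℕ; zero; suc; _⊓_; _⊔_)
import Data.Nat.Base as ℕ
import Data.Nat.ListAction as ℕ
import Data.Nat.Properties as ℕ
open import Data.Product.Base using (∃-syntax; _×_; _,_; proj₁; proj₂)
open import Data.Rational.Base using (ℚ; 0ℚ; 1ℚ; 1/_)
import Data.Rational.Base as ℚ
import Data.Rational.Properties as ℚ
open import Data.Vec.Base using ([]; _∷_)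
import Data.Vec.Functional as VF
open import Data.Vec.Properties using (≡-dec)
open import Level using (0ℓ)
open import Relation.Binary.Core using (Rel)
import Relation.Binary.Construct.Flip.EqAndOrd as Flip
open import Relation.Binary.PropositionalEquality.Core using (_≡_; refl; sym; trans; cong; subst)
open import Relation.Binary.Structures using (IsStrictTotalOrder)
open import Relation.Nullary.Decidable using (yes; no; dec⇒maybe; _×-dec_; ¬?)
open import Relation.Unary using (Pred; Decidable)
open import Tactic.RingSolver using (solve-∀)
open import Tactic.RingSolver.Core.AlmostCommutativeRing using (AlmostCommutativeRing; fromCommutativeRing)

------------------------------------------------------------------------
-- Real numbers: Cauchy sequences of rationals, with the setoid equality _≈_
-- (difference tends to 0).  All ring operations are pointwise.

IsCauchy : (ℕ → ℚ) → Set
IsCauchy x = ∀ ε → 0ℚ ℚ.< ε →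
  ∃[ N ] ∀ m n → N ℕ.≤ m → N ℕ.≤ n → ℚ.∣ x m ℚ.- x n ∣ ℚ.< ε

record ℝ : Set where
  constructor mkℝ
  field
    seq    : ℕ → ℚ
    cauchy : IsCauchy seq

open ℝ public

infix 4 _≈_ _≤_

_≈_ : Rel ℝ 0ℓ
x ≈ y = ∀ ε → 0ℚ ℚ.< ε → ∃[ N ] ∀ n → N ℕ.≤ n → ℚ.∣ seq x n ℚ.- seq y n ∣ ℚ.< ε

_≤_ : Rel ℝ 0ℓ
x ≤ y = ∀ ε → 0ℚ ℚ.< ε → ∃[ N ] ∀ n → N ℕ.≤ n → seq x n ℚ.< seq y n ℚ.+ ε

fromℚ : ℚ → ℝ
fromℚ q = mkℝ (λ _ → q) λ ε 0<ε → 0 , λ _ _ _ _ →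
  subst (ℚ._< ε) (sym (cong ℚ.∣_∣ (ℚ.+-inverseʳ q))) 0<ε

fromℤ : ℤ → ℝ
fromℤ z = fromℚ (z ℚ./ 1)

fromℕ : ℕ → ℝ
fromℕ m = fromℤ (+ m)

private
  open ℚ.≤-Reasoning

  ring : AlmostCommutativeRing 0ℓ 0ℓ
  ring = fromCommutativeRing ℚ.+-*-commutativeRing λ p → dec⇒maybe (0ℚ ℚ.≟ p)

  -- Opaque, so that the moduli of convergence are never unfolded.
  abstract
    halve : ∀ ε → ℚ.½ ℚ.* ε ℚ.+ ℚ.½ ℚ.* ε ≡ ε
    halve ε = trans (sym (ℚ.*-distribʳ-+ ε ℚ.½ ℚ.½)) (ℚ.*-identityˡ ε)

    0<½ε : ∀ ε → 0ℚ ℚ.< ε → 0ℚ ℚ.< ℚ.½ ℚ.* ε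
    0<½ε ε 0<ε = subst (ℚ._< ℚ.½ ℚ.* ε) (ℚ.*-zeroʳ ℚ.½) (ℚ.*-monoʳ-<-pos ℚ.½ 0<ε)

    ⊔-≤ˡ : ∀ {M N m} → M ⊔ N ℕ.≤ m → M ℕ.≤ m
    ⊔-≤ˡ {M} {N} = ℕ.≤-trans (ℕ.m≤m⊔n M N)

    ⊔-≤ʳ : ∀ {M N m} → M ⊔ N ℕ.≤ m → N ℕ.≤ m
    ⊔-≤ʳ {M} {N} = ℕ.≤-trans (ℕ.m≤n⊔m M N)

    +-cauchy : ∀ x y → IsCauchy x → IsCauchy y → IsCauchy (λ n → x n ℚ.+ y n)
    +-cauchy x y cx cy ε 0<ε with cx _ (0<½ε ε 0<ε) | cy _ (0<½ε ε 0<ε)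
    ... | M , hx | N , hy = M ⊔ N , λ m n M⊔N≤m M⊔N≤n → begin-strict
      ℚ.∣ (x m ℚ.+ y m) ℚ.- (x n ℚ.+ y n) ∣
        ≡⟨ cong ℚ.∣_∣ (regroup (x m) (y m) (x n) (y n)) ⟩
      ℚ.∣ (x m ℚ.- x n) ℚ.+ (y m ℚ.- y n) ∣
        ≤⟨ ℚ.∣p+q∣≤∣p∣+∣q∣ (x m ℚ.- x n) (y m ℚ.- y n) ⟩
      ℚ.∣ x m ℚ.- x n ∣ ℚ.+ ℚ.∣ y m ℚ.- y n ∣
        <⟨ ℚ.+-mono-< (hx m n (⊔-≤ˡ M⊔N≤m) (⊔-≤ˡ M⊔N≤n))
                      (hy m n (⊔-≤ʳ {M} M⊔N≤m) (⊔-≤ʳ {M} M⊔N≤n)) ⟩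
      ℚ.½ ℚ.* ε ℚ.+ ℚ.½ ℚ.* ε
        ≡⟨ halve ε ⟩
      ε ∎
      where
      regroup : ∀ a b c d → (a ℚ.+ b) ℚ.- (c ℚ.+ d) ≡ (a ℚ.- c) ℚ.+ (b ℚ.- d)
      regroup = solve-∀ ring

    neg-cauchy : ∀ x → IsCauchy x → IsCauchy (λ n → ℚ.- x n)
    neg-cauchy x cx ε 0<ε with cx ε 0<ε
    ... | M , hx = M , λ m n M≤m M≤n → begin-strict
      ℚ.∣ ℚ.- x m ℚ.- ℚ.- x n ∣  ≡⟨ cong ℚ.∣_∣ (regroup (x m) (x n)) ⟩
      ℚ.∣ ℚ.- (x m ℚ.- x n) ∣    ≡⟨ ℚ.∣-p∣≡∣p∣ (x m ℚ.- x n) ⟩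
      ℚ.∣ x m ℚ.- x n ∣          <⟨ hx m n M≤m M≤n ⟩
      ε ∎
      where
      regroup : ∀ a b → ℚ.- a ℚ.- ℚ.- b ≡ ℚ.- (a ℚ.- b)
      regroup = solve-∀ ring

    eventuallyBounded : ∀ {x} → IsCauchy x →
      ∃[ B ] 0ℚ ℚ.< B × ∃[ N ] ∀ n → N ℕ.≤ n → ℚ.∣ x n ∣ ℚ.< B
    eventuallyBounded {x} cx with cx 1ℚ (ℚ.positive⁻¹ 1ℚ)
    ... | N , hx = 1ℚ ℚ.+ ℚ.∣ x N ∣ , 0<B , N , λ n N≤n → begin-strict
      ℚ.∣ x n ∣                        ≡⟨ cong ℚ.∣_∣ (regroup (x n) (x N)) ⟩
      ℚ.∣ (x n ℚ.- x N) ℚ.+ x N ∣      ≤⟨ ℚ.∣p+q∣≤∣p∣+∣q∣ (x n ℚ.- x N) (x N) ⟩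
      ℚ.∣ x n ℚ.- x N ∣ ℚ.+ ℚ.∣ x N ∣  <⟨ ℚ.+-monoˡ-< ℚ.∣ x N ∣ (hx n N N≤n ℕ.≤-refl) ⟩
      1ℚ ℚ.+ ℚ.∣ x N ∣ ∎
      where
      0<B : 0ℚ ℚ.< 1ℚ ℚ.+ ℚ.∣ x N ∣
      0<B = ℚ.+-mono-<-≤ (ℚ.positive⁻¹ 1ℚ) (ℚ.0≤∣p∣ (x N))

      regroup : ∀ a b → a ≡ (a ℚ.- b) ℚ.+ b
      regroup = solve-∀ ring

    prod-bound : ∀ {p q} a b → ℚ.∣ a ∣ ℚ.< p → ℚ.∣ b ∣ ℚ.< q → 0ℚ ℚ.< p → ℚ.∣ a ℚ.* b ∣ ℚ.< p ℚ.* q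
    prod-bound {p} {q} a b a<p b<q 0<p = begin-strict
      ℚ.∣ a ℚ.* b ∣        ≡⟨ ℚ.∣p*q∣≡∣p∣*∣q∣ a b ⟩
      ℚ.∣ a ∣ ℚ.* ℚ.∣ b ∣  ≤⟨ ℚ.*-monoʳ-≤-nonNeg ℚ.∣ b ∣ {{ℚ.∣-∣-nonNeg b}} (ℚ.<⇒≤ a<p) ⟩
      p ℚ.* ℚ.∣ b ∣        <⟨ ℚ.*-monoʳ-<-pos p {{ℚ.positive 0<p}} b<q ⟩
      p ℚ.* q ∎

    prod-close : ∀ {A B δ} a b c d → 0ℚ ℚ.< A → 0ℚ ℚ.< δ → ℚ.∣ a ∣ ℚ.< A → ℚ.∣ d ∣ ℚ.< B →
      ℚ.∣ a ℚ.- c ∣ ℚ.< δ → ℚ.∣ b ℚ.- d ∣ ℚ.< δ →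
      ℚ.∣ a ℚ.* b ℚ.- c ℚ.* d ∣ ℚ.< A ℚ.* δ ℚ.+ δ ℚ.* B
    prod-close {A} {B} {δ} a b c d 0<A 0<δ a<A d<B a-c<δ b-d<δ = begin-strict
      ℚ.∣ a ℚ.* b ℚ.- c ℚ.* d ∣
        ≡⟨ cong ℚ.∣_∣ (regroup a b c d) ⟩
      ℚ.∣ a ℚ.* (b ℚ.- d) ℚ.+ (a ℚ.- c) ℚ.* d ∣
        ≤⟨ ℚ.∣p+q∣≤∣p∣+∣q∣ (a ℚ.* (b ℚ.- d)) ((a ℚ.- c) ℚ.* d) ⟩
      ℚ.∣ a ℚ.* (b ℚ.- d) ∣ ℚ.+ ℚ.∣ (a ℚ.- c) ℚ.* d ∣
        <⟨ ℚ.+-mono-< (prod-bound a (b ℚ.- d) a<A b-d<δ 0<A)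
                      (prod-bound (a ℚ.- c) d a-c<δ d<B 0<δ) ⟩
      A ℚ.* δ ℚ.+ δ ℚ.* B ∎
      where
      regroup : ∀ a b c d → a ℚ.* b ℚ.- c ℚ.* d ≡ a ℚ.* (b ℚ.- d) ℚ.+ (a ℚ.- c) ℚ.* d
      regroup = solve-∀ ring

    split : ∀ A B ε → 0ℚ ℚ.< A → 0ℚ ℚ.< B → 0ℚ ℚ.< ε →
      ∃[ δ ] 0ℚ ℚ.< δ × A ℚ.* δ ℚ.+ δ ℚ.* B ≡ ε
    split A B ε 0<A 0<B 0<ε = ε ℚ.* i , 0<εi , trans (factor A B ε i) εi[A+B]≡ε
      where
      A+B-pos : ℚ.Positive (A ℚ.+ B)
      A+B-pos = ℚ.positive (ℚ.+-mono-< 0<A 0<B)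

      A+B-nonZero : ℚ.NonZero (A ℚ.+ B)
      A+B-nonZero = ℚ.pos⇒nonZero (A ℚ.+ B) {{A+B-pos}}

      i : ℚ
      i = (1/ (A ℚ.+ B)) {{A+B-nonZero}}

      0<εi : 0ℚ ℚ.< ε ℚ.* i
      0<εi = ℚ.positive⁻¹ (ε ℚ.* i)
        {{ℚ.pos*pos⇒pos ε {{ℚ.positive 0<ε}} i {{ℚ.1/pos⇒pos (A ℚ.+ B) {{A+B-pos}}}}}}

      εi[A+B]≡ε : ε ℚ.* (i ℚ.* (A ℚ.+ B)) ≡ ε
      εi[A+B]≡ε = trans (cong (ε ℚ.*_) (ℚ.*-inverseˡ (A ℚ.+ B) {{A+B-nonZero}})) (ℚ.*-identityʳ ε)

      factor : ∀ a b e i → a ℚ.* (e ℚ.* i) ℚ.+ (e ℚ.* i) ℚ.* b ≡ e ℚ.* (i ℚ.* (a ℚ.+ b))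
      factor = solve-∀ ring

    *-cauchy : ∀ x y → IsCauchy x → IsCauchy y → IsCauchy (λ n → x n ℚ.* y n)
    *-cauchy x y cx cy ε 0<ε =
      let A , 0<A , M , boundx = eventuallyBounded {x} cx
          B , 0<B , N , boundy = eventuallyBounded {y} cy
          δ , 0<δ , Aδ+δB≡ε    = split A B ε 0<A 0<B 0<ε
          Kx , closex          = cx δ 0<δ
          Ky , closey          = cy δ 0<δ
      in (M ⊔ N) ⊔ (Kx ⊔ Ky) , λ m n K≤m K≤n →
        subst (ℚ.∣ x m ℚ.* y m ℚ.- x n ℚ.* y n ∣ ℚ.<_) Aδ+δB≡ε
          (prod-close {A} {B} {δ} (x m) (y m) (x n) (y n) 0<A 0<δ
            (boundx m (⊔-≤ˡ (⊔-≤ˡ K≤m)))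
            (boundy n (⊔-≤ʳ {M} (⊔-≤ˡ K≤n)))
            (closex m n (⊔-≤ˡ (⊔-≤ʳ {M ⊔ N} K≤m)) (⊔-≤ˡ (⊔-≤ʳ {M ⊔ N} K≤n)))
            (closey m n (⊔-≤ʳ {Kx} (⊔-≤ʳ {M ⊔ N} K≤m)) (⊔-≤ʳ {Kx} (⊔-≤ʳ {M ⊔ N} K≤n))))

infixl 6 _+_ _-_
infixl 7 _*_
infix  8 -_

_+_ : ℝ → ℝ → ℝ
x + y = mkℝ (λ n → seq x n ℚ.+ seq y n) (+-cauchy (seq x) (seq y) (cauchy x) (cauchy y))

-_ : ℝ → ℝ
- x = mkℝ (λ n → ℚ.- seq x n) (neg-cauchy (seq x) (cauchy x))

_-_ : ℝ → ℝ → ℝ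
x - y = x + (- y)

_*_ : ℝ → ℝ → ℝ
x * y = mkℝ (λ n → seq x n ℚ.* seq y n) (*-cauchy (seq x) (seq y) (cauchy x) (cauchy y))

0ℝ 1ℝ : ℝ
0ℝ = fromℚ 0ℚ
1ℝ = fromℚ 1ℚ

sum product : ∀ {n} → (Fin n → ℝ) → ℝ
sum     = VF.foldr _+_ 0ℝ
product = VF.foldr _*_ 1ℝ

------------------------------------------------------------------------
-- Matrices and eigenvalues

Matrix : Set → ℕ → Set
Matrix A n = Fin n → Fin n → A

sign : ℕ → ℝ
sign m = fromℤ (-1ℤ ℤ.^ m)

-- Laplace expansion along the first row.
det : ∀ {n} → Matrix ℝ n → ℝ
det {zero}  M = 1ℝ
det {suc n} M =
  sum λ j → sign (toℕ j) * M zero j * det (λ i k → M (suc i) (punchIn j k))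

scalar : ∀ {n} → ℝ → Matrix ℝ n
scalar {suc n} t zero    zero    = t
scalar {suc n} t zero    (suc j) = 0ℝ
scalar {suc n} t (suc i) zero    = 0ℝ
scalar {suc n} t (suc i) (suc j) = scalar t i j

charPoly : ∀ {n} → Matrix ℝ n → ℝ → ℝ
charPoly M t = det λ i j → scalar t i j - M i j

-- μ lists all eigenvalues of M, repeated according to multiplicity, from the
-- largest (index zero) to the smallest.  Over ℝ a polynomial is determined by
-- its values, so the factorisation of the characteristic polynomial is stated
-- pointwise.
record IsEigenvalueList {n} (M : Matrix ℝ n) (μ : Fin n → ℝ) : Set where
  field
    decreasing : ∀ i j → i ≤ᶠ j → μ j ≤ μ i
    splits     : ∀ t → charPoly M t ≈ product λ i → t - μ i

------------------------------------------------------------------------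
-- Simplicial complexes on the vertex set Fin n

record SimplicialComplex (n : ℕ) : Set₁ where
  field
    IsFace     : Pred (Subset n) 0ℓ
    isFace?    : Decidable IsFace
    downClosed : ∀ {σ τ} → IsFace τ → σ ⊆ τ → IsFace σ

open SimplicialComplex public

subsets : ∀ n → List (Subset n)
subsets zero    = [] ∷ []
subsets (suc n) = map (outside ∷_) (subsets n) ++ map (inside ∷_) (subsets n)

module _ {n : ℕ} (X : SimplicialComplex n) where

  -- Simplices are indexed by their number s of vertices, not by dimension, so
  -- that no index -1 is needed: simplices s is X(s-1), without repetition.
  simplices : ℕ → List (Subset n)
  simplices s = filter (λ σ → isFace? X σ ×-dec (∣ σ ∣ ℕ.≟ s)) (subsets n)

  HasDimension : ℕ → Set
  HasDimension r =
    (∀ {σ} → IsFace X σ → ∣ σ ∣ ℕ.≤ suc r) × (∃[ σ ] IsFace X σ × ∣ σ ∣ ≡ suc r)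

  deg : ℕ → Subset n → ℕ
  deg r σ = length (filter (σ ⊆?_) (simplices (suc r)))

  record IsPartite (r : ℕ) (V : Fin (suc r) → Subset n) : Set where
    field
      hasDimension : HasDimension r
      covers       : ∀ v → ∃[ j ] v ∈ V j
      disjoint     : ∀ {v i j} → v ∈ V i → v ∈ V j → i ≡ j
      rainbow      : ∀ {σ} → IsFace X σ → ∀ j → ∣ σ ∩ V j ∣ ℕ.≤ 1

  -- X(r-1;j), where W = V_j.
  simplicesAvoiding : ℕ → Subset n → List (Subset n)
  simplicesAvoiding r W = filter (λ σ → ¬? (nonempty? (σ ∩ W))) (simplices r)

  -- d₁ ≥ d₂ ≥ …
  degreesAvoiding : ℕ → Subset n → List ℕ
  degreesAvoiding r W = sort (map (deg r) (simplicesAvoiding r W))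
    where open Data.List.Sort (Flip.decTotalOrder ℕ.≤-decTotalOrder) using (sort)

  sumLargestDegrees : ℕ → ℕ → Subset n → ℕ
  sumLargestDegrees k r W =
    ℕ.sum (take (k ⊓ length (simplicesAvoiding r W)) (degreesAvoiding r W))

  -- f_{s-1}(X).
  faceCount : ℕ → ℕ
  faceCount s = length (simplices s)

module _ {n : ℕ} {_<_ : Rel (Fin n) 0ℓ} (<-sto : IsStrictTotalOrder _≡_ _<_) where

  open IsStrictTotalOrder <-sto using (_<?_)

  -- (τ : σ), for σ ⊂ τ with a single vertex u in τ ∖ σ; the value 1 when τ ∖ σ
  -- is empty is never used.
  incidence : Subset n → Subset n → ℤ
  incidence τ σ with nonempty? (τ ─ σ)
  ... | yes (u , _) = -1ℤ ℤ.^ length (filter (λ v → (v ∈? τ) ×-dec (v <? u)) (allFin n))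
  ... | no _        = ℤ.1ℤ

  laplacianEntry : SimplicialComplex n → ℕ → Subset n → Subset n → ℤ
  laplacianEntry X r τ η with ≡-dec _≟ᵇ_ τ η
  ... | yes _ = + deg X r τ
  ... | no _ with (suc ∣ τ ∩ η ∣ ℕ.≟ r) ×-dec isFace? X (τ ∪ η)
  ...   | yes _ = ℤ.- (incidence τ (τ ∩ η) ℤ.* incidence η (τ ∩ η))
  ...   | no _  = 0ℤ

  -- L⁺_{r-1}(X); rows and columns are indexed by positions in simplices X r.
  upperLaplacian : (X : SimplicialComplex n) (r : ℕ) → Matrix ℝ (faceCount X r)
  upperLaplacian X r i j =
    fromℤ (laplacianEntry X r (lookup (simplices X r) i) (lookup (simplices X r) j))

sumFirst : ∀ {m k} → k ℕ.≤ m → (Fin m → ℝ) → ℝ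
sumFirst k≤m μ = sum λ i → μ (inject≤ i k≤m)

-- Write L = ∂ ∂ᵀ, where ∂ has rows X(r-1) and columns X(r).  The rows in X(r-1;j)
-- have squared lengths deg τ and disjoint supports, since a simplex of X(r) has
-- exactly one facet avoiding V_j.  Let t_j be the k-th largest degree in
-- X(r-1;j), or 0, let T = Σ_j t_j, and let Q be the projection of the chains on
-- X(r) onto the eigenvectors of ∂ᵀ ∂ with eigenvalue above T.  Then
--   Σ_{μᵢ > T} (μᵢ − T) = Σ_j (Σ_{τ ∈ X(r-1;j)} ∂_τ Q ∂_τᵀ − t_j tr Q)
--                       ≤ Σ_j Σ_{τ ∈ X(r-1;j)} max (deg τ − t_j) 0,
-- and Σ_{i ≤ k} μᵢ ≤ k T + Σ_{μᵢ > T} (μᵢ − T).  As _≤_ on ℝ is stable under double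
-- negation, finitely many case distinctions on reals are harmless.  No
-- eigenvectors are constructed: Q comes from a polynomial in L that interpolates
-- at the eigenvalues, and the characteristic polynomial enters through
-- tr p(L) = Σ p(μᵢ) only.

module Submission where

open import Algebra.Bundles using (CommutativeRing; RawRing)
import Algebra.Properties.CommutativeSemiring.Exp
import Algebra.Properties.Ring
import Algebra.Properties.Semiring.Mult
import Algebra.Properties.Semiring.Sum
import Algebra.Solver.Ring
open import Algebra.Solver.Ring.AlmostCommutativeRing
  using (AlmostCommutativeRing; fromCommutativeRing; _-Raw-AlmostCommutative⟶_; Induced-equivalence)
open import Data.Bool.Base using (Bool; true; false)
open import Data.Empty using (⊥-elim)
open import Data.Fin.Base using (Fin; zero; suc; toℕ; punchIn; punchOut; inject≤)
import Data.Fin.Properties as Fin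
open import Data.Fin.Subset using (Subset)
import Data.Integer.Base as ℤ
import Data.Integer.Properties as ℤ
open import Data.List.Base using (List; []; _∷_; map; length)
open import Data.Maybe.Base using (Maybe; just; nothing)
open import Data.Nat.Base using (ℕ; zero; suc)
import Data.Nat.Base as ℕ
import Data.Nat.Properties as ℕ
open import Data.Product.Base using (∃; ∃-syntax; _×_; _,_; proj₁; proj₂)
import Data.Rational.Base as ℚ
import Data.Rational.Properties as ℚ
import Data.Rational.Unnormalised.Base as ℚᵘ
import Data.Rational.Unnormalised.Properties as ℚᵘ
open import Data.Sum.Base using (_⊎_; inj₁; inj₂)
open import Data.Vec.Base using (Vec; []; _∷_)
open import Data.Vec.Functional using (updateAt; foldr)
open import Data.Vec.Functional.Properties using (updateAt-updates; updateAt-minimal)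
import Defs
open import Function.Base using (_∘_; const; id; case_of_)
open import Level as Level using (Level; 0ℓ; _⊔_)
open import Relation.Binary.Core using (Rel)
open import Relation.Binary.Definitions using (tri<; tri≈; tri>)
open import Relation.Binary.PropositionalEquality.Core as ≡ using (_≡_; _≢_)
open import Relation.Binary.PropositionalEquality.Properties using (module ≡-Reasoning)
import Relation.Binary.Reasoning.Setoid
open import Relation.Binary.Structures using (IsStrictTotalOrder)
open import Relation.Nullary.Decidable using (Dec; yes; no; ¬?; _×-dec_)
open import Relation.Nullary.Negation using (¬_; contradiction)

-- The estimate that carries the argument concerns one row u of ∂, with entries 0 and ±1 and d =
-- |u|². The number x = u Q uᵀ satisfies x ≤ d, because Q contracts, and x ≤ d m, where m sums the
-- diagonal of Q over the support of u. For t ≤ d the weights 1 - t/d and t/d combine these to x ≤ t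
-- m + (d - t); for t ≥ d the second bound alone gives x ≤ t m. Disjoint supports enter only here:
-- inside one part the numbers m add up to at most tr Q.
--
-- The trace formula must come from a factorisation of the characteristic polynomial that is known
-- only pointwise. Jacobi's formula for det (1 - zL) over formal power series supplies the power
-- traces without inverting a matrix over the reals, and agreement at infinitely many z turns the
-- pointwise hypothesis into an equality of coefficients. An identity p(μᵢ) = 0 at all eigenvalues
-- then passes to p(L) = 0, since p(L) is symmetric and tr p(L)² vanishes; this replaces
-- diagonalisation.

-- The ring solver needs coefficients with decidable equality for terms to
-- cancel: a pair (a , b) of naturals stands for a − b, and is kept reduced since
-- normal forms are compared syntactically.
module IntegerRingSolver {c ℓ : Level} (R : CommutativeRing c ℓ) where

  open CommutativeRing R hiding (_-_; zero)
  open Algebra.Properties.Semiring.Mult semiring using (×-homo-+; ×1-homo-*)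
    renaming (_×_ to _·_)
  open Algebra.Properties.Ring ring
    using (-‿distribˡ-*; -‿distribʳ-*; -‿+-comm; -‿involutive; -0#≈0#)
  open Relation.Binary.Reasoning.Setoid setoid

  private
    reduce : ℕ → ℕ → ℕ × ℕ
    reduce a b = a ℕ.∸ b , b ℕ.∸ a

    differences : RawRing 0ℓ 0ℓ
    differences = record
      { Carrier = ℕ × ℕ
      ; _≈_     = _≡_
      ; _+_     = λ (a , b) (c , d) → reduce (a ℕ.+ c) (b ℕ.+ d)
      ; _*_     = λ (a , b) (c , d) → reduce (a ℕ.* c ℕ.+ b ℕ.* d) (a ℕ.* d ℕ.+ b ℕ.* c)
      ; -_      = λ (a , b) → b , a
      ; 0#      = 0 , 0
      ; 1#      = 1 , 0
      }

    ⟦_⟧ : ℕ → Carrier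
    ⟦ n ⟧ = n · 1#

    interchange : ∀ w x y z → (w + x) + (y + z) ≈ (w + y) + (x + z)
    interchange w x y z = begin
      (w + x) + (y + z)  ≈⟨ +-assoc w x (y + z) ⟩
      w + (x + (y + z))  ≈⟨ +-congˡ (+-assoc x y z) ⟨
      w + ((x + y) + z)  ≈⟨ +-congˡ (+-congʳ (+-comm x y)) ⟩
      w + ((y + x) + z)  ≈⟨ +-congˡ (+-assoc y x z) ⟩
      w + (y + (x + z))  ≈⟨ +-assoc w y (x + z) ⟨
      (w + y) + (x + z)  ∎

    -- Moving the negative terms across turns an equality of differences into one of naturals, which
    -- is decidable. It justifies both the reduction of coefficients and the test `equal?`.
    difference-cong : ∀ a b c d → a ℕ.+ d ≡ c ℕ.+ b → ⟦ a ⟧ + - ⟦ b ⟧ ≈ ⟦ c ⟧ + - ⟦ d ⟧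
    difference-cong a b c d a+d≡c+b = begin
      ⟦ a ⟧ + - ⟦ b ⟧                        ≈⟨ +-identityʳ _ ⟨
      (⟦ a ⟧ + - ⟦ b ⟧) + 0#                 ≈⟨ +-congˡ (-‿inverseʳ ⟦ d ⟧) ⟨
      (⟦ a ⟧ + - ⟦ b ⟧) + (⟦ d ⟧ + - ⟦ d ⟧)  ≈⟨ interchange _ _ _ _ ⟩
      (⟦ a ⟧ + ⟦ d ⟧) + (- ⟦ b ⟧ + - ⟦ d ⟧)  ≈⟨ +-cong sums (+-comm _ _) ⟩
      (⟦ c ⟧ + ⟦ b ⟧) + (- ⟦ d ⟧ + - ⟦ b ⟧)  ≈⟨ interchange _ _ _ _ ⟩
      (⟦ c ⟧ + - ⟦ d ⟧) + (⟦ b ⟧ + - ⟦ b ⟧)  ≈⟨ +-congˡ (-‿inverseʳ ⟦ b ⟧) ⟩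
      (⟦ c ⟧ + - ⟦ d ⟧) + 0#                 ≈⟨ +-identityʳ _ ⟩
      ⟦ c ⟧ + - ⟦ d ⟧                        ∎
      where
      sums : ⟦ a ⟧ + ⟦ d ⟧ ≈ ⟦ c ⟧ + ⟦ b ⟧
      sums = trans (sym (×-homo-+ 1# a d))
        (trans (reflexive (≡.cong ⟦_⟧ a+d≡c+b)) (×-homo-+ 1# c b))

    ⟦reduce⟧ : ∀ a b → ⟦ a ℕ.∸ b ⟧ + - ⟦ b ℕ.∸ a ⟧ ≈ ⟦ a ⟧ + - ⟦ b ⟧
    ⟦reduce⟧ a b = difference-cong (a ℕ.∸ b) (b ℕ.∸ a) a b (balance a b)
      where
      balance : ∀ a b → a ℕ.∸ b ℕ.+ b ≡ a ℕ.+ (b ℕ.∸ a)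
      balance zero    zero    = ≡.refl
      balance zero    (suc b) = ≡.refl
      balance (suc a) zero    = ≡.refl
      balance (suc a) (suc b) = ≡.trans (ℕ.+-suc (a ℕ.∸ b) b) (≡.cong suc (balance a b))

    multiply : ∀ p q r s → (p * r + q * s) + - (p * s + q * r) ≈ (p + - q) * (r + - s)
    multiply p q r s = begin
      (p * r + q * s) + - (p * s + q * r)
        ≈⟨ +-congˡ (-‿+-comm (p * s) (q * r)) ⟨
      (p * r + q * s) + (- (p * s) + - (q * r))
        ≈⟨ interchange (p * r) (q * s) (- (p * s)) (- (q * r)) ⟩
      (p * r + - (p * s)) + (q * s + - (q * r))
        ≈⟨ +-cong (trans (+-congˡ (-‿distribʳ-* p s)) (sym (distribˡ p r (- s)))) second ⟩
      p * (r + - s) + - q * (r + - s)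
        ≈⟨ distribʳ (r + - s) p (- q) ⟨
      (p + - q) * (r + - s) ∎
      where
      second : q * s + - (q * r) ≈ - q * (r + - s)
      second = begin
        q * s + - (q * r)        ≈⟨ +-comm (q * s) (- (q * r)) ⟩
        - (q * r) + q * s        ≈⟨ +-cong (-‿distribˡ-* q r) (sym (-‿involutive (q * s))) ⟩
        - q * r + - - (q * s)    ≈⟨ +-congˡ (-‿cong (-‿distribˡ-* q s)) ⟩
        - q * r + - (- q * s)    ≈⟨ +-congˡ (-‿distribʳ-* (- q) s) ⟩
        - q * r + - q * - s      ≈⟨ distribˡ (- q) r (- s) ⟨
        - q * (r + - s)          ∎

    almostCommutativeRing : AlmostCommutativeRing c ℓ
    almostCommutativeRing = fromCommutativeRing R

    evaluate : differences -Raw-AlmostCommutative⟶ almostCommutativeRing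
    evaluate = record
      { ⟦_⟧    = λ (a , b) → ⟦ a ⟧ + - ⟦ b ⟧
      ; +-homo = λ (a , b) (c , d) → trans (⟦reduce⟧ (a ℕ.+ c) (b ℕ.+ d)) (begin
          ⟦ a ℕ.+ c ⟧ + - ⟦ b ℕ.+ d ⟧
            ≈⟨ +-cong (×-homo-+ 1# a c)
                 (trans (-‿cong (×-homo-+ 1# b d)) (sym (-‿+-comm ⟦ b ⟧ ⟦ d ⟧))) ⟩
          (⟦ a ⟧ + ⟦ c ⟧) + (- ⟦ b ⟧ + - ⟦ d ⟧)
            ≈⟨ interchange ⟦ a ⟧ ⟦ c ⟧ (- ⟦ b ⟧) (- ⟦ d ⟧) ⟩
          (⟦ a ⟧ + - ⟦ b ⟧) + (⟦ c ⟧ + - ⟦ d ⟧) ∎)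
      ; *-homo = λ (a , b) (c , d) → trans
        (⟦reduce⟧ (a ℕ.* c ℕ.+ b ℕ.* d) (a ℕ.* d ℕ.+ b ℕ.* c)) (trans
          (+-cong (product-sum a c b d) (-‿cong (product-sum a d b c)))
          (multiply ⟦ a ⟧ ⟦ b ⟧ ⟦ c ⟧ ⟦ d ⟧))
      ; -‿homo = λ (a , b) → begin
          ⟦ b ⟧ + - ⟦ a ⟧      ≈⟨ +-comm ⟦ b ⟧ (- ⟦ a ⟧) ⟩
          - ⟦ a ⟧ + ⟦ b ⟧      ≈⟨ +-congˡ (-‿involutive ⟦ b ⟧) ⟨
          - ⟦ a ⟧ + - - ⟦ b ⟧  ≈⟨ -‿+-comm ⟦ a ⟧ (- ⟦ b ⟧) ⟩
          - (⟦ a ⟧ + - ⟦ b ⟧)  ∎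
      ; 0-homo = -‿inverseʳ 0#
      ; 1-homo = trans (+-cong (+-identityʳ 1#) -0#≈0#) (+-identityʳ 1#)
      }
      where
      product-sum : ∀ a c b d → ⟦ a ℕ.* c ℕ.+ b ℕ.* d ⟧ ≈ ⟦ a ⟧ * ⟦ c ⟧ + ⟦ b ⟧ * ⟦ d ⟧
      product-sum a c b d =
        trans (×-homo-+ 1# (a ℕ.* c) (b ℕ.* d)) (+-cong (×1-homo-* a c) (×1-homo-* b d))

    equal? : (x y : ℕ × ℕ) → Maybe (Induced-equivalence evaluate x y)
    equal? (a , b) (c , d) with a ℕ.+ d ℕ.≟ c ℕ.+ b
    ... | no _        = nothing
    ... | yes a+d≡c+b = just (difference-cong a b c d a+d≡c+b)

  open Algebra.Solver.Ring differences almostCommutativeRing evaluate equal? public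
    using (solve; _:+_; _:*_; :-_; _:-_; _:=_)


-- Finite sums and products.

module Sums {c ℓ : Level} (R : CommutativeRing c ℓ) where

  open CommutativeRing R hiding (_-_; zero)
  open Algebra.Properties.Semiring.Sum semiring public
    using (sum; sum-cong-≋; ∑-distrib-+; ∑-comm; *-distribˡ-sum; *-distribʳ-sum; sum-replicate-zero)
  open Algebra.Properties.Ring ring using (-‿+-comm; -0#≈0#)

  product : ∀ {n} → (Fin n → Carrier) → Carrier
  product = foldr _*_ 1#

  sum-zero : ∀ {n} {f : Fin n → Carrier} → (∀ i → f i ≈ 0#) → sum f ≈ 0#
  sum-zero {n} f≈0 = trans (sum-cong-≋ f≈0) (sum-replicate-zero n)

  sum-neg : ∀ {n} (f : Fin n → Carrier) → sum (λ i → - f i) ≈ - sum f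
  sum-neg {zero}  f = sym -0#≈0#
  sum-neg {suc n} f = trans (+-congˡ (sum-neg (f ∘ suc))) (-‿+-comm _ _)

  sum-single : ∀ {n} (f : Fin n → Carrier) i → (∀ j → j ≢ i → f j ≈ 0#) → sum f ≈ f i
  sum-single f zero    f≈0 =
    trans (+-congˡ (sum-zero λ j → f≈0 (suc j) λ ())) (+-identityʳ (f zero))
  sum-single f (suc i) f≈0 = trans
    (+-cong (f≈0 zero λ ()) (sum-single (f ∘ suc) i λ j j≢i → f≈0 (suc j) (j≢i ∘ Fin.suc-injective)))
    (+-identityˡ (f (suc i)))

-- Exterior algebra in coordinates.

-- An element of the exterior algebra of Rⁿ is given by its coefficient at each
-- subset of the basis, a bit vector whose first bit is the membership of e₀.
module ExteriorAlgebra {c ℓ : Level} (R : CommutativeRing c ℓ) where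

  open CommutativeRing R hiding (_-_; zero)
  open Algebra.Properties.Ring ring using (-0#≈0#; -1*x≈-x)
  open Relation.Binary.Reasoning.Setoid setoid
  open IntegerRingSolver R
  open Sums R

  Form : ℕ → Set c
  Form n = Vec Bool n → Carrier

  Vector : ℕ → Set c
  Vector n = Fin n → Carrier

  one : ∀ {n} → Form n
  one []          = 1#
  one (false ∷ S) = one S
  one (true ∷ S)  = 0#

  infixr 7 _∧_

  -- With v = v₀ e₀ + v′ and x = x₀ + e₀ ∧ x₁, where v′, x₀ and x₁ do not involve e₀, the product is
  -- v′ ∧ x₀ + e₀ ∧ (v₀ x₀ - v′ ∧ x₁). The minus sign comes from moving v′ past e₀.
  _∧_ : ∀ {n} → Vector n → Form n → Form n
  (v ∧ x) []          = 0#
  (v ∧ x) (false ∷ S) = ((v ∘ suc) ∧ (x ∘ (false ∷_))) S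
  (v ∧ x) (true ∷ S)  = v zero * x (false ∷ S) + - ((v ∘ suc) ∧ (x ∘ (true ∷_))) S

  ∧-congˡ : ∀ {n} (v : Vector n) {x y} → (∀ S → x S ≈ y S) → ∀ S → (v ∧ x) S ≈ (v ∧ y) S
  ∧-congˡ v x≈y []          = refl
  ∧-congˡ v x≈y (false ∷ S) = ∧-congˡ (v ∘ suc) (x≈y ∘ (false ∷_)) S
  ∧-congˡ v x≈y (true ∷ S)  =
    +-cong (*-congˡ (x≈y (false ∷ S))) (-‿cong (∧-congˡ (v ∘ suc) (x≈y ∘ (true ∷_)) S))

  ∧-congʳ : ∀ {n} {v w : Vector n} (x : Form n) → (∀ i → v i ≈ w i) → ∀ S → (v ∧ x) S ≈ (w ∧ x) S
  ∧-congʳ x v≈w []          = refl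
  ∧-congʳ x v≈w (false ∷ S) = ∧-congʳ (x ∘ (false ∷_)) (v≈w ∘ suc) S
  ∧-congʳ x v≈w (true ∷ S)  =
    +-cong (*-congʳ (v≈w zero)) (-‿cong (∧-congʳ (x ∘ (true ∷_)) (v≈w ∘ suc) S))

  ∧-zeroʳ : ∀ {n} (v : Vector n) {x} → (∀ S → x S ≈ 0#) → ∀ S → (v ∧ x) S ≈ 0#
  ∧-zeroʳ v x≈0 []          = refl
  ∧-zeroʳ v x≈0 (false ∷ S) = ∧-zeroʳ (v ∘ suc) (x≈0 ∘ (false ∷_)) S
  ∧-zeroʳ v x≈0 (true ∷ S)  = trans
    (+-cong (trans (*-congˡ (x≈0 (false ∷ S))) (zeroʳ (v zero)))
            (trans (-‿cong (∧-zeroʳ (v ∘ suc) (x≈0 ∘ (true ∷_)) S)) -0#≈0#))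
    (+-identityʳ 0#)

  ∧-distribˡ : ∀ {n} (v : Vector n) x y S → (v ∧ λ T → x T + y T) S ≈ (v ∧ x) S + (v ∧ y) S
  ∧-distribˡ v x y []          = sym (+-identityʳ 0#)
  ∧-distribˡ v x y (false ∷ S) = ∧-distribˡ (v ∘ suc) (x ∘ (false ∷_)) (y ∘ (false ∷_)) S
  ∧-distribˡ v x y (true ∷ S)  = trans
    (+-congˡ (-‿cong (∧-distribˡ (v ∘ suc) (x ∘ (true ∷_)) (y ∘ (true ∷_)) S)))
    (solve 5 (λ c x y p q → c :* (x :+ y) :- (p :+ q) := (c :* x :- p) :+ (c :* y :- q))
      refl _ _ _ _ _)

  ∧-scaleˡ : ∀ {n} (v : Vector n) a x S → (v ∧ λ T → a * x T) S ≈ a * (v ∧ x) S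
  ∧-scaleˡ v a x []          = sym (zeroʳ a)
  ∧-scaleˡ v a x (false ∷ S) = ∧-scaleˡ (v ∘ suc) a (x ∘ (false ∷_)) S
  ∧-scaleˡ v a x (true ∷ S)  = trans
    (+-congˡ (-‿cong (∧-scaleˡ (v ∘ suc) a (x ∘ (true ∷_)) S)))
    (solve 4 (λ c a x p → c :* (a :* x) :- a :* p := a :* (c :* x :- p)) refl _ _ _ _)

  ∧-distribʳ : ∀ {n} (v w : Vector n) x S → ((λ i → v i + w i) ∧ x) S ≈ (v ∧ x) S + (w ∧ x) S
  ∧-distribʳ v w x []          = sym (+-identityʳ 0#)
  ∧-distribʳ v w x (false ∷ S) = ∧-distribʳ (v ∘ suc) (w ∘ suc) (x ∘ (false ∷_)) S
  ∧-distribʳ v w x (true ∷ S)  = trans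
    (+-congˡ (-‿cong (∧-distribʳ (v ∘ suc) (w ∘ suc) (x ∘ (true ∷_)) S)))
    (solve 5 (λ c d x p q → (c :+ d) :* x :- (p :+ q) := (c :* x :- p) :+ (d :* x :- q))
      refl _ _ _ _ _)

  ∧-scaleʳ : ∀ {n} a (v : Vector n) x S → ((λ i → a * v i) ∧ x) S ≈ a * (v ∧ x) S
  ∧-scaleʳ a v x []          = sym (zeroʳ a)
  ∧-scaleʳ a v x (false ∷ S) = ∧-scaleʳ a (v ∘ suc) (x ∘ (false ∷_)) S
  ∧-scaleʳ a v x (true ∷ S)  = trans
    (+-congˡ (-‿cong (∧-scaleʳ a (v ∘ suc) (x ∘ (true ∷_)) S)))
    (solve 4 (λ c a x p → (a :* c) :* x :- a :* p := a :* (c :* x :- p)) refl _ _ _ _)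

  ∧-zeroˡ : ∀ {n} {v : Vector n} → (∀ i → v i ≈ 0#) → ∀ x S → (v ∧ x) S ≈ 0#
  ∧-zeroˡ {v = v} v≈0 x S = begin
    (v ∧ x) S                 ≈⟨ ∧-congʳ x (λ i → trans (v≈0 i) (sym (zeroˡ (v i)))) S ⟩
    ((λ i → 0# * v i) ∧ x) S  ≈⟨ ∧-scaleʳ 0# v x S ⟩
    0# * (v ∧ x) S            ≈⟨ zeroˡ _ ⟩
    0#                        ∎

  ∧-sumˡ : ∀ {n m} (v : Vector n) (x : Fin m → Form n) S →
    (v ∧ λ T → sum λ i → x i T) S ≈ sum λ i → (v ∧ x i) S
  ∧-sumˡ {m = zero}  v x S = ∧-zeroʳ v (λ _ → refl) S
  ∧-sumˡ {m = suc m} v x S =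
    trans (∧-distribˡ v (x zero) _ S) (+-congˡ (∧-sumˡ v (x ∘ suc) S))

  ∧-sumʳ : ∀ {n m} (v : Fin m → Vector n) x S →
    ((λ i → sum λ k → v k i) ∧ x) S ≈ sum λ k → (v k ∧ x) S
  ∧-sumʳ {m = zero}  v x S = ∧-zeroˡ (λ _ → refl) x S
  ∧-sumʳ {m = suc m} v x S =
    trans (∧-distribʳ (v zero) _ x S) (+-congˡ (∧-sumʳ (v ∘ suc) x S))

  ∧-negˡ : ∀ {n} (v : Vector n) x S → (v ∧ λ T → - x T) S ≈ - (v ∧ x) S
  ∧-negˡ v x S = begin
    (v ∧ λ T → - x T) S       ≈⟨ ∧-congˡ v (λ T → sym (-1*x≈-x (x T))) S ⟩
    (v ∧ λ T → - 1# * x T) S  ≈⟨ ∧-scaleˡ v (- 1#) x S ⟩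
    - 1# * (v ∧ x) S          ≈⟨ -1*x≈-x _ ⟩
    - (v ∧ x) S               ∎

  ∧-true : ∀ {n} (u v : Vector n) a x y S →
    (u ∧ λ T → a * x T + - (v ∧ y) T) S ≈ a * (u ∧ x) S + - (u ∧ v ∧ y) S
  ∧-true u v a x y S = trans
    (∧-distribˡ u (λ T → a * x T) (λ T → - (v ∧ y) T) S)
    (+-cong (∧-scaleˡ u a x S) (∧-negˡ u (v ∧ y) S))

  ∧-anticomm : ∀ {n} (v w : Vector n) x S → (v ∧ w ∧ x) S ≈ - (w ∧ v ∧ x) S
  ∧-anticomm v w x []          = sym -0#≈0#
  ∧-anticomm v w x (false ∷ S) = ∧-anticomm (v ∘ suc) (w ∘ suc) (x ∘ (false ∷_)) S
  ∧-anticomm v w x (true ∷ S)  = begin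
    v zero * w·x₀ + - (v′ ∧ λ T → w zero * x (false ∷ T) + - (w′ ∧ x₁) T) S
      ≈⟨ +-congˡ (-‿cong (∧-true v′ w′ (w zero) x₀ x₁ S)) ⟩
    v zero * w·x₀ + - (w zero * v·x₀ + - v·w·x₁)
      ≈⟨ +-congˡ (-‿cong (+-congˡ (-‿cong (∧-anticomm v′ w′ x₁ S)))) ⟩
    v zero * w·x₀ + - (w zero * v·x₀ + - - w·v·x₁)
      ≈⟨ solve 5 (λ a b p q r → a :* p :- (b :* q :- :- r) := :- (b :* q :- (a :* p :- r)))
           refl _ _ _ _ _ ⟩
    - (w zero * v·x₀ + - (v zero * w·x₀ + - w·v·x₁))
      ≈⟨ -‿cong (+-congˡ (-‿cong (∧-true w′ v′ (v zero) x₀ x₁ S))) ⟨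
    - (w zero * v·x₀ + - (w′ ∧ λ T → v zero * x (false ∷ T) + - (v′ ∧ x₁) T) S) ∎
    where
    v′ = v ∘ suc
    w′ = w ∘ suc
    x₀ = x ∘ (false ∷_)
    x₁ = x ∘ (true ∷_)
    v·x₀ = (v′ ∧ x₀) S
    w·x₀ = (w′ ∧ x₀) S
    v·w·x₁ = (v′ ∧ w′ ∧ x₁) S
    w·v·x₁ = (w′ ∧ v′ ∧ x₁) S

  -- Anticommutativity gives only twice this statement, and 2 may be a zero divisor in R, so the
  -- cancellation of the two mixed terms is carried out directly.
  ∧-nilpotent : ∀ {n} (v : Vector n) x S → (v ∧ v ∧ x) S ≈ 0#
  ∧-nilpotent v x []          = refl
  ∧-nilpotent v x (false ∷ S) = ∧-nilpotent (v ∘ suc) (x ∘ (false ∷_)) S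
  ∧-nilpotent v x (true ∷ S)  = begin
    v zero * v·x₀ + - (v′ ∧ λ T → v zero * x₀ T + - (v′ ∧ x₁) T) S
      ≈⟨ +-congˡ (-‿cong (∧-true v′ v′ (v zero) x₀ x₁ S)) ⟩
    v zero * v·x₀ + - (v zero * v·x₀ + - (v′ ∧ v′ ∧ x₁) S)
      ≈⟨ solve 2 (λ p q → p :- (p :- q) := q) refl _ _ ⟩
    (v′ ∧ v′ ∧ x₁) S
      ≈⟨ ∧-nilpotent v′ x₁ S ⟩
    0# ∎
    where
    v′ = v ∘ suc
    x₀ = x ∘ (false ∷_)
    x₁ = x ∘ (true ∷_)
    v·x₀ = (v′ ∧ x₀) S

-- Determinants as top exterior powers, and Jacobi's formula.

module Determinant {c ℓ : Level} (R : CommutativeRing c ℓ) where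

  open CommutativeRing R hiding (_-_; zero)
  open Algebra.Properties.Ring ring using (-0#≈0#; +-cancelˡ; +-inverseʳ-unique)
  open Relation.Binary.Reasoning.Setoid setoid
  open IntegerRingSolver R
  open Sums R
  open ExteriorAlgebra R

  ⋀ : ∀ {m n} → (Fin m → Vector n) → Form n
  ⋀ {zero}  C = one
  ⋀ {suc m} C = C zero ∧ ⋀ (C ∘ suc)

  ⋀-cong : ∀ {m n} {C D : Fin m → Vector n} → (∀ k i → C k i ≈ D k i) → ∀ S → ⋀ C S ≈ ⋀ D S
  ⋀-cong {zero}  C≈D S = refl
  ⋀-cong {suc m} {C = C} {D} C≈D S =
    trans (∧-congʳ (⋀ (C ∘ suc)) (C≈D zero) S) (∧-congˡ (D zero) (⋀-cong (C≈D ∘ suc)) S)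

  -- By anticommutativity v moves inwards, changing sign each time, until it stands next to its
  -- copy, where `∧-nilpotent` applies.
  ∧-⋀-repeated : ∀ {m n} (v : Vector n) (C : Fin m → Vector n) k → (∀ i → v i ≈ C k i) →
    ∀ S → (v ∧ ⋀ C) S ≈ 0#
  ∧-⋀-repeated v C zero    v≈Cₖ S =
    trans (∧-congʳ (⋀ C) v≈Cₖ S) (∧-nilpotent (C zero) (⋀ (C ∘ suc)) S)
  ∧-⋀-repeated v C (suc k) v≈Cₖ S = begin
    (v ∧ C zero ∧ ⋀ (C ∘ suc)) S    ≈⟨ ∧-anticomm v (C zero) (⋀ (C ∘ suc)) S ⟩
    - (C zero ∧ v ∧ ⋀ (C ∘ suc)) S  ≈⟨ -‿cong (∧-zeroʳ (C zero) (∧-⋀-repeated v (C ∘ suc) k v≈Cₖ) S) ⟩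
    - 0#                            ≈⟨ -0#≈0# ⟩
    0#                              ∎

  ⋀-alternating : ∀ {m n} (C : Fin m → Vector n) k l → k ≢ l → (∀ i → C k i ≈ C l i) →
    ∀ S → ⋀ C S ≈ 0#
  ⋀-alternating C zero    zero    k≢l eq = contradiction ≡.refl k≢l
  ⋀-alternating C zero    (suc l) k≢l eq = ∧-⋀-repeated (C zero) (C ∘ suc) l eq
  ⋀-alternating C (suc k) zero    k≢l eq = ∧-⋀-repeated (C zero) (C ∘ suc) k (sym ∘ eq)
  ⋀-alternating C (suc k) (suc l) k≢l eq =
    ∧-zeroʳ (C zero) (⋀-alternating (C ∘ suc) k l (k≢l ∘ ≡.cong suc) eq)

  infixl 8 _[_]≔_

  _[_]≔_ : ∀ {m n} → (Fin m → Vector n) → Fin m → Vector n → Fin m → Vector n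
  C [ k ]≔ v = updateAt C k (const v)

  ⋀-update-sum : ∀ {m n p} (C : Fin m → Vector n) k (a : Fin p → Carrier) (D : Fin p → Vector n) S →
    ⋀ (C [ k ]≔ λ i → sum λ l → a l * D l i) S ≈ sum λ l → a l * ⋀ (C [ k ]≔ D l) S
  ⋀-update-sum C zero a D S = trans
    (∧-sumʳ (λ l i → a l * D l i) (⋀ (C ∘ suc)) S)
    (sum-cong-≋ λ l → ∧-scaleʳ (a l) (D l) (⋀ (C ∘ suc)) S)
  ⋀-update-sum C (suc k) a D S = begin
    (C zero ∧ ⋀ ((C ∘ suc) [ k ]≔ λ i → sum λ l → a l * D l i)) S
      ≈⟨ ∧-congˡ (C zero) (⋀-update-sum (C ∘ suc) k a D) S ⟩
    (C zero ∧ λ T → sum λ l → a l * ⋀ ((C ∘ suc) [ k ]≔ D l) T) S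
      ≈⟨ ∧-sumˡ (C zero) (λ l T → a l * ⋀ ((C ∘ suc) [ k ]≔ D l) T) S ⟩
    (sum λ l → (C zero ∧ λ T → a l * ⋀ ((C ∘ suc) [ k ]≔ D l) T) S)
      ≈⟨ sum-cong-≋ (λ l → ∧-scaleˡ (C zero) (a l) (⋀ ((C ∘ suc) [ k ]≔ D l)) S) ⟩
    (sum λ l → a l * (C zero ∧ ⋀ ((C ∘ suc) [ k ]≔ D l)) S) ∎

  ⋀-update-other : ∀ {m n} (C : Fin m → Vector n) k l → l ≢ k → ∀ S → ⋀ (C [ k ]≔ C l) S ≈ 0#
  ⋀-update-other C k l l≢k = ⋀-alternating (C [ k ]≔ C l) k l (l≢k ∘ ≡.sym) λ i →
    reflexive (≡.cong (λ v → v i)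
      (≡.trans (updateAt-updates k C) (≡.sym (updateAt-minimal l k C l≢k))))

  ⋀-update-self : ∀ {m n} (C : Fin m → Vector n) k S → ⋀ (C [ k ]≔ C k) S ≈ ⋀ C S
  ⋀-update-self C zero    S = refl
  ⋀-update-self C (suc k) S = ∧-congˡ (C zero) (⋀-update-self (C ∘ suc) k) S

  sgn : ℕ → Carrier
  sgn zero    = 1#
  sgn (suc m) = - sgn m

  det : ∀ {n} → (Fin n → Fin n → Carrier) → Carrier
  det {zero}  M = 1#
  det {suc n} M = sum λ j → sgn (toℕ j) * M zero j * det (λ i k → M (suc i) (punchIn j k))

  ⋀-false : ∀ {m n} (C : Fin m → Vector (suc n)) S → ⋀ C (false ∷ S) ≈ ⋀ (λ k → C k ∘ suc) S
  ⋀-false {zero}  C S = refl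
  ⋀-false {suc m} C S = ∧-congˡ (C zero ∘ suc) (⋀-false (C ∘ suc)) S

  -- A term containing e₀ takes it from exactly one of the vectors; if that is the j-th, bringing e₀
  -- to the front passes j vectors and costs (-1)^j. This is Laplace expansion along the row of e₀.
  ⋀-true : ∀ {m n} (C : Fin (suc m) → Vector (suc n)) S →
    ⋀ C (true ∷ S) ≈ sum λ j → sgn (toℕ j) * C j zero * ⋀ (λ k i → C (punchIn j k) (suc i)) S
  ⋀-true {m} C S = +-cong
    (trans (*-cong (sym (*-identityˡ (C zero zero))) (⋀-false (C ∘ suc) S)) refl)
    (rest C S)
    where
    rest : ∀ {m n} (C : Fin (suc m) → Vector (suc n)) S →
      - ((C zero ∘ suc) ∧ λ T → ⋀ (C ∘ suc) (true ∷ T)) S ≈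
      sum λ j → - sgn (toℕ j) * C (suc j) zero * ⋀ (λ k i → C (punchIn (suc j) k) (suc i)) S
    rest {zero}  C S = trans (-‿cong (∧-zeroʳ (C zero ∘ suc) (λ _ → refl) S)) -0#≈0#
    rest {suc m} C S = begin
      - (v ∧ λ T → ⋀ (C ∘ suc) (true ∷ T)) S
        ≈⟨ -‿cong (∧-congˡ v (⋀-true (C ∘ suc)) S) ⟩
      - (v ∧ λ T → sum λ j → a j * minor j T) S
        ≈⟨ -‿cong (∧-sumˡ v (λ j T → a j * minor j T) S) ⟩
      - (sum λ j → (v ∧ λ T → a j * minor j T) S)
        ≈⟨ sum-neg (λ j → (v ∧ λ T → a j * minor j T) S) ⟨
      (sum λ j → - (v ∧ λ T → a j * minor j T) S)
        ≈⟨ sum-cong-≋ (λ j → trans (-‿cong (∧-scaleˡ v (a j) (minor j) S))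
             (solve 3 (λ s c x → :- ((s :* c) :* x) := :- s :* c :* x) refl _ _ _)) ⟩
      (sum λ j → - sgn (toℕ j) * C (suc j) zero * (v ∧ minor j) S) ∎
      where
      v = C zero ∘ suc
      a = λ j → sgn (toℕ j) * C (suc j) zero
      minor = λ j → ⋀ λ k i → C (suc (punchIn j k)) (suc i)

  full : ∀ n → Vec Bool n
  full zero    = []
  full (suc n) = true ∷ full n

  -- The determinant is the top coefficient of the wedge of the columns. Multilinearity and
  -- alternation in the columns, which the recursive expansion hides, are immediate for the wedge.
  det≈⋀ : ∀ {n} (M : Fin n → Fin n → Carrier) → det M ≈ ⋀ (λ k i → M i k) (full n)
  det≈⋀ {zero}  M = refl
  det≈⋀ {suc n} M = trans
    (sum-cong-≋ λ j → *-congˡ {x = sgn (toℕ j) * M zero j} (det≈⋀ λ i k → M (suc i) (punchIn j k)))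
    (sym (⋀-true (λ k i → M i k) (full n)))

  module Derivation
    (δ : Carrier → Carrier)
    (δ-cong : ∀ {x y} → x ≈ y → δ x ≈ δ y)
    (δ-+ : ∀ x y → δ (x + y) ≈ δ x + δ y)
    (δ-* : ∀ x y → δ (x * y) ≈ δ x * y + x * δ y)
    where

    δ-zero : δ 0# ≈ 0#
    δ-zero = +-cancelˡ (δ 0#) (δ 0#) 0# (begin
      δ 0# + δ 0#  ≈⟨ δ-+ 0# 0# ⟨
      δ (0# + 0#)  ≈⟨ δ-cong (+-identityʳ 0#) ⟩
      δ 0#         ≈⟨ +-identityʳ (δ 0#) ⟨
      δ 0# + 0#    ∎)

    δ-one : δ 1# ≈ 0#
    δ-one = +-cancelˡ (δ 1#) (δ 1#) 0# (begin
      δ 1# + δ 1#            ≈⟨ +-cong (*-identityʳ (δ 1#)) (*-identityˡ (δ 1#)) ⟨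
      δ 1# * 1# + 1# * δ 1#  ≈⟨ δ-* 1# 1# ⟨
      δ (1# * 1#)            ≈⟨ δ-cong (*-identityʳ 1#) ⟩
      δ 1#                   ≈⟨ +-identityʳ (δ 1#) ⟨
      δ 1# + 0#              ∎)

    δ-neg : ∀ x → δ (- x) ≈ - δ x
    δ-neg x = +-inverseʳ-unique (δ x) (δ (- x)) (begin
      δ x + δ (- x)  ≈⟨ δ-+ x (- x) ⟨
      δ (x + - x)    ≈⟨ δ-cong (-‿inverseʳ x) ⟩
      δ 0#           ≈⟨ δ-zero ⟩
      0#             ∎)

    δ-form : ∀ {n} S → δ (one {n} S) ≈ 0#
    δ-form []          = δ-one
    δ-form (false ∷ S) = δ-form S
    δ-form (true ∷ S)  = δ-zero

    δ-∧ : ∀ {n} (v : Vector n) x S → δ ((v ∧ x) S) ≈ ((δ ∘ v) ∧ x) S + (v ∧ (δ ∘ x)) S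
    δ-∧ v x []          = trans δ-zero (sym (+-identityʳ 0#))
    δ-∧ v x (false ∷ S) = δ-∧ (v ∘ suc) (x ∘ (false ∷_)) S
    δ-∧ v x (true ∷ S)  = begin
      δ (v zero * x (false ∷ S) + - (v′ ∧ x₁) S)
        ≈⟨ δ-+ _ _ ⟩
      δ (v zero * x (false ∷ S)) + δ (- (v′ ∧ x₁) S)
        ≈⟨ +-cong (δ-* _ _) (trans (δ-neg _) (-‿cong (δ-∧ v′ x₁ S))) ⟩
      (δ (v zero) * x (false ∷ S) + v zero * δ (x (false ∷ S))) +
        - (((δ ∘ v′) ∧ x₁) S + (v′ ∧ (δ ∘ x₁)) S)
        ≈⟨ solve 4 (λ a b p q → (a :+ b) :- (p :+ q) := (a :- p) :+ (b :- q)) refl _ _ _ _ ⟩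
      (δ (v zero) * x (false ∷ S) + - ((δ ∘ v′) ∧ x₁) S) +
        (v zero * δ (x (false ∷ S)) + - (v′ ∧ (δ ∘ x₁)) S) ∎
      where
      v′ = v ∘ suc
      x₁ = x ∘ (true ∷_)

    δ-⋀ : ∀ {m n} (C : Fin m → Vector n) S → δ (⋀ C S) ≈ sum λ k → ⋀ (C [ k ]≔ (δ ∘ C k)) S
    δ-⋀ {zero}  C S = δ-form S
    δ-⋀ {suc m} C S = begin
      δ ((C zero ∧ ⋀ (C ∘ suc)) S)
        ≈⟨ δ-∧ (C zero) (⋀ (C ∘ suc)) S ⟩
      ((δ ∘ C zero) ∧ ⋀ (C ∘ suc)) S + (C zero ∧ (δ ∘ ⋀ (C ∘ suc))) S
        ≈⟨ +-congˡ (∧-congˡ (C zero) (δ-⋀ (C ∘ suc)) S) ⟩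
      ((δ ∘ C zero) ∧ ⋀ (C ∘ suc)) S +
        (C zero ∧ λ T → sum λ k → ⋀ ((C ∘ suc) [ k ]≔ (δ ∘ C (suc k))) T) S
        ≈⟨ +-congˡ (∧-sumˡ (C zero) (λ k → ⋀ ((C ∘ suc) [ k ]≔ (δ ∘ C (suc k)))) S) ⟩
      ((δ ∘ C zero) ∧ ⋀ (C ∘ suc)) S +
        (sum λ k → (C zero ∧ ⋀ ((C ∘ suc) [ k ]≔ (δ ∘ C (suc k)))) S) ∎

    -- The hypothesis δM = M K replaces K = M⁻¹ δM, so no inverse or adjugate occurs.
    -- Differentiating one column at a time puts Σ_l K_lk · (column l) in place of column k; every l
    -- ≠ k repeats a column and vanishes, which leaves K_kk det M.
    jacobi : ∀ {n} (M K : Fin n → Fin n → Carrier) →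
      (∀ i j → δ (M i j) ≈ sum λ l → M i l * K l j) →
      δ (det M) ≈ det M * sum λ i → K i i
    jacobi {n} M K δM≈MK = begin
      δ (det M)
        ≈⟨ δ-cong (det≈⋀ M) ⟩
      δ (⋀ C (full n))
        ≈⟨ δ-⋀ C (full n) ⟩
      (sum λ k → ⋀ (C [ k ]≔ (δ ∘ C k)) (full n))
        ≈⟨ sum-cong-≋ column ⟩
      (sum λ k → ⋀ C (full n) * K k k)
        ≈⟨ *-distribˡ-sum (⋀ C (full n)) (λ k → K k k) ⟨
      ⋀ C (full n) * (sum λ k → K k k)
        ≈⟨ *-congʳ (det≈⋀ M) ⟨
      det M * (sum λ k → K k k) ∎
      where
      C : Fin n → Vector n
      C k i = M i k

      update-cong : ∀ {m} (C : Fin m → Vector n) k {v w : Vector n} → (∀ i → v i ≈ w i) →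
        ∀ S → ⋀ (C [ k ]≔ v) S ≈ ⋀ (C [ k ]≔ w) S
      update-cong C zero    v≈w S = ∧-congʳ (⋀ (C ∘ suc)) v≈w S
      update-cong C (suc k) v≈w S = ∧-congˡ (C zero) (update-cong (C ∘ suc) k v≈w) S

      column : ∀ k → ⋀ (C [ k ]≔ (δ ∘ C k)) (full n) ≈ ⋀ C (full n) * K k k
      column k = begin
        ⋀ (C [ k ]≔ (δ ∘ C k)) (full n)
          ≈⟨ update-cong C k (λ i → trans (δM≈MK i k) (sum-cong-≋ λ l → *-comm (M i l) (K l k))) (full n) ⟩
        ⋀ (C [ k ]≔ λ i → sum λ l → K l k * C l i) (full n)
          ≈⟨ ⋀-update-sum C k (λ l → K l k) C (full n) ⟩
        (sum λ l → K l k * ⋀ (C [ k ]≔ C l) (full n))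
          ≈⟨ sum-single _ k (λ l l≢k →
               trans (*-congˡ (⋀-update-other C k l l≢k (full n))) (zeroʳ (K l k))) ⟩
        K k k * ⋀ (C [ k ]≔ C k) (full n)
          ≈⟨ *-congˡ (⋀-update-self C k (full n)) ⟩
        K k k * ⋀ C (full n)
          ≈⟨ *-comm (K k k) (⋀ C (full n)) ⟩
        ⋀ C (full n) * K k k ∎

    -- The counterpart of `jacobi` for a product of scalars, in the same form, so that both sides of
    -- the factorisation of det (1 - zL) can be differentiated and compared.
    logarithmicDerivative : ∀ {n} (f g : Fin n → Carrier) → (∀ i → δ (f i) ≈ f i * g i) →
      δ (product f) ≈ product f * sum g
    logarithmicDerivative {zero}  f g δf≈fg = trans δ-one (sym (zeroʳ 1#))
    logarithmicDerivative {suc n} f g δf≈fg = begin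
      δ (f zero * product (f ∘ suc))
        ≈⟨ δ-* _ _ ⟩
      δ (f zero) * product (f ∘ suc) + f zero * δ (product (f ∘ suc))
        ≈⟨ +-cong (*-congʳ (δf≈fg zero))
             (*-congˡ (logarithmicDerivative (f ∘ suc) (g ∘ suc) (δf≈fg ∘ suc))) ⟩
      f zero * g zero * product (f ∘ suc) + f zero * (product (f ∘ suc) * sum (g ∘ suc))
        ≈⟨ solve 4 (λ a b p s → a :* b :* p :+ a :* (p :* s) := a :* p :* (b :+ s)) refl _ _ _ _ ⟩
      f zero * product (f ∘ suc) * (g zero + sum (g ∘ suc)) ∎

-- The ring of formal power series.

module PowerSeries {c ℓ : Level} (R : CommutativeRing c ℓ) where

  open CommutativeRing R hiding (_-_; zero)
  open Algebra.Properties.Semiring.Mult semiring using () renaming (_×_ to _·_)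
  open Relation.Binary.Reasoning.Setoid setoid
  open IntegerRingSolver R

  Series : Set c
  Series = ℕ → Carrier

  infix  4 _≋_
  infixl 6 _⊕_
  infixl 7 _⊛_

  _≋_ : Series → Series → Set ℓ
  f ≋ g = ∀ n → f n ≈ g n

  0ˢ 1ˢ : Series
  0ˢ _ = 0#
  1ˢ zero    = 1#
  1ˢ (suc _) = 0#

  _⊕_ _⊛_ : Series → Series → Series
  (f ⊕ g) n = f n + g n
  (f ⊛ g) zero    = f zero * g zero
  (f ⊛ g) (suc n) = f zero * g (suc n) + (f ∘ suc ⊛ g) n

  ⊖_ : Series → Series
  (⊖ f) n = - f n

  ⊛-cong : ∀ {f f′ g g′} → f ≋ f′ → g ≋ g′ → f ⊛ g ≋ f′ ⊛ g′
  ⊛-cong f≋f′ g≋g′ zero    = *-cong (f≋f′ zero) (g≋g′ zero)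
  ⊛-cong f≋f′ g≋g′ (suc n) =
    +-cong (*-cong (f≋f′ zero) (g≋g′ (suc n))) (⊛-cong (f≋f′ ∘ suc) g≋g′ n)

  -- The product recurses on its left factor; commutativity needs the same recursion on the right
  -- one.
  ⊛-sucʳ : ∀ f g n → (f ⊛ g) (suc n) ≈ (f ⊛ (g ∘ suc)) n + f (suc n) * g zero
  ⊛-sucʳ f g zero    = refl
  ⊛-sucʳ f g (suc n) = trans (+-congˡ (⊛-sucʳ (f ∘ suc) g n)) (sym (+-assoc _ _ _))

  ⊛-comm : ∀ f g → f ⊛ g ≋ g ⊛ f
  ⊛-comm f g zero    = *-comm (f zero) (g zero)
  ⊛-comm f g (suc n) = begin
    f zero * g (suc n) + (f ∘ suc ⊛ g) n  ≈⟨ +-cong (*-comm _ _) (⊛-comm (f ∘ suc) g n) ⟩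
    g (suc n) * f zero + (g ⊛ f ∘ suc) n  ≈⟨ +-comm _ _ ⟩
    (g ⊛ f ∘ suc) n + g (suc n) * f zero  ≈⟨ ⊛-sucʳ g f n ⟨
    (g ⊛ f) (suc n)                       ∎

  ⊛-zeroˡ : ∀ {f} → f ≋ 0ˢ → ∀ g → f ⊛ g ≋ 0ˢ
  ⊛-zeroˡ f≋0 g zero    = trans (*-congʳ (f≋0 zero)) (zeroˡ (g zero))
  ⊛-zeroˡ f≋0 g (suc n) = trans
    (+-cong (trans (*-congʳ (f≋0 zero)) (zeroˡ (g (suc n)))) (⊛-zeroˡ (f≋0 ∘ suc) g n))
    (+-identityʳ 0#)

  ⊛-identityˡ : ∀ f → 1ˢ ⊛ f ≋ f
  ⊛-identityˡ f zero    = *-identityˡ (f zero)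
  ⊛-identityˡ f (suc n) = trans
    (+-cong (*-identityˡ (f (suc n))) (⊛-zeroˡ (λ _ → refl) f n))
    (+-identityʳ (f (suc n)))

  ⊛-distribʳ : ∀ h f g → (f ⊕ g) ⊛ h ≋ (f ⊛ h) ⊕ (g ⊛ h)
  ⊛-distribʳ h f g zero    = distribʳ (h zero) (f zero) (g zero)
  ⊛-distribʳ h f g (suc n) = trans
    (+-congˡ (⊛-distribʳ h (f ∘ suc) (g ∘ suc) n))
    (solve 5 (λ x y z p q → (x :+ y) :* z :+ (p :+ q) := (x :* z :+ p) :+ (y :* z :+ q))
      refl _ _ _ _ _)

  ⊛-scale : ∀ a f g n → ((λ i → a * f i) ⊛ g) n ≈ a * (f ⊛ g) n
  ⊛-scale a f g zero    = *-assoc a (f zero) (g zero)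
  ⊛-scale a f g (suc n) = trans
    (+-congˡ (⊛-scale a (f ∘ suc) g n))
    (solve 4 (λ a x y p → a :* x :* y :+ a :* p := a :* (x :* y :+ p)) refl _ _ _ _)

  ⊛-assoc : ∀ f g h → (f ⊛ g) ⊛ h ≋ f ⊛ (g ⊛ h)
  ⊛-assoc f g h zero    = *-assoc (f zero) (g zero) (h zero)
  ⊛-assoc f g h (suc n) = begin
    f zero * g zero * h (suc n) + (((λ i → f zero * g (suc i)) ⊕ (f ∘ suc ⊛ g)) ⊛ h) n
      ≈⟨ +-congˡ (⊛-distribʳ h (λ i → f zero * g (suc i)) (f ∘ suc ⊛ g) n) ⟩
    f zero * g zero * h (suc n) + (((λ i → f zero * g (suc i)) ⊛ h) n + ((f ∘ suc ⊛ g) ⊛ h) n)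
      ≈⟨ +-congˡ (+-cong (⊛-scale (f zero) (g ∘ suc) h n) (⊛-assoc (f ∘ suc) g h n)) ⟩
    f zero * g zero * h (suc n) + (f zero * (g ∘ suc ⊛ h) n + (f ∘ suc ⊛ (g ⊛ h)) n)
      ≈⟨ solve 5 (λ x y z p q → x :* y :* z :+ (x :* p :+ q) := x :* (y :* z :+ p) :+ q)
           refl _ _ _ _ _ ⟩
    f zero * (g zero * h (suc n) + (g ∘ suc ⊛ h) n) + (f ∘ suc ⊛ (g ⊛ h)) n ∎

  seriesRing : CommutativeRing c ℓ
  seriesRing = record
    { Carrier = Series
    ; _≈_ = _≋_
    ; _+_ = _⊕_
    ; _*_ = _⊛_
    ; -_  = ⊖_
    ; 0#  = 0ˢ
    ; 1#  = 1ˢ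
    ; isCommutativeRing = record
      { isRing = record
        { +-isAbelianGroup = record
          { isGroup = record
            { isMonoid = record
              { isSemigroup = record
                { isMagma = record
                  { isEquivalence = record
                    { refl  = λ _ → refl
                    ; sym   = λ f≋g n → sym (f≋g n)
                    ; trans = λ f≋g g≋h n → trans (f≋g n) (g≋h n)
                    }
                  ; ∙-cong = λ f≋f′ g≋g′ n → +-cong (f≋f′ n) (g≋g′ n)
                  }
                ; assoc = λ f g h n → +-assoc (f n) (g n) (h n)
                }
              ; identity = (λ f n → +-identityˡ (f n)) , (λ f n → +-identityʳ (f n))
              }
            ; inverse = (λ f n → -‿inverseˡ (f n)) , (λ f n → -‿inverseʳ (f n))
            ; ⁻¹-cong = λ f≋g n → -‿cong (f≋g n)
            }
          ; comm = λ f g n → +-comm (f n) (g n)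
          }
        ; *-cong = ⊛-cong
        ; *-assoc = ⊛-assoc
        ; *-identity = ⊛-identityˡ , λ f n → trans (⊛-comm f 1ˢ n) (⊛-identityˡ f n)
        ; distrib = (λ f g h n → trans (⊛-comm f (g ⊕ h) n) (trans (⊛-distribʳ f g h n)
                       (+-cong (⊛-comm g f n) (⊛-comm h f n)))) , ⊛-distribʳ
        }
      ; *-comm = ⊛-comm
      }
    }

  -- The constant term of the product is that of g, hence 0. Then g is a shift of `g ∘ suc`, to
  -- which the same argument applies. The product is commuted first because the recursion of `⊛`
  -- peels its left factor.
  ⊛-cancelˡ-zero : ∀ f g → f zero ≈ 1# → f ⊛ g ≋ 0ˢ → g ≋ 0ˢ
  ⊛-cancelˡ-zero f g f₀≈1 fg≋0 = go g λ n → trans (⊛-comm g f n) (fg≋0 n)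
    where
    head≈0 : ∀ g → g ⊛ f ≋ 0ˢ → g zero ≈ 0#
    head≈0 g gf≋0 = begin
      g zero           ≈⟨ *-identityʳ (g zero) ⟨
      g zero * 1#      ≈⟨ *-congˡ f₀≈1 ⟨
      g zero * f zero  ≈⟨ gf≋0 zero ⟩
      0#               ∎

    go : ∀ g → g ⊛ f ≋ 0ˢ → g ≋ 0ˢ
    go g gf≋0 zero    = head≈0 g gf≋0
    go g gf≋0 (suc n) = go (g ∘ suc) tail n
      where
      tail : g ∘ suc ⊛ f ≋ 0ˢ
      tail n = begin
        (g ∘ suc ⊛ f) n                       ≈⟨ +-identityˡ _ ⟨
        0# + (g ∘ suc ⊛ f) n                  ≈⟨ +-congʳ (zeroˡ (f (suc n))) ⟨
        0# * f (suc n) + (g ∘ suc ⊛ f) n      ≈⟨ +-congʳ (*-congʳ (head≈0 g gf≋0)) ⟨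
        g zero * f (suc n) + (g ∘ suc ⊛ f) n  ≈⟨ gf≋0 (suc n) ⟩
        0#                                    ∎

  -- The derivation z d/dz.
  θ : Series → Series
  θ f n = (n · 1#) * f n

  θ-cong : ∀ {f g} → f ≋ g → θ f ≋ θ g
  θ-cong f≋g n = *-congˡ (f≋g n)

  θ-⊕ : ∀ f g → θ (f ⊕ g) ≋ θ f ⊕ θ g
  θ-⊕ f g n = distribˡ (n · 1#) (f n) (g n)

  θ-⊛ : ∀ f g → θ (f ⊛ g) ≋ (θ f ⊛ g) ⊕ (f ⊛ θ g)
  θ-⊛ f g zero    = begin
    0# * (f zero * g zero)                       ≈⟨ zeroˡ _ ⟩
    0#                                           ≈⟨ +-identityʳ 0# ⟨
    0# + 0#                                      ≈⟨ +-cong (zeroˡ (g zero)) (zeroʳ (f zero)) ⟨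
    0# * g zero + f zero * 0#                    ≈⟨ +-cong (*-congʳ (zeroˡ (f zero))) (*-congˡ (zeroˡ (g zero))) ⟨
    0# * f zero * g zero + f zero * (0# * g zero) ∎
  θ-⊛ f g (suc n) = begin
    (1# + m) * (a * b + p)
      ≈⟨ solve 4 (λ o m q p → (o :+ m) :* (q :+ p) := (o :+ m) :* q :+ o :* p :+ m :* p)
           refl 1# m (a * b) p ⟩
    (1# + m) * (a * b) + 1# * p + m * p
      ≈⟨ +-cong (+-congˡ (*-identityˡ p)) (θ-⊛ (f ∘ suc) g n) ⟩
    (1# + m) * (a * b) + p + (u + v)
      ≈⟨ solve 6 (λ k a b p u v → k :* (a :* b) :+ p :+ (u :+ v) := (p :+ u) :+ (a :* (k :* b) :+ v))
           refl (1# + m) a b p u v ⟩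
    (p + u) + (a * ((1# + m) * b) + v)
      ≈⟨ +-congʳ (trans (⊛-cong {g = g} shift (λ _ → refl) n) (⊛-distribʳ g (f ∘ suc) (θ (f ∘ suc)) n)) ⟨
    (θ f ∘ suc ⊛ g) n + (a * ((1# + m) * b) + v)
      ≈⟨ +-congʳ (+-identityˡ _) ⟨
    (0# + (θ f ∘ suc ⊛ g) n) + (a * ((1# + m) * b) + v)
      ≈⟨ +-congʳ (+-congʳ (trans (*-congʳ (zeroˡ a)) (zeroˡ b))) ⟨
    (0# * a * b + (θ f ∘ suc ⊛ g) n) + (a * ((1# + m) * b) + v) ∎
    where
    m = n · 1#
    a = f zero
    b = g (suc n)
    p = (f ∘ suc ⊛ g) n
    u = (θ (f ∘ suc) ⊛ g) n
    v = (f ∘ suc ⊛ θ g) n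

    -- Dropping the constant term divides by z, and θ (z h) = z (h + θ h).
    shift : θ f ∘ suc ≋ (f ∘ suc) ⊕ θ (f ∘ suc)
    shift k = trans (distribʳ (f (suc k)) 1# (k · 1#)) (+-congʳ (*-identityˡ (f (suc k))))

-- Matrix products, powers and traces.

module Matrices {c ℓ : Level} (R : CommutativeRing c ℓ) where

  open CommutativeRing R hiding (_-_; zero)
  open Sums R

  Square : ℕ → Set c
  Square n = Fin n → Fin n → Carrier

  1ᴹ : ∀ {n} → Square n
  1ᴹ zero    zero    = 1#
  1ᴹ zero    (suc j) = 0#
  1ᴹ (suc i) zero    = 0#
  1ᴹ (suc i) (suc j) = 1ᴹ i j

  infixl 7 _*ᴹ_
  infixr 8 _^ᴹ_

  _*ᴹ_ : ∀ {m n p} → (Fin m → Fin n → Carrier) → (Fin n → Fin p → Carrier) → Fin m → Fin p → Carrier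
  (A *ᴹ B) i j = sum λ k → A i k * B k j

  _^ᴹ_ : ∀ {n} → Square n → ℕ → Square n
  A ^ᴹ zero  = 1ᴹ
  A ^ᴹ suc q = A *ᴹ A ^ᴹ q

  trace : ∀ {n} → Square n → Carrier
  trace A = sum λ i → A i i

  1ᴹ-diagonal : ∀ {n} (i : Fin n) → 1ᴹ i i ≈ 1#
  1ᴹ-diagonal zero    = refl
  1ᴹ-diagonal (suc i) = 1ᴹ-diagonal i

  1ᴹ-offDiagonal : ∀ {n} {i j : Fin n} → i ≢ j → 1ᴹ i j ≈ 0#
  1ᴹ-offDiagonal {i = zero}  {zero}  i≢j = contradiction ≡.refl i≢j
  1ᴹ-offDiagonal {i = zero}  {suc j} i≢j = refl
  1ᴹ-offDiagonal {i = suc i} {zero}  i≢j = refl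
  1ᴹ-offDiagonal {i = suc i} {suc j} i≢j = 1ᴹ-offDiagonal (i≢j ∘ ≡.cong suc)

  *ᴹ-identityˡ : ∀ {m n} (A : Fin m → Fin n → Carrier) i j → (1ᴹ *ᴹ A) i j ≈ A i j
  *ᴹ-identityˡ A i j = trans
    (sum-single _ i λ k k≢i → trans (*-congʳ (1ᴹ-offDiagonal (k≢i ∘ ≡.sym))) (zeroˡ (A k j)))
    (trans (*-congʳ (1ᴹ-diagonal i)) (*-identityˡ (A i j)))

  *ᴹ-identityʳ : ∀ {m n} (A : Fin m → Fin n → Carrier) i j → (A *ᴹ 1ᴹ) i j ≈ A i j
  *ᴹ-identityʳ A i j = trans
    (sum-single _ j λ k k≢j → trans (*-congˡ (1ᴹ-offDiagonal k≢j)) (zeroʳ (A i k)))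
    (trans (*-congˡ (1ᴹ-diagonal j)) (*-identityʳ (A i j)))

-- Power traces from the factorised characteristic polynomial.

-- If det (1 − zL) = Π (1 − z μᵢ), comparing logarithmic derivatives gives
-- tr L^q = Σ μᵢ^q, because z L (1 − zL)⁻¹ is the series of positive powers of L.
module PowerTraces {c ℓ : Level} (R : CommutativeRing c ℓ) where

  open CommutativeRing R hiding (_-_; zero)
  open Algebra.Properties.CommutativeSemiring.Exp commutativeSemiring using (_^_)
  open Algebra.Properties.Ring ring using (-‿distribˡ-*; -‿distribʳ-*; -0#≈0#; x∙y⁻¹≈ε⇒x≈y; -‿injective)
  open Relation.Binary.Reasoning.Setoid setoid
  open IntegerRingSolver R
  open Sums R
  open Matrices R
  open PowerSeries R
  private
    module Ŝ = Sums seriesRing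
    module D̂ = Determinant seriesRing
    module R̂ = CommutativeRing seriesRing
    module Ŝolver = IntegerRingSolver seriesRing

  open D̂.Derivation θ θ-cong θ-⊕ θ-⊛

  sum-coefficient : ∀ {n} (f : Fin n → Series) q → Ŝ.sum f q ≈ sum λ i → f i q
  sum-coefficient {zero}  f q = refl
  sum-coefficient {suc n} f q = +-congˡ (sum-coefficient (f ∘ suc) q)

  -- The series a − b z.
  linear : Carrier → Carrier → Series
  linear a b zero          = a
  linear a b (suc zero)    = - b
  linear a b (suc (suc _)) = 0#

  linear-⊛ : ∀ a b f q → (linear a b ⊛ f) (suc q) ≈ a * f (suc q) + - b * f q
  linear-⊛ a b f zero    = refl
  linear-⊛ a b f (suc q) =
    +-congˡ (trans (+-congˡ (⊛-zeroˡ (λ _ → refl) f q)) (+-identityʳ (- b * f (suc q))))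

  1-z_ : ∀ {n} → Square n → Fin n → Fin n → Series
  (1-z L) i j = linear (1ᴹ i j) (L i j)

  -- This is -zL (1 - zL)⁻¹ expanded as -Σ_{q ≥ 1} L^q z^q, the logarithmic derivative of 1 - zL
  -- under θ. It serves as the matrix K of `jacobi`.
  logSeries : ∀ {n} → Square n → Fin n → Fin n → Series
  logSeries L i j zero    = 0#
  logSeries L i j (suc q) = - (L ^ᴹ suc q) i j

  -- The product of 1 - zL with -Σ_{q ≥ 1} L^q z^q telescopes to -zL, which is θ (1 - zL).
  θ-matrix : ∀ {n} (L : Square n) i j →
    θ ((1-z L) i j) ≋ Ŝ.sum λ l → (1-z L) i l ⊛ logSeries L l j
  θ-matrix L i j q = trans (go q) (sym (sum-coefficient (λ l → (1-z L) i l ⊛ logSeries L l j) q))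
    where
    go : ∀ q → θ ((1-z L) i j) q ≈ sum λ l → ((1-z L) i l ⊛ logSeries L l j) q
    go zero = trans (zeroˡ (1ᴹ i j)) (sym (sum-zero λ l → zeroʳ (1ᴹ i l)))
    go (suc q) = begin
      θ ((1-z L) i j) (suc q)
        ≈⟨ coefficient q ⟩
      - (L ^ᴹ suc q) i j + - (L *ᴹ λ l j → logSeries L l j q) i j
        ≈⟨ +-cong (trans (-‿cong (sym (*ᴹ-identityˡ (L ^ᴹ suc q) i j))) (sym (sum-neg λ l → 1ᴹ i l * (L ^ᴹ suc q) l j)))
                  (sym (sum-neg λ l → L i l * logSeries L l j q)) ⟩
      (sum λ l → - (1ᴹ i l * (L ^ᴹ suc q) l j)) + (sum λ l → - (L i l * logSeries L l j q))
        ≈⟨ ∑-distrib-+ (λ l → - (1ᴹ i l * (L ^ᴹ suc q) l j)) _ ⟨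
      (sum λ l → - (1ᴹ i l * (L ^ᴹ suc q) l j) + - (L i l * logSeries L l j q))
        ≈⟨ sum-cong-≋ (λ l → trans (+-cong (-‿distribʳ-* _ _) (-‿distribˡ-* _ _))
             (sym (linear-⊛ (1ᴹ i l) (L i l) (logSeries L l j) q))) ⟩
      (sum λ l → ((1-z L) i l ⊛ logSeries L l j) (suc q)) ∎
      where
      coefficient : ∀ q → θ ((1-z L) i j) (suc q) ≈
        - (L ^ᴹ suc q) i j + - (L *ᴹ λ l j → logSeries L l j q) i j
      coefficient zero = begin
        (1# + 0#) * - L i j   ≈⟨ trans (*-congʳ (+-identityʳ 1#)) (*-identityˡ (- L i j)) ⟩
        - L i j               ≈⟨ -‿cong (*ᴹ-identityʳ L i j) ⟨
        - (L *ᴹ 1ᴹ) i j       ≈⟨ +-identityʳ _ ⟨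
        - (L *ᴹ 1ᴹ) i j + 0#  ≈⟨ +-congˡ (trans (-‿cong (sum-zero λ l → zeroʳ (L i l))) -0#≈0#) ⟨
        - (L *ᴹ 1ᴹ) i j + - (sum λ l → L i l * 0#) ∎
      coefficient (suc q) = begin
        _ * 0#                                            ≈⟨ zeroʳ _ ⟩
        0#                                                ≈⟨ -‿inverseʳ _ ⟨
        - L² + - - L²                                     ≈⟨ +-congˡ (-‿cong (trans (sym (sum-neg λ l → L i l * (L ^ᴹ suc q) l j))
                                                               (sum-cong-≋ λ l → -‿distribʳ-* (L i l) _))) ⟩
        - L² + - (sum λ l → L i l * - (L ^ᴹ suc q) l j)   ∎
        where L² = (L ^ᴹ suc (suc q)) i j

  logScalar : Carrier → Series
  logScalar x zero    = 0#
  logScalar x (suc q) = - x ^ suc q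

  θ-scalar : ∀ x → θ (linear 1# x) ≋ linear 1# x ⊛ logScalar x
  θ-scalar x zero          = trans (zeroˡ 1#) (sym (zeroʳ 1#))
  θ-scalar x (suc zero)    = begin
    (1# + 0#) * - x               ≈⟨ trans (*-congʳ (+-identityʳ 1#)) (*-congˡ (-‿cong (sym (*-identityʳ x)))) ⟩
    1# * - (x * 1#)               ≈⟨ trans (+-congˡ (zeroʳ (- x))) (+-identityʳ _) ⟨
    1# * - (x * 1#) + - x * 0#    ∎
  θ-scalar x (suc (suc q)) = begin
    _ * 0#                                         ≈⟨ zeroʳ _ ⟩
    0#                                             ≈⟨ -‿inverseʳ _ ⟨
    - (x * x ^ suc q) + - - (x * x ^ suc q)
      ≈⟨ +-cong (sym (*-identityˡ _)) (solve 2 (λ x y → :- :- (x :* y) := :- x :* :- y) refl x (x ^ suc q)) ⟩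
    1# * - (x * x ^ suc q) + - x * - (x ^ suc q)
      ≈⟨ linear-⊛ 1# x (logScalar x) (suc q) ⟨
    (linear 1# x ⊛ logScalar x) (suc (suc q))      ∎

  product-head : ∀ {n} (μ : Fin n → Carrier) → Ŝ.product (λ i → linear 1# (μ i)) 0 ≈ 1#
  product-head {zero}  μ = refl
  product-head {suc n} μ = trans (*-identityˡ _) (product-head (μ ∘ suc))

  trace-^ : ∀ {n} (L : Square n) (μ : Fin n → Carrier) →
    D̂.det (1-z L) ≋ Ŝ.product (λ i → linear 1# (μ i)) →
    ∀ q → trace (L ^ᴹ q) ≈ sum λ i → μ i ^ q
  -- A logarithmic derivative has no constant term and says nothing about q = 0; there both sides
  -- count to n.
  trace-^ {n} L μ χ zero    = sum-cong-≋ {n} λ i → 1ᴹ-diagonal i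
  trace-^ {n} L μ χ (suc q) = -‿injective (begin
    - trace (L ^ᴹ suc q)             ≈⟨ sum-neg (λ i → (L ^ᴹ suc q) i i) ⟨
    (sum λ i → - (L ^ᴹ suc q) i i)   ≈⟨ sum-coefficient (λ i → logSeries L i i) (suc q) ⟨
    Ŝ.sum (λ i → logSeries L i i) (suc q)   ≈⟨ x∙y⁻¹≈ε⇒x≈y _ _ (⊛-cancelˡ-zero Π (tr ⊕ (⊖ ps)) (product-head μ) Π*difference≋0 (suc q)) ⟩
    Ŝ.sum (λ i → logScalar (μ i)) (suc q)   ≈⟨ sum-coefficient (λ i → logScalar (μ i)) (suc q) ⟩
    (sum λ i → - μ i ^ suc q)        ≈⟨ sum-neg (λ i → μ i ^ suc q) ⟩
    - (sum λ i → μ i ^ suc q)        ∎)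
    where
    Π tr ps : Series
    Π  = Ŝ.product λ i → linear 1# (μ i)
    tr = Ŝ.sum λ i → logSeries L i i
    ps = Ŝ.sum λ i → logScalar (μ i)

    -- Both sides are θ of the same series, evaluated once by `jacobi` and once by
    -- `logarithmicDerivative`.
    Π*tr≋Π*ps : Π ⊛ tr ≋ Π ⊛ ps
    Π*tr≋Π*ps = R̂.trans (R̂.*-congʳ {tr} {Π} {D̂.det (1-z L)} (R̂.sym {D̂.det (1-z L)} {Π} χ))
      (R̂.trans (R̂.sym {θ (D̂.det (1-z L))} (jacobi (1-z L) (logSeries L) (θ-matrix L)))
      (R̂.trans (θ-cong χ) (logarithmicDerivative (λ i → linear 1# (μ i)) (λ i → logScalar (μ i)) (θ-scalar ∘ μ))))

    Π*difference≋0 : Π ⊛ (tr ⊕ (⊖ ps)) ≋ 0ˢ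
    Π*difference≋0 q = begin
      (Π ⊛ (tr ⊕ (⊖ ps))) q        ≈⟨ Ŝolver.solve 3 (λ p x y → p Ŝolver.:* (x Ŝolver.:- y) Ŝolver.:= p Ŝolver.:* x Ŝolver.:- p Ŝolver.:* y) (λ _ → refl) Π tr ps q ⟩
      (Π ⊛ tr) q + - (Π ⊛ ps) q    ≈⟨ +-congʳ (Π*tr≋Π*ps q) ⟩
      (Π ⊛ ps) q + - (Π ⊛ ps) q    ≈⟨ -‿inverseʳ _ ⟩
      0#                           ∎

-- Polynomials: from values to coefficients.

module Polynomials {c ℓ : Level} (R : CommutativeRing c ℓ) where

  open CommutativeRing R hiding (_-_; zero)
  open Algebra.Properties.CommutativeSemiring.Exp commutativeSemiring using (_^_)
  open Algebra.Properties.Ring ring using (x∙y⁻¹≈ε⇒x≈y; -1*x≈-x)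
  open Relation.Binary.Reasoning.Setoid setoid
  open IntegerRingSolver R
  open Sums R
  open Matrices R
  open PowerSeries R
  open PowerTraces R using (linear; 1-z_; trace-^)
  open Determinant R using (sgn; det)
  private
    module Ŝ = Sums seriesRing
    module D̂ = Determinant seriesRing

  Polynomial : Set c
  Polynomial = List Carrier

  ev : Polynomial → Carrier → Carrier
  ev []      x = 0#
  ev (a ∷ p) x = a + x * ev p x

  coefficient : Polynomial → Series
  coefficient []      _       = 0#
  coefficient (a ∷ p) zero    = a
  coefficient (a ∷ p) (suc n) = coefficient p n

  infixl 6 _+ₚ_
  infixl 7 _*ₚ_

  _+ₚ_ _*ₚ_ : Polynomial → Polynomial → Polynomial
  []      +ₚ q       = q
  (a ∷ p) +ₚ []      = a ∷ p
  (a ∷ p) +ₚ (b ∷ q) = a + b ∷ p +ₚ q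

  scale : Carrier → Polynomial → Polynomial
  scale a = map (a *_)

  []      *ₚ q = []
  (a ∷ p) *ₚ q = scale a q +ₚ (0# ∷ p *ₚ q)

  ev-cong : ∀ p {x y} → x ≈ y → ev p x ≈ ev p y
  ev-cong []      x≈y = refl
  ev-cong (a ∷ p) x≈y = +-congˡ (*-cong x≈y (ev-cong p x≈y))

  ev-+ : ∀ p q x → ev (p +ₚ q) x ≈ ev p x + ev q x
  ev-+ []      q       x = sym (+-identityˡ (ev q x))
  ev-+ (a ∷ p) []      x = sym (+-identityʳ _)
  ev-+ (a ∷ p) (b ∷ q) x = trans (+-congˡ (*-congˡ (ev-+ p q x)))
    (solve 5 (λ a b x p q → a :+ b :+ x :* (p :+ q) := (a :+ x :* p) :+ (b :+ x :* q)) refl _ _ _ _ _)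

  ev-scale : ∀ a p x → ev (scale a p) x ≈ a * ev p x
  ev-scale a []      x = sym (zeroʳ a)
  ev-scale a (b ∷ p) x = trans (+-congˡ (*-congˡ (ev-scale a p x)))
    (solve 4 (λ a b x p → a :* b :+ x :* (a :* p) := a :* (b :+ x :* p)) refl _ _ _ _)

  ev-* : ∀ p q x → ev (p *ₚ q) x ≈ ev p x * ev q x
  ev-* []      q x = sym (zeroˡ (ev q x))
  ev-* (a ∷ p) q x = begin
    ev (scale a q +ₚ (0# ∷ p *ₚ q)) x                ≈⟨ ev-+ (scale a q) (0# ∷ p *ₚ q) x ⟩
    ev (scale a q) x + (0# + x * ev (p *ₚ q) x)
      ≈⟨ +-cong (ev-scale a q x) (trans (+-identityˡ _) (*-congˡ (ev-* p q x))) ⟩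
    a * ev q x + x * (ev p x * ev q x)
      ≈⟨ solve 4 (λ a x p q → a :* q :+ x :* (p :* q) := (a :+ x :* p) :* q) refl _ _ _ _ ⟩
    (a + x * ev p x) * ev q x                        ∎

  coefficient-+ : ∀ p q → coefficient (p +ₚ q) ≋ coefficient p ⊕ coefficient q
  coefficient-+ []      q       n       = sym (+-identityˡ _)
  coefficient-+ (a ∷ p) []      n       = sym (+-identityʳ _)
  coefficient-+ (a ∷ p) (b ∷ q) zero    = refl
  coefficient-+ (a ∷ p) (b ∷ q) (suc n) = coefficient-+ p q n

  coefficient-scale : ∀ a p n → coefficient (scale a p) n ≈ a * coefficient p n
  coefficient-scale a []      n       = sym (zeroʳ a)
  coefficient-scale a (b ∷ p) zero    = refl
  coefficient-scale a (b ∷ p) (suc n) = coefficient-scale a p n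

  coefficient-* : ∀ p q → coefficient (p *ₚ q) ≋ coefficient p ⊛ coefficient q
  coefficient-* []      q n = sym (⊛-zeroˡ (λ _ → refl) (coefficient q) n)
  coefficient-* (a ∷ p) q n =
    trans (coefficient-+ (scale a q) (0# ∷ p *ₚ q) n) (trans (+-congʳ (coefficient-scale a q n)) (go n))
    where
    go : ∀ n → a * coefficient q n + coefficient (0# ∷ p *ₚ q) n ≈ (coefficient (a ∷ p) ⊛ coefficient q) n
    go zero    = +-identityʳ _
    go (suc n) = +-congˡ (coefficient-* p q n)

  -- Horner's scheme for the division of `a ∷ p` by x - b: the remainder of each tail is the next
  -- coefficient of the quotient, and the last remainder is the value at b.
  divide : Carrier → Carrier → Polynomial → Polynomial × Carrier
  divide b a []      = [] , a
  divide b a (d ∷ p) = let q , r = divide b d p in r ∷ q , a + b * r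

  ev-divide : ∀ b a p x → let q , r = divide b a p in ev (a ∷ p) x ≈ r + (x + - b) * ev q x
  ev-divide b a []      x = +-congˡ (trans (zeroʳ x) (sym (zeroʳ _)))
  ev-divide b a (d ∷ p) x = trans (+-congˡ (*-congˡ (ev-divide b d p x)))
    (solve 5 (λ a b x r q → a :+ x :* (r :+ (x :- b) :* q) := a :+ b :* r :+ (x :- b) :* (r :+ x :* q))
      refl _ _ _ _ _)

  length-divide : ∀ b a p → length (proj₁ (divide b a p)) ≡ length p
  length-divide b a []      = ≡.refl
  length-divide b a (d ∷ p) = ≡.cong suc (length-divide b d p)

  divide-zero : ∀ b a p → let q , r = divide b a p in
    coefficient q ≋ 0ˢ → r ≈ 0# → coefficient (a ∷ p) ≋ 0ˢ
  divide-zero b a []      q≋0 r≈0 zero    = r≈0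
  divide-zero b a []      q≋0 r≈0 (suc n) = refl
  divide-zero b a (d ∷ p) q≋0 r≈0 (suc n) = divide-zero b d p (q≋0 ∘ suc) (q≋0 zero) n
  divide-zero b a (d ∷ p) q≋0 r≈0 zero    = begin
    a                               ≈⟨ +-identityʳ a ⟨
    a + 0#                          ≈⟨ +-congˡ (trans (*-congˡ (q≋0 zero)) (zeroʳ b)) ⟨
    a + b * proj₂ (divide b d p)    ≈⟨ r≈0 ⟩
    0#                              ∎

  -- Distinctness of the nodes in the form that root counting uses: differences of nodes can be
  -- cancelled. This avoids any apartness relation on R.
  Separated : (ℕ → Carrier) → Set (c ⊔ ℓ)
  Separated a = ∀ m n → m ≢ n → ∀ x → (a m + - a n) * x ≈ 0# → x ≈ 0#

  -- Root counting. Division by x - a 0 has remainder 0, and by separation the quotient vanishes at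
  -- all later nodes, again a separated sequence. Infinitely many nodes are given, so the length of
  -- p serves only to make the recursion terminate.
  vanishing : ∀ {a} → Separated a → ∀ p → (∀ m → ev p (a m) ≈ 0#) → coefficient p ≋ 0ˢ
  vanishing a-sep p = go (length p) p ≡.refl a-sep
    where
    go : ∀ {a} d p → length p ≡ d → Separated a → (∀ m → ev p (a m) ≈ 0#) → coefficient p ≋ 0ˢ
    go d       []      eq a-sep ev≈0 n = refl
    go {a} (suc d) (k ∷ p) eq a-sep ev≈0 =
      let q , r = divide (a 0) k p
          r≈0 : r ≈ 0#
          r≈0 = begin
            r                                   ≈⟨ +-identityʳ r ⟨
            r + 0#                              ≈⟨ +-congˡ (trans (*-congʳ (-‿inverseʳ (a 0))) (zeroˡ _)) ⟨
            r + (a 0 + - a 0) * ev q (a 0)      ≈⟨ ev-divide (a 0) k p (a 0) ⟨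
            ev (k ∷ p) (a 0)                    ≈⟨ ev≈0 0 ⟩
            0#                                  ∎
          quotient≈0 m = a-sep (suc m) 0 (λ ()) (ev q (a (suc m))) (begin
            (a (suc m) + - a 0) * ev q (a (suc m))      ≈⟨ +-identityˡ _ ⟨
            0# + (a (suc m) + - a 0) * ev q (a (suc m)) ≈⟨ +-congʳ r≈0 ⟨
            r + (a (suc m) + - a 0) * ev q (a (suc m))  ≈⟨ ev-divide (a 0) k p (a (suc m)) ⟨
            ev (k ∷ p) (a (suc m))                      ≈⟨ ev≈0 (suc m) ⟩
            0#                                          ∎)
      in divide-zero (a 0) k p
           (go d q (≡.trans (length-divide (a 0) k p) (ℕ.suc-injective eq))
             (λ m n m≢n → a-sep (suc m) (suc n) (m≢n ∘ ℕ.suc-injective)) quotient≈0)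
           r≈0

  -- One polynomial seen as a series and as a function. The determinant det (1 - zL) is
  -- differentiated as a series, while the hypothesis on the characteristic polynomial concerns
  -- values; carrying both views through all ring operations links the two.
  record IsPolynomial (f : Series) (P : Carrier → Carrier) : Set (c ⊔ ℓ) where
    field
      polynomial   : Polynomial
      coefficients : f ≋ coefficient polynomial
      values       : ∀ x → P x ≈ ev polynomial x

  open IsPolynomial

  identify : ∀ {a} → Separated a → ∀ {f g P Q} → IsPolynomial f P → IsPolynomial g Q →
    (∀ m → P (a m) ≈ Q (a m)) → f ≋ g
  identify {a} a-sep {f} {g} {P} {Q} f~P g~Q P≈Q n = x∙y⁻¹≈ε⇒x≈y (f n) (g n) (begin
    f n + - g n
      ≈⟨ +-cong (coefficients f~P n) (trans (-‿cong (coefficients g~Q n)) (sym (-1*x≈-x _))) ⟩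
    coefficient p n + - 1# * coefficient q n
      ≈⟨ trans (coefficient-+ p (scale (- 1#) q) n) (+-congˡ (coefficient-scale (- 1#) q n)) ⟨
    coefficient (p +ₚ scale (- 1#) q) n
      ≈⟨ vanishing a-sep (p +ₚ scale (- 1#) q) difference n ⟩
    0# ∎)
    where
    p = polynomial f~P
    q = polynomial g~Q
    difference : ∀ m → ev (p +ₚ scale (- 1#) q) (a m) ≈ 0#
    difference m = begin
      ev (p +ₚ scale (- 1#) q) (a m)          ≈⟨ ev-+ p (scale (- 1#) q) (a m) ⟩
      ev p (a m) + ev (scale (- 1#) q) (a m)
        ≈⟨ +-cong (sym (values f~P (a m))) (trans (ev-scale (- 1#) q (a m)) (-1*x≈-x _)) ⟩
      P (a m) + - ev q (a m)                  ≈⟨ +-cong (P≈Q m) (-‿cong (sym (values g~Q (a m)))) ⟩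
      Q (a m) + - Q (a m)                     ≈⟨ -‿inverseʳ _ ⟩
      0#                                      ∎

  IsPolynomial-linear : ∀ a b → IsPolynomial (linear a b) (λ x → a + x * - b)
  IsPolynomial-linear a b = record
    { polynomial   = a ∷ - b ∷ []
    ; coefficients = λ { zero → refl ; (suc zero) → refl ; (suc (suc n)) → refl }
    ; values       = λ x → +-congˡ (*-congˡ (sym (trans (+-congˡ (zeroʳ x)) (+-identityʳ (- b)))))
    }

  IsPolynomial-0 : IsPolynomial 0ˢ (λ _ → 0#)
  IsPolynomial-0 = record { polynomial = [] ; coefficients = λ _ → refl ; values = λ _ → refl }

  IsPolynomial-1 : IsPolynomial 1ˢ (λ _ → 1#)
  IsPolynomial-1 = record
    { polynomial   = 1# ∷ []
    ; coefficients = λ { zero → refl ; (suc n) → refl }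
    ; values       = λ x → sym (trans (+-congˡ (zeroʳ x)) (+-identityʳ 1#))
    }

  IsPolynomial-+ : ∀ {f g P Q} → IsPolynomial f P → IsPolynomial g Q →
    IsPolynomial (f ⊕ g) (λ x → P x + Q x)
  IsPolynomial-+ f~P g~Q = record
    { polynomial   = polynomial f~P +ₚ polynomial g~Q
    ; coefficients = λ n → trans (+-cong (coefficients f~P n) (coefficients g~Q n))
        (sym (coefficient-+ (polynomial f~P) (polynomial g~Q) n))
    ; values       = λ x → trans (+-cong (values f~P x) (values g~Q x))
        (sym (ev-+ (polynomial f~P) (polynomial g~Q) x))
    }

  IsPolynomial-* : ∀ {f g P Q} → IsPolynomial f P → IsPolynomial g Q →
    IsPolynomial (f ⊛ g) (λ x → P x * Q x)
  IsPolynomial-* f~P g~Q = record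
    { polynomial   = polynomial f~P *ₚ polynomial g~Q
    ; coefficients = λ n → trans (⊛-cong (coefficients f~P) (coefficients g~Q) n)
        (sym (coefficient-* (polynomial f~P) (polynomial g~Q) n))
    ; values       = λ x → trans (*-cong (values f~P x) (values g~Q x))
        (sym (ev-* (polynomial f~P) (polynomial g~Q) x))
    }

  IsPolynomial-neg : ∀ {f P} → IsPolynomial f P → IsPolynomial (⊖ f) (λ x → - P x)
  IsPolynomial-neg {f} f~P = record
    { polynomial   = scale (- 1#) (polynomial f~P)
    ; coefficients = λ n → trans (-‿cong (coefficients f~P n))
        (sym (trans (coefficient-scale (- 1#) (polynomial f~P) n) (-1*x≈-x _)))
    ; values       = λ x → trans (-‿cong (values f~P x))
        (sym (trans (ev-scale (- 1#) (polynomial f~P) x) (-1*x≈-x _)))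
    }

  IsPolynomial-sum : ∀ {n} {f : Fin n → Series} {P : Fin n → Carrier → Carrier} →
    (∀ i → IsPolynomial (f i) (P i)) → IsPolynomial (Ŝ.sum f) (λ x → sum λ i → P i x)
  IsPolynomial-sum {zero}  f~P = IsPolynomial-0
  IsPolynomial-sum {suc n} f~P = IsPolynomial-+ (f~P zero) (IsPolynomial-sum (f~P ∘ suc))

  IsPolynomial-product : ∀ {n} {f : Fin n → Series} {P : Fin n → Carrier → Carrier} →
    (∀ i → IsPolynomial (f i) (P i)) → IsPolynomial (Ŝ.product f) (λ x → product λ i → P i x)
  IsPolynomial-product {zero}  f~P = IsPolynomial-1
  IsPolynomial-product {suc n} f~P = IsPolynomial-* (f~P zero) (IsPolynomial-product (f~P ∘ suc))

  IsPolynomial-sgn : ∀ m → IsPolynomial (D̂.sgn m) (λ _ → sgn m)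
  IsPolynomial-sgn zero    = IsPolynomial-1
  IsPolynomial-sgn (suc m) = IsPolynomial-neg (IsPolynomial-sgn m)

  IsPolynomial-det : ∀ {n} {M : Fin n → Fin n → Series} {P : Fin n → Fin n → Carrier → Carrier} →
    (∀ i j → IsPolynomial (M i j) (P i j)) → IsPolynomial (D̂.det M) (λ x → det λ i j → P i j x)
  IsPolynomial-det {zero}  M~P = IsPolynomial-1
  IsPolynomial-det {suc n} M~P = IsPolynomial-sum λ j → IsPolynomial-*
    (IsPolynomial-* (IsPolynomial-sgn (toℕ j)) (M~P zero j))
    (IsPolynomial-det λ i k → M~P (suc i) (punchIn j k))

  det-cong : ∀ {n} {M N : Square n} → (∀ i j → M i j ≈ N i j) → det M ≈ det N
  det-cong {zero}  M≈N = refl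
  det-cong {suc n} M≈N = sum-cong-≋ λ j →
    *-cong (*-congˡ {x = sgn (toℕ j)} (M≈N zero j)) (det-cong λ i k → M≈N (suc i) (punchIn j k))

  product-cong : ∀ {n} {f g : Fin n → Carrier} → (∀ i → f i ≈ g i) → product f ≈ product g
  product-cong {zero}  f≈g = refl
  product-cong {suc n} f≈g = *-cong (f≈g zero) (product-cong (f≈g ∘ suc))

  det-scale : ∀ {n} a (M : Square n) → det (λ i j → a * M i j) ≈ a ^ n * det M
  det-scale {zero}  a M = sym (*-identityˡ 1#)
  det-scale {suc n} a M = trans
    (sum-cong-≋ {suc n} λ j → trans (*-congˡ (det-scale a (minor j)))
      (solve 5 (λ s a m p d → s :* (a :* m) :* (p :* d) := a :* p :* (s :* m :* d))
        refl (sgn (toℕ j)) a (M zero j) (a ^ n) (det (minor j))))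
    (sym (*-distribˡ-sum {suc n} (a ^ suc n) λ j → sgn (toℕ j) * M zero j * det (minor j)))
    where
    minor : Fin (suc n) → Square n
    minor j i k = M (suc i) (punchIn j k)

  product-scale : ∀ {n} a (f : Fin n → Carrier) → product (λ i → a * f i) ≈ a ^ n * product f
  product-scale {zero}  a f = sym (*-identityˡ 1#)
  product-scale {suc n} a f = trans (*-congˡ (product-scale a (f ∘ suc)))
    (solve 4 (λ a x p f → a :* x :* (p :* f) := a :* p :* (x :* f)) refl _ _ _ _)

  -- For invertible z one has det (1 - zL) = zⁿ det (z⁻¹ - L), and the product of the 1 - z μᵢ
  -- scales alike. So the hypothesis at t = b m gives the reversed identity at z = a m, and
  -- separated nodes make it an identity of series.
  charPoly⇒trace-^ : ∀ {a b : ℕ → Carrier} → Separated a → (∀ m → a m * b m ≈ 1#) →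
    ∀ {n} (L : Square n) (μ : Fin n → Carrier) →
    (∀ t → det (λ i j → t * 1ᴹ i j + - L i j) ≈ product (λ i → t + - μ i)) →
    ∀ q → trace (L ^ᴹ q) ≈ sum λ i → μ i ^ q
  charPoly⇒trace-^ {a} {b} a-sep ab≈1 {n} L μ χ = trace-^ L μ (identify a-sep
    (IsPolynomial-det λ i j → IsPolynomial-linear (1ᴹ i j) (L i j))
    (IsPolynomial-product λ i → IsPolynomial-linear 1# (μ i))
    λ m → begin
      det (λ i j → 1ᴹ i j + a m * - L i j)
        ≈⟨ det-cong (λ i j → sym (rescale m (1ᴹ i j) (L i j))) ⟩
      det (λ i j → a m * (b m * 1ᴹ i j + - L i j))
        ≈⟨ det-scale (a m) (λ i j → b m * 1ᴹ i j + - L i j) ⟩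
      a m ^ n * det (λ i j → b m * 1ᴹ i j + - L i j)
        ≈⟨ *-congˡ (χ (b m)) ⟩
      a m ^ n * product (λ i → b m + - μ i)
        ≈⟨ product-scale (a m) (λ i → b m + - μ i) ⟨
      product (λ i → a m * (b m + - μ i))
        ≈⟨ product-cong (λ i → trans (*-congˡ (+-congʳ (sym (*-identityʳ (b m))))) (rescale m 1# (μ i))) ⟩
      product (λ i → 1# + a m * - μ i) ∎)
    where
    rescale : ∀ m x y → a m * (b m * x + - y) ≈ x + a m * - y
    rescale m x y = begin
      a m * (b m * x + - y)      ≈⟨ distribˡ (a m) (b m * x) (- y) ⟩
      a m * (b m * x) + a m * - y ≈⟨ +-congʳ (*-assoc (a m) (b m) x) ⟨
      a m * b m * x + a m * - y  ≈⟨ +-congʳ (trans (*-congʳ (ab≈1 m)) (*-identityˡ x)) ⟩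
      x + a m * - y              ∎

-- Ordered fields with stable order.

-- The order axioms that hold constructively for Cauchy reals: the case
-- distinctions are available only under a double negation, which the stability
-- of _≤_ removes at the end.
record StableOrderedField (c ℓ₁ ℓ₂ : Level) : Set (Level.suc (c ⊔ ℓ₁ ⊔ ℓ₂)) where
  field
    commutativeRing : CommutativeRing c ℓ₁
  open CommutativeRing commutativeRing public hiding (_-_; zero)
  open Algebra.Properties.Semiring.Mult semiring public using () renaming (_×_ to _·_)
  infix 4 _≤_
  field
    _≤_         : Carrier → Carrier → Set ℓ₂
    ≤-reflexive : ∀ {x y} → x ≈ y → x ≤ y
    ≤-trans     : ∀ {x y z} → x ≤ y → y ≤ z → x ≤ z
    ≤-antisym   : ∀ {x y} → x ≤ y → y ≤ x → x ≈ y
    ≤-stable    : ∀ {x y} → ¬ ¬ (x ≤ y) → x ≤ y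
    ≤-total     : ∀ x y → ¬ ¬ (x ≤ y ⊎ y ≤ x)
    +-mono-≤    : ∀ {w x y z} → w ≤ x → y ≤ z → w + y ≤ x + z
    *-nonneg    : ∀ {x y} → 0# ≤ x → 0# ≤ y → 0# ≤ x * y
    square≥0    : ∀ x → 0# ≤ x * x
    invert      : ∀ x → ¬ ¬ (x ≈ 0# ⊎ ∃[ y ] x * y ≈ 1#)
    invertℕ     : ∀ n → ∃[ y ] (suc n · 1#) * y ≈ 1#

module OrderedFieldProperties {c ℓ₁ ℓ₂ : Level} (F : StableOrderedField c ℓ₁ ℓ₂) where

  open StableOrderedField F
  open Algebra.Properties.Semiring.Mult semiring public using (×-homo-+; ×1-homo-*)
  open Algebra.Properties.Ring ring using (-0#≈0#)
  open Relation.Binary.Reasoning.Setoid setoid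
  open IntegerRingSolver commutativeRing
  open Sums commutativeRing

  ι : ℕ → Carrier
  ι n = n · 1#

  ≤-refl : ∀ {x} → x ≤ x
  ≤-refl = ≤-reflexive refl

  ≤-resp : ∀ {x x′ y y′} → x ≈ x′ → y ≈ y′ → x ≤ y → x′ ≤ y′
  ≤-resp x≈x′ y≈y′ x≤y = ≤-trans (≤-reflexive (sym x≈x′)) (≤-trans x≤y (≤-reflexive y≈y′))

  x≤y⇒0≤y-x : ∀ {x y} → x ≤ y → 0# ≤ y + - x
  x≤y⇒0≤y-x {x} x≤y = ≤-resp (-‿inverseʳ x) refl (+-mono-≤ x≤y ≤-refl)

  0≤y-x⇒x≤y : ∀ {x y} → 0# ≤ y + - x → x ≤ y
  0≤y-x⇒x≤y {x} {y} 0≤y-x = ≤-resp (+-identityˡ x)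
    (solve 2 (λ x y → (y :- x) :+ x := y) refl x y) (+-mono-≤ 0≤y-x ≤-refl)

  *-monoˡ-≤ : ∀ {a x y} → 0# ≤ a → x ≤ y → a * x ≤ a * y
  *-monoˡ-≤ {a} {x} {y} 0≤a x≤y = 0≤y-x⇒x≤y
    (≤-resp refl (solve 3 (λ a x y → a :* (y :- x) := a :* y :- a :* x) refl a x y)
      (*-nonneg 0≤a (x≤y⇒0≤y-x x≤y)))

  0≤1 : 0# ≤ 1#
  0≤1 = ≤-resp refl (*-identityˡ 1#) (square≥0 1#)

  ι≥0 : ∀ n → 0# ≤ ι n
  ι≥0 zero    = ≤-refl
  ι≥0 (suc n) = ≤-resp (+-identityˡ 0#) refl (+-mono-≤ 0≤1 (ι≥0 n))

  ι-mono : ∀ {m n} → m ℕ.≤ n → ι m ≤ ι n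
  ι-mono (ℕ.z≤n {n}) = ι≥0 n
  ι-mono (ℕ.s≤s m≤n) = +-mono-≤ ≤-refl (ι-mono m≤n)

  ι-cancel : ∀ n x → ι (suc n) * x ≈ 0# → x ≈ 0#
  ι-cancel n x nx≈0 = let y , ny≈1 = invertℕ n in begin
    x                      ≈⟨ *-identityˡ x ⟨
    1# * x                 ≈⟨ *-congʳ ny≈1 ⟨
    ι (suc n) * y * x      ≈⟨ solve 3 (λ n y x → n :* y :* x := y :* (n :* x)) refl (ι (suc n)) y x ⟩
    y * (ι (suc n) * x)    ≈⟨ *-congˡ nx≈0 ⟩
    y * 0#                 ≈⟨ zeroʳ y ⟩
    0#                     ∎

  -- The inverse y of n + 1 is nonnegative because y = (n + 1) y², so multiplication by it preserves
  -- the inequality.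
  ι-cancel-nonneg : ∀ n x → 0# ≤ ι (suc n) * x → 0# ≤ x
  ι-cancel-nonneg n x 0≤nx = let y , ny≈1 = invertℕ n in
    ≤-resp refl (begin
      y * (ι (suc n) * y) * (ι (suc n) * x)
        ≈⟨ solve 3 (λ n y x → y :* (n :* y) :* (n :* x) := (n :* y) :* (n :* y) :* x) refl (ι (suc n)) y x ⟩
      ι (suc n) * y * (ι (suc n) * y) * x   ≈⟨ *-congʳ (*-cong ny≈1 ny≈1) ⟩
      1# * 1# * x                           ≈⟨ trans (*-congʳ (*-identityˡ 1#)) (*-identityˡ x) ⟩
      x                                     ∎)
      (*-nonneg (≤-resp refl (solve 2 (λ n y → n :* (y :* y) := y :* (n :* y)) refl (ι (suc n)) y)
        (*-nonneg (ι≥0 (suc n)) (square≥0 y))) 0≤nx)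

  ι-separated : ∀ m n → m ≢ n → ∀ x → (ι (suc m) + - ι (suc n)) * x ≈ 0# → x ≈ 0#
  ι-separated m n m≢n x [m-n]x≈0 with ℕ.<-cmp m n
  ... | tri≈ _ m≡n _ = contradiction m≡n m≢n
  ... | tri< m<n _ _ = case ℕ.m≤n⇒∃[o]m+o≡n m<n of λ { (k , ≡.refl) → ι-cancel k x (begin
    ι (suc k) * x
      ≈⟨ solve 3 (λ m k x → k :* x := :- ((m :- (m :+ k)) :* x)) refl (ι (suc m)) (ι (suc k)) x ⟩
    - ((ι (suc m) + - (ι (suc m) + ι (suc k))) * x)
      ≈⟨ -‿cong (*-congʳ (+-congˡ (-‿cong (trans (sym (×-homo-+ 1# (suc m) (suc k)))
           (reflexive (≡.cong ι (ℕ.+-suc (suc m) k))))))) ⟩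
    - ((ι (suc m) + - ι (suc (suc m ℕ.+ k))) * x)  ≈⟨ -‿cong [m-n]x≈0 ⟩
    - 0#                                           ≈⟨ -0#≈0# ⟩
    0#                                             ∎) }
  ... | tri> _ _ n<m = case ℕ.m≤n⇒∃[o]m+o≡n n<m of λ { (k , ≡.refl) → ι-cancel k x (begin
    ι (suc k) * x
      ≈⟨ solve 3 (λ m k x → k :* x := (m :+ k :- m) :* x) refl (ι (suc n)) (ι (suc k)) x ⟩
    (ι (suc n) + ι (suc k) + - ι (suc n)) * x
      ≈⟨ *-congʳ (+-congʳ (trans (sym (×-homo-+ 1# (suc n) (suc k)))
           (reflexive (≡.cong ι (ℕ.+-suc (suc n) k))))) ⟩
    (ι (suc (suc n ℕ.+ k)) + - ι (suc n)) * x  ≈⟨ [m-n]x≈0 ⟩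
    0#                                         ∎) }

  sum-mono : ∀ {n} {f g : Fin n → Carrier} → (∀ i → f i ≤ g i) → sum f ≤ sum g
  sum-mono {zero}  f≤g = ≤-refl
  sum-mono {suc n} f≤g = +-mono-≤ (f≤g zero) (sum-mono (f≤g ∘ suc))

  sum-nonneg : ∀ {n} {f : Fin n → Carrier} → (∀ i → 0# ≤ f i) → 0# ≤ sum f
  sum-nonneg {n} 0≤f = ≤-resp (sum-zero {n} λ _ → refl) refl (sum-mono 0≤f)

  term≤sum : ∀ {n} {f : Fin n → Carrier} → (∀ i → 0# ≤ f i) → ∀ i → f i ≤ sum f
  term≤sum {suc n} {f} 0≤f zero =
    ≤-resp (+-identityʳ (f zero)) refl (+-mono-≤ ≤-refl (sum-nonneg (0≤f ∘ suc)))
  term≤sum {suc n} {f} 0≤f (suc i) =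
    ≤-resp (+-identityˡ (f (suc i))) refl (+-mono-≤ (0≤f zero) (term≤sum (0≤f ∘ suc) i))

  subsum : ∀ {n} {f : Fin n → Carrier} → (∀ i → 0# ≤ f i) → ∀ k (k≤n : k ℕ.≤ n) →
    (sum λ i → f (inject≤ {k} i k≤n)) ≤ sum f
  subsum         0≤f zero    k≤n = sum-nonneg 0≤f
  subsum {suc n} 0≤f (suc k) k≤n = +-mono-≤ ≤-refl (subsum (0≤f ∘ suc) k (ℕ.s≤s⁻¹ k≤n))

  sum-const : ∀ n x → (sum {n} λ _ → x) ≈ ι n * x
  sum-const zero    x = sym (zeroˡ x)
  sum-const (suc n) x = trans (+-congˡ (sum-const n x))
    (trans (+-congʳ (sym (*-identityˡ x))) (sym (distribʳ x 1# (ι n))))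

  ≈0-stable : ∀ {x} → ¬ ¬ (x ≈ 0#) → x ≈ 0#
  ≈0-stable ¬¬x≈0 = ≤-antisym
    (≤-stable λ x≰0 → ¬¬x≈0 (x≰0 ∘ ≤-reflexive))
    (≤-stable λ 0≰x → ¬¬x≈0 (0≰x ∘ ≤-reflexive ∘ sym))

  -- Up to double negation x is 0 or invertible, and an invertible x with square 0 is 0 as well;
  -- equality with 0 is stable.
  x²≈0⇒x≈0 : ∀ x → x * x ≈ 0# → x ≈ 0#
  x²≈0⇒x≈0 x x²≈0 = ≈0-stable λ x≉0 → invert x λ
    { (inj₁ x≈0)        → x≉0 x≈0
    ; (inj₂ (y , xy≈1)) → x≉0 (begin
        x              ≈⟨ *-identityʳ x ⟨
        x * 1#         ≈⟨ *-congˡ xy≈1 ⟨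
        x * (x * y)    ≈⟨ *-assoc x x y ⟨
        x * x * y      ≈⟨ *-congʳ x²≈0 ⟩
        0# * y         ≈⟨ zeroˡ y ⟩
        0#             ∎)
    }

-- Polynomials in a matrix and their traces.

module FunctionalCalculus {c ℓ : Level} (R : CommutativeRing c ℓ) where

  open CommutativeRing R hiding (_-_; zero)
  open Algebra.Properties.CommutativeSemiring.Exp commutativeSemiring using (_^_)
  open Relation.Binary.Reasoning.Setoid setoid
  open IntegerRingSolver R
  open Sums R
  open Matrices R
  open Polynomials R

  Matrix : ℕ → ℕ → Set c
  Matrix m n = Fin m → Fin n → Carrier

  infixl 9 _ᵀ

  _ᵀ : ∀ {m n} → Matrix m n → Matrix n m
  (A ᵀ) i j = A j i

  infix 4 _≈ᴹ_

  _≈ᴹ_ : ∀ {m n} → Matrix m n → Matrix m n → Set ℓ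
  A ≈ᴹ B = ∀ i j → A i j ≈ B i j

  *ᴹ-cong : ∀ {m n p} {A A′ : Matrix m n} {B B′ : Matrix n p} → A ≈ᴹ A′ → B ≈ᴹ B′ → A *ᴹ B ≈ᴹ A′ *ᴹ B′
  *ᴹ-cong A≈A′ B≈B′ i j = sum-cong-≋ λ k → *-cong (A≈A′ i k) (B≈B′ k j)

  *ᴹ-congˡ : ∀ {m n p} (A : Matrix m n) {B B′ : Matrix n p} → B ≈ᴹ B′ → A *ᴹ B ≈ᴹ A *ᴹ B′
  *ᴹ-congˡ A B≈B′ = *ᴹ-cong {A = A} (λ _ _ → refl) B≈B′

  *ᴹ-congʳ : ∀ {m n p} {A A′ : Matrix m n} (B : Matrix n p) → A ≈ᴹ A′ → A *ᴹ B ≈ᴹ A′ *ᴹ B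
  *ᴹ-congʳ B A≈A′ = *ᴹ-cong {B = B} A≈A′ (λ _ _ → refl)

  *ᴹ-assoc : ∀ {m n p q} (A : Matrix m n) (B : Matrix n p) (C : Matrix p q) →
    (A *ᴹ B) *ᴹ C ≈ᴹ A *ᴹ (B *ᴹ C)
  *ᴹ-assoc {n = n} {p} A B C i j = begin
    (sum λ l → (sum λ k → A i k * B k l) * C l j)
      ≈⟨ sum-cong-≋ (λ l → trans (*-distribʳ-sum (C l j) (λ k → A i k * B k l))
           (sum-cong-≋ λ k → *-assoc (A i k) (B k l) (C l j))) ⟩
    (sum λ l → sum λ k → A i k * (B k l * C l j))
      ≈⟨ ∑-comm {p} {n} (λ l k → A i k * (B k l * C l j)) ⟩
    (sum λ k → sum λ l → A i k * (B k l * C l j))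
      ≈⟨ sum-cong-≋ (λ k → *-distribˡ-sum (A i k) (λ l → B k l * C l j)) ⟨
    (sum λ k → A i k * sum λ l → B k l * C l j) ∎

  *ᴹ-transpose : ∀ {m n p} (A : Matrix m n) (B : Matrix n p) → (A *ᴹ B) ᵀ ≈ᴹ B ᵀ *ᴹ A ᵀ
  *ᴹ-transpose A B i j = sum-cong-≋ λ k → *-comm (A j k) (B k i)

  trace-*ᴹ-comm : ∀ {m n} (A : Matrix m n) (B : Matrix n m) → trace (A *ᴹ B) ≈ trace (B *ᴹ A)
  trace-*ᴹ-comm {m} {n} A B = trans
    (∑-comm {m} {n} (λ i k → A i k * B k i))
    (sum-cong-≋ λ k → sum-cong-≋ λ i → *-comm (A i k) (B k i))

  Symmetric : ∀ {n} → Square n → Set ℓ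
  Symmetric A = A ᵀ ≈ᴹ A

  ^ᴹ-comm : ∀ {n} (A : Square n) q → A ^ᴹ q *ᴹ A ≈ᴹ A *ᴹ A ^ᴹ q
  ^ᴹ-comm A zero    i j = trans (*ᴹ-identityˡ A i j) (sym (*ᴹ-identityʳ A i j))
  ^ᴹ-comm A (suc q) i j =
    trans (*ᴹ-assoc A (A ^ᴹ q) A i j) (*ᴹ-congˡ A (^ᴹ-comm A q) i j)

  1ᴹ-symmetric : ∀ {n} → Symmetric (1ᴹ {n})
  1ᴹ-symmetric zero    zero    = refl
  1ᴹ-symmetric zero    (suc j) = refl
  1ᴹ-symmetric (suc i) zero    = refl
  1ᴹ-symmetric (suc i) (suc j) = 1ᴹ-symmetric i j

  ^ᴹ-symmetric : ∀ {n} {A : Square n} → Symmetric A → ∀ q → Symmetric (A ^ᴹ q)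
  ^ᴹ-symmetric         Aᵀ≈A zero    = 1ᴹ-symmetric
  ^ᴹ-symmetric {A = A} Aᵀ≈A (suc q) i j = begin
    (A *ᴹ A ^ᴹ q) j i        ≈⟨ *ᴹ-transpose A (A ^ᴹ q) i j ⟩
    ((A ^ᴹ q) ᵀ *ᴹ A ᵀ) i j  ≈⟨ *ᴹ-cong (^ᴹ-symmetric Aᵀ≈A q) Aᵀ≈A i j ⟩
    (A ^ᴹ q *ᴹ A) i j        ≈⟨ ^ᴹ-comm A q i j ⟩
    (A *ᴹ A ^ᴹ q) i j        ∎

  -- evᴹ q p A = A^q p(A).
  evᴹ : ∀ {n} → ℕ → Polynomial → Square n → Square n
  evᴹ q []      A i j = 0#
  evᴹ q (a ∷ p) A i j = a * (A ^ᴹ q) i j + evᴹ (suc q) p A i j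

  evᴹ-suc : ∀ {n} q p (A : Square n) → evᴹ (suc q) p A ≈ᴹ A *ᴹ evᴹ q p A
  evᴹ-suc q []      A i j = sym (sum-zero λ k → zeroʳ (A i k))
  evᴹ-suc q (a ∷ p) A i j = begin
    a * (A *ᴹ A ^ᴹ q) i j + evᴹ (suc (suc q)) p A i j
      ≈⟨ +-cong (*-distribˡ-sum a (λ k → A i k * (A ^ᴹ q) k j)) (evᴹ-suc (suc q) p A i j) ⟩
    (sum λ k → a * (A i k * (A ^ᴹ q) k j)) + (sum λ k → A i k * evᴹ (suc q) p A k j)
      ≈⟨ ∑-distrib-+ (λ k → a * (A i k * (A ^ᴹ q) k j)) _ ⟨
    (sum λ k → a * (A i k * (A ^ᴹ q) k j) + A i k * evᴹ (suc q) p A k j)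
      ≈⟨ sum-cong-≋ (λ k → solve 4 (λ a x y z → a :* (x :* y) :+ x :* z := x :* (a :* y :+ z))
           refl a (A i k) ((A ^ᴹ q) k j) (evᴹ (suc q) p A k j)) ⟩
    (sum λ k → A i k * (a * (A ^ᴹ q) k j + evᴹ (suc q) p A k j)) ∎

  evᴹ-symmetric : ∀ {n} q p {A : Square n} → Symmetric A → Symmetric (evᴹ q p A)
  evᴹ-symmetric q []      Aᵀ≈A i j = refl
  evᴹ-symmetric q (a ∷ p) Aᵀ≈A i j =
    +-cong (*-congˡ (^ᴹ-symmetric Aᵀ≈A q i j)) (evᴹ-symmetric (suc q) p Aᵀ≈A i j)

  evᴹ-+ : ∀ {n} k p q (A : Square n) i j → evᴹ k (p +ₚ q) A i j ≈ evᴹ k p A i j + evᴹ k q A i j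
  evᴹ-+ k []      q       A i j = sym (+-identityˡ _)
  evᴹ-+ k (a ∷ p) []      A i j = sym (+-identityʳ _)
  evᴹ-+ k (a ∷ p) (b ∷ q) A i j = trans (+-congˡ (evᴹ-+ (suc k) p q A i j))
    (solve 5 (λ a b x p q → (a :+ b) :* x :+ (p :+ q) := (a :* x :+ p) :+ (b :* x :+ q)) refl _ _ _ _ _)

  evᴹ-scale : ∀ {n} k a p (A : Square n) i j → evᴹ k (scale a p) A i j ≈ a * evᴹ k p A i j
  evᴹ-scale k a []      A i j = sym (zeroʳ a)
  evᴹ-scale k a (b ∷ p) A i j = trans (+-congˡ (evᴹ-scale (suc k) a p A i j))
    (solve 4 (λ a b x p → (a :* b) :* x :+ a :* p := a :* (b :* x :+ p)) refl _ _ _ _)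

  evᴹ-shift : ∀ {n} p (A : Square n) → evᴹ 0 (0# ∷ p) A ≈ᴹ A *ᴹ evᴹ 0 p A
  evᴹ-shift p A i j = trans (+-congʳ (zeroˡ _)) (trans (+-identityˡ _) (evᴹ-suc 0 p A i j))

  evᴹ-* : ∀ {n} p q (A : Square n) → evᴹ 0 (p *ₚ q) A ≈ᴹ evᴹ 0 p A *ᴹ evᴹ 0 q A
  evᴹ-* []      q A i j = sym (sum-zero λ k → zeroˡ (evᴹ 0 q A k j))
  evᴹ-* (a ∷ p) q A i j = begin
    evᴹ 0 (scale a q +ₚ (0# ∷ p *ₚ q)) A i j
      ≈⟨ evᴹ-+ 0 (scale a q) (0# ∷ p *ₚ q) A i j ⟩
    evᴹ 0 (scale a q) A i j + evᴹ 0 (0# ∷ p *ₚ q) A i j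
      ≈⟨ +-cong (evᴹ-scale 0 a q A i j) (evᴹ-shift (p *ₚ q) A i j) ⟩
    a * Q i j + (A *ᴹ evᴹ 0 (p *ₚ q) A) i j
      ≈⟨ +-cong (*-congˡ (sym (*ᴹ-identityˡ Q i j)))
           (trans (*ᴹ-congˡ A (evᴹ-* p q A) i j) (sym (*ᴹ-assoc A P Q i j))) ⟩
    a * (1ᴹ *ᴹ Q) i j + ((A *ᴹ P) *ᴹ Q) i j
      ≈⟨ +-cong (*-distribˡ-sum a (λ k → 1ᴹ i k * Q k j))
           (*ᴹ-congʳ Q (λ i k → sym (evᴹ-suc 0 p A i k)) i j) ⟩
    (sum λ k → a * (1ᴹ i k * Q k j)) + (sum λ k → evᴹ 1 p A i k * Q k j)
      ≈⟨ ∑-distrib-+ (λ k → a * (1ᴹ i k * Q k j)) _ ⟨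
    (sum λ k → a * (1ᴹ i k * Q k j) + evᴹ 1 p A i k * Q k j)
      ≈⟨ sum-cong-≋ (λ k → solve 4 (λ a x y z → a :* (x :* y) :+ z :* y := (a :* x :+ z) :* y)
           refl a (1ᴹ i k) (Q k j) (evᴹ 1 p A i k)) ⟩
    (sum λ k → (a * 1ᴹ i k + evᴹ 1 p A i k) * Q k j) ∎
    where
    P = evᴹ 0 p A
    Q = evᴹ 0 q A

  trace-evᴹ : ∀ {n} (A : Square n) (μ : Fin n → Carrier) →
    (∀ q → trace (A ^ᴹ q) ≈ sum λ i → μ i ^ q) →
    ∀ p → trace (evᴹ 0 p A) ≈ sum λ i → ev p (μ i)
  trace-evᴹ {n} A μ tr p = trans (go 0 p) (sum-cong-≋ {n} λ i → *-identityˡ (ev p (μ i)))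
    where
    -- Generalised to the trace of A^q p(A), because `evᴹ` raises the exponent as it walks along the
    -- coefficients.
    go : ∀ q p → trace (evᴹ q p A) ≈ sum λ i → μ i ^ q * ev p (μ i)
    go q []      = sum-cong-≋ {n} λ i → sym (zeroʳ (μ i ^ q))
    go q (a ∷ p) = begin
      (sum λ i → a * (A ^ᴹ q) i i + evᴹ (suc q) p A i i)
        ≈⟨ ∑-distrib-+ (λ i → a * (A ^ᴹ q) i i) _ ⟩
      (sum λ i → a * (A ^ᴹ q) i i) + trace (evᴹ (suc q) p A)
        ≈⟨ +-cong (trans (sym (*-distribˡ-sum a λ i → (A ^ᴹ q) i i)) (*-congˡ (tr q))) (go (suc q) p) ⟩
      a * (sum λ i → μ i ^ q) + (sum λ i → μ i * μ i ^ q * ev p (μ i))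
        ≈⟨ +-congʳ (*-distribˡ-sum a λ i → μ i ^ q) ⟩
      (sum λ i → a * μ i ^ q) + (sum λ i → μ i * μ i ^ q * ev p (μ i))
        ≈⟨ ∑-distrib-+ (λ i → a * μ i ^ q) _ ⟨
      (sum λ i → a * μ i ^ q + μ i * μ i ^ q * ev p (μ i))
        ≈⟨ sum-cong-≋ (λ i → solve 4 (λ a x y z → a :* y :+ x :* y :* z := y :* (a :+ x :* z))
             refl a (μ i) (μ i ^ q) (ev p (μ i))) ⟩
      (sum λ i → μ i ^ q * (a + μ i * ev p (μ i))) ∎

-- Selecting the eigenvalues above a threshold.

module SpectralProjection {c ℓ₁ ℓ₂ : Level} (F : StableOrderedField c ℓ₁ ℓ₂) where

  open StableOrderedField F
  open OrderedFieldProperties F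
  open Algebra.Properties.CommutativeSemiring.Exp commutativeSemiring using (_^_)
  open Algebra.Properties.Ring ring using (x∙y⁻¹≈ε⇒x≈y; -1*x≈-x)
  open Relation.Binary.Reasoning.Setoid setoid
  open IntegerRingSolver commutativeRing
  open Sums commutativeRing
  open Matrices commutativeRing
  open Polynomials commutativeRing
  open FunctionalCalculus commutativeRing

  nodal : ∀ {n} → (Fin n → Carrier) → Polynomial
  nodal {zero}  μ = 1# ∷ []
  nodal {suc n} μ = (- μ zero ∷ 1# ∷ []) *ₚ nodal (μ ∘ suc)

  ev-nodal : ∀ {n} (μ : Fin (suc n) → Carrier) x →
    ev (nodal μ) x ≈ (x + - μ zero) * ev (nodal (μ ∘ suc)) x
  ev-nodal μ x = trans (ev-* (- μ zero ∷ 1# ∷ []) (nodal (μ ∘ suc)) x) (*-congʳ (begin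
    - μ zero + x * (1# + x * 0#)  ≈⟨ +-congˡ (*-congˡ (trans (+-congˡ (zeroʳ x)) (+-identityʳ 1#))) ⟩
    - μ zero + x * 1#             ≈⟨ +-congˡ (*-identityʳ x) ⟩
    - μ zero + x                  ≈⟨ +-comm (- μ zero) x ⟩
    x + - μ zero                  ∎))

  nodal-root : ∀ {n} (μ : Fin n → Carrier) i → ev (nodal μ) (μ i) ≈ 0#
  nodal-root μ zero    = trans (ev-nodal μ (μ zero)) (trans (*-congʳ (-‿inverseʳ (μ zero))) (zeroˡ _))
  nodal-root μ (suc i) = trans (ev-nodal μ (μ (suc i))) (trans (*-congˡ (nodal-root (μ ∘ suc) i)) (zeroʳ _))

  -- Newton's correction at a new node x divides by the nodal polynomial there. Its value is a
  -- product of differences, each zero or invertible up to double negation; a zero difference means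
  -- that x is an old node.
  nodal-invertible : ∀ {n} (μ : Fin n → Carrier) x →
    ¬ ¬ ((∃[ i ] x ≈ μ i) ⊎ (∃[ y ] ev (nodal μ) x * y ≈ 1#))
  nodal-invertible {zero}  μ x k = k (inj₂ (1# , (begin
    (1# + x * 0#) * 1#  ≈⟨ *-identityʳ _ ⟩
    1# + x * 0#         ≈⟨ trans (+-congˡ (zeroʳ x)) (+-identityʳ 1#) ⟩
    1#                  ∎)))
  nodal-invertible {suc n} μ x k = invert (x + - μ zero) λ
    { (inj₁ x-μ₀≈0)          → k (inj₁ (zero , x∙y⁻¹≈ε⇒x≈y x (μ zero) x-μ₀≈0))
    ; (inj₂ (y , [x-μ₀]y≈1)) → nodal-invertible (μ ∘ suc) x λ
      { (inj₁ (i , x≈μᵢ)) → k (inj₁ (suc i , x≈μᵢ))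
      ; (inj₂ (z , Wz≈1)) → k (inj₂ (y * z , (begin
          ev (nodal μ) x * (y * z)
            ≈⟨ *-congʳ (ev-nodal μ x) ⟩
          (x + - μ zero) * ev (nodal (μ ∘ suc)) x * (y * z)
            ≈⟨ solve 4 (λ a b y z → a :* b :* (y :* z) := (a :* y) :* (b :* z)) refl _ _ _ _ ⟩
          (x + - μ zero) * y * (ev (nodal (μ ∘ suc)) x * z)
            ≈⟨ trans (*-cong [x-μ₀]y≈1 Wz≈1) (*-identityˡ 1#) ⟩
          1# ∎)))
      }
    }

  -- Newton interpolation; a node that repeats an earlier one needs no correction.
  interpolate : ∀ {p} (Value : Carrier → Carrier → Set p) →
    (∀ {x x′ v v′} → x ≈ x′ → v ≈ v′ → Value x v → Value x′ v′) →
    (∀ x → ¬ ¬ ∃ (Value x)) →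
    ∀ {n} (μ : Fin n → Carrier) → ¬ ¬ (∃[ g ] ∀ i → Value (μ i) (ev g (μ i)))
  interpolate Value resp choose {zero}  μ k = k ([] , λ ())
  interpolate Value resp choose {suc n} μ k = interpolate Value resp choose (μ ∘ suc) λ (g , values) →
    nodal-invertible (μ ∘ suc) (μ zero) λ
      { (inj₁ (i , μ₀≈μᵢ)) → k (g , λ
          { zero    → resp (sym μ₀≈μᵢ) (ev-cong g (sym μ₀≈μᵢ)) (values i)
          ; (suc i) → values i
          })
      ; (inj₂ (y , Wy≈1)) → choose (μ zero) λ (v , value) →
          let W = nodal (μ ∘ suc)
              a = (v + - ev g (μ zero)) * y
              ev-g′ : ∀ x → ev (g +ₚ scale a W) x ≈ ev g x + a * ev W x
              ev-g′ x = trans (ev-+ g (scale a W) x) (+-congˡ (ev-scale a W x))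
          in k (g +ₚ scale a W , λ
          { zero → resp refl (sym (begin
              ev (g +ₚ scale a W) (μ zero)
                ≈⟨ ev-g′ (μ zero) ⟩
              ev g (μ zero) + (v + - ev g (μ zero)) * y * ev W (μ zero)
                ≈⟨ +-congˡ (trans (*-assoc _ y _) (*-congˡ (trans (*-comm y _) Wy≈1))) ⟩
              ev g (μ zero) + (v + - ev g (μ zero)) * 1#
                ≈⟨ +-congˡ (*-identityʳ _) ⟩
              ev g (μ zero) + (v + - ev g (μ zero))
                ≈⟨ solve 2 (λ g v → g :+ (v :- g) := v) refl (ev g (μ zero)) v ⟩
              v ∎)) value
          ; (suc i) → resp refl (sym (begin
              ev (g +ₚ scale a W) (μ (suc i))
                ≈⟨ ev-g′ (μ (suc i)) ⟩
              ev g (μ (suc i)) + a * ev W (μ (suc i))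
                ≈⟨ +-congˡ (trans (*-congˡ (nodal-root (μ ∘ suc) i)) (zeroʳ a)) ⟩
              ev g (μ (suc i)) + 0#
                ≈⟨ +-identityʳ _ ⟩
              ev g (μ (suc i)) ∎)) (values i)
          })
      }

  -- tr p(A)² is the sum of the squares of the entries of p(A).
  evᴹ-vanishes : ∀ {n} (A : Square n) (μ : Fin n → Carrier) → Symmetric A →
    (∀ q → trace (A ^ᴹ q) ≈ sum λ i → μ i ^ q) →
    ∀ p → (∀ i → ev p (μ i) ≈ 0#) → ∀ i j → evᴹ 0 p A i j ≈ 0#
  evᴹ-vanishes {n} A μ Aᵀ≈A tr p p[μ]≈0 i j = x²≈0⇒x≈0 (P i j) (≤-antisym
    (≤-trans (term≤sum (λ j → square≥0 (P i j)) j)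
      (≤-trans (term≤sum (λ i → sum-nonneg λ j → square≥0 (P i j)) i) (≤-reflexive squares≈0)))
    (square≥0 (P i j)))
    where
    P = evᴹ 0 p A
    squares≈0 : (sum λ i → sum λ j → P i j * P i j) ≈ 0#
    squares≈0 = begin
      (sum λ i → sum λ j → P i j * P i j)
        ≈⟨ sum-cong-≋ (λ i → sum-cong-≋ λ j → *-congˡ (evᴹ-symmetric 0 p Aᵀ≈A j i)) ⟩
      trace (P *ᴹ P)                   ≈⟨ sum-cong-≋ {n} (λ i → evᴹ-* p p A i i) ⟨
      trace (evᴹ 0 (p *ₚ p) A)         ≈⟨ trace-evᴹ A μ tr (p *ₚ p) ⟩
      (sum λ i → ev (p *ₚ p) (μ i))
        ≈⟨ sum-zero {n} (λ i → trans (ev-* p p (μ i)) (trans (*-congʳ (p[μ]≈0 i)) (zeroˡ _))) ⟩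
      0#                               ∎

  -- G is the inverse of A on the span of the eigenvectors with eigenvalue above
  -- T, and 0 on the others; wᵢ ∈ {0, 1} tells whether μᵢ is selected.
  record Selection {n} (A : Square n) (μ : Fin n → Carrier) (T : Carrier) : Set (c ⊔ ℓ₁ ⊔ ℓ₂) where
    field
      G             : Square n
      w             : Fin n → Carrier
      symmetric     : Symmetric G
      commutes      : A *ᴹ G ≈ᴹ G *ᴹ A
      pseudoInverse : A *ᴹ G *ᴹ G ≈ᴹ G
      trace-AG      : trace (A *ᴹ G) ≈ sum w
      trace-A²G     : trace (A *ᴹ (A *ᴹ G)) ≈ sum λ i → μ i * w i
      w[μ-T]≥0      : ∀ i → 0# ≤ w i * (μ i + - T)
      w[μ-T]≥μ-T    : ∀ i → μ i + - T ≤ w i * (μ i + - T)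

  -- The polynomial g takes the value 1/x at the selected eigenvalues and 0 at the others, and G =
  -- g(A). Then x g(x) is 1 or 0 there, so x g(x)² = g(x) at every eigenvalue, which `evᴹ-vanishes`
  -- lifts to A G G = G; the two traces follow from the trace formula.
  select : ∀ {n} (A : Square n) (μ : Fin n → Carrier) → Symmetric A →
    (∀ q → trace (A ^ᴹ q) ≈ sum λ i → μ i ^ q) →
    ∀ T → 0# ≤ T → ¬ ¬ Selection A μ T
  select {n} A μ Aᵀ≈A tr T 0≤T k = interpolate Value value-resp choose μ λ (g , values) → k (record
    { G          = evᴹ 0 g A
    ; w          = λ i → μ i * ev g (μ i)
    ; symmetric  = evᴹ-symmetric 0 g Aᵀ≈A
    ; commutes   = λ i j → begin
        (A *ᴹ evᴹ 0 g A) i j        ≈⟨ evᴹ-shift g A i j ⟨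
        evᴹ 0 (0# ∷ g) A i j        ≈⟨ evᴹ-symmetric 0 (0# ∷ g) Aᵀ≈A i j ⟨
        evᴹ 0 (0# ∷ g) A j i        ≈⟨ evᴹ-shift g A j i ⟩
        (A *ᴹ evᴹ 0 g A) j i        ≈⟨ *ᴹ-transpose A (evᴹ 0 g A) i j ⟩
        (evᴹ 0 g A ᵀ *ᴹ A ᵀ) i j    ≈⟨ *ᴹ-cong (evᴹ-symmetric 0 g Aᵀ≈A) Aᵀ≈A i j ⟩
        (evᴹ 0 g A *ᴹ A) i j        ∎
    ; pseudoInverse = λ i j → x∙y⁻¹≈ε⇒x≈y _ _ (begin
        (A *ᴹ evᴹ 0 g A *ᴹ evᴹ 0 g A) i j + - evᴹ 0 g A i j
          ≈⟨ +-cong (trans (*ᴹ-congʳ (evᴹ 0 g A) (λ i j → sym (evᴹ-shift g A i j)) i j)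
                           (sym (evᴹ-* (0# ∷ g) g A i j)))
                    (trans (sym (-1*x≈-x _)) (sym (evᴹ-scale 0 (- 1#) g A i j))) ⟩
        evᴹ 0 ((0# ∷ g) *ₚ g) A i j + evᴹ 0 (scale (- 1#) g) A i j
          ≈⟨ evᴹ-+ 0 ((0# ∷ g) *ₚ g) (scale (- 1#) g) A i j ⟨
        evᴹ 0 ((0# ∷ g) *ₚ g +ₚ scale (- 1#) g) A i j
          ≈⟨ evᴹ-vanishes A μ Aᵀ≈A tr ((0# ∷ g) *ₚ g +ₚ scale (- 1#) g) (λ i → idempotent g (μ i) (values i)) i j ⟩
        0# ∎)
    ; trace-AG   = begin
        trace (A *ᴹ evᴹ 0 g A)          ≈⟨ sum-cong-≋ {n} (λ i → evᴹ-shift g A i i) ⟨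
        trace (evᴹ 0 (0# ∷ g) A)        ≈⟨ trace-evᴹ A μ tr (0# ∷ g) ⟩
        (sum λ i → ev (0# ∷ g) (μ i))   ≈⟨ sum-cong-≋ {n} (λ i → +-identityˡ _) ⟩
        (sum λ i → μ i * ev g (μ i))    ∎
    ; trace-A²G  = begin
        trace (A *ᴹ (A *ᴹ evᴹ 0 g A))
          ≈⟨ sum-cong-≋ {n} (λ i → trans (evᴹ-shift (0# ∷ g) A i i) (*ᴹ-congˡ A (evᴹ-shift g A) i i)) ⟨
        trace (evᴹ 0 (0# ∷ 0# ∷ g) A)
          ≈⟨ trace-evᴹ A μ tr (0# ∷ 0# ∷ g) ⟩
        (sum λ i → ev (0# ∷ 0# ∷ g) (μ i))
          ≈⟨ sum-cong-≋ {n} (λ i → trans (+-identityˡ _) (*-congˡ (+-identityˡ _))) ⟩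
        (sum λ i → μ i * (μ i * ev g (μ i))) ∎
    ; w[μ-T]≥0   = λ i → nonneg (values i)
    ; w[μ-T]≥μ-T = λ i → dominates (values i)
    })
    where
    -- The alternatives overlap at x = T, so `≤-total` suffices and no strict comparison is needed;
    -- the factor x - T makes the choice immaterial there.
    Value : Carrier → Carrier → Set (ℓ₁ ⊔ ℓ₂)
    Value x v = (x ≤ T × v ≈ 0#) ⊎ (T ≤ x × x * v ≈ 1#)

    value-resp : ∀ {x x′ v v′} → x ≈ x′ → v ≈ v′ → Value x v → Value x′ v′
    value-resp x≈x′ v≈v′ (inj₁ (x≤T , v≈0)) = inj₁ (≤-resp x≈x′ refl x≤T , trans (sym v≈v′) v≈0)
    value-resp x≈x′ v≈v′ (inj₂ (T≤x , xv≈1)) =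
      inj₂ (≤-resp refl x≈x′ T≤x , trans (*-cong (sym x≈x′) (sym v≈v′)) xv≈1)

    choose : ∀ x → ¬ ¬ ∃ (Value x)
    choose x k = ≤-total x T λ
      { (inj₁ x≤T) → k (0# , inj₁ (x≤T , refl))
      ; (inj₂ T≤x) → invert x λ
        -- A zero eigenvalue has no reciprocal, but 0 ≤ T allows it to be counted among the rejected
        -- ones.
        { (inj₁ x≈0)        → k (0# , inj₁ (≤-resp (sym x≈0) refl 0≤T , refl))
        ; (inj₂ (y , xy≈1)) → k (y , inj₂ (T≤x , xy≈1))
        }
      }

    idempotent : ∀ g x → Value x (ev g x) → ev ((0# ∷ g) *ₚ g +ₚ scale (- 1#) g) x ≈ 0#
    idempotent g x value = begin
      ev ((0# ∷ g) *ₚ g +ₚ scale (- 1#) g) x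
        ≈⟨ ev-+ ((0# ∷ g) *ₚ g) (scale (- 1#) g) x ⟩
      ev ((0# ∷ g) *ₚ g) x + ev (scale (- 1#) g) x
        ≈⟨ +-cong (ev-* (0# ∷ g) g x) (trans (ev-scale (- 1#) g x) (-1*x≈-x _)) ⟩
      (0# + x * ev g x) * ev g x + - ev g x
        ≈⟨ +-congʳ (*-congʳ (+-identityˡ _)) ⟩
      x * ev g x * ev g x + - ev g x
        ≈⟨ +-congʳ (case value of λ
             { (inj₁ (_ , v≈0))  → trans (*-congˡ v≈0) (trans (zeroʳ _) (sym v≈0))
             ; (inj₂ (_ , xv≈1)) → trans (*-congʳ xv≈1) (*-identityˡ _)
             }) ⟩
      ev g x + - ev g x
        ≈⟨ -‿inverseʳ _ ⟩
      0# ∎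

    nonneg : ∀ {x v} → Value x v → 0# ≤ x * v * (x + - T)
    nonneg {x} (inj₁ (x≤T , v≈0))  =
      ≤-reflexive (sym (trans (*-congʳ (trans (*-congˡ v≈0) (zeroʳ x))) (zeroˡ _)))
    nonneg {x} (inj₂ (T≤x , xv≈1)) =
      ≤-resp refl (sym (trans (*-congʳ xv≈1) (*-identityˡ _))) (x≤y⇒0≤y-x T≤x)

    dominates : ∀ {x v} → Value x v → x + - T ≤ x * v * (x + - T)
    dominates {x} (inj₁ (x≤T , v≈0)) = ≤-resp refl
      (trans (-‿inverseʳ T) (sym (trans (*-congʳ (trans (*-congˡ v≈0) (zeroʳ x))) (zeroˡ _))))
      (+-mono-≤ x≤T ≤-refl)
    dominates {x} (inj₂ (T≤x , xv≈1)) =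
      ≤-reflexive (sym (trans (*-congʳ xv≈1) (*-identityˡ _)))

-- Projecting the rows of a Gram factor.

-- Let Q = Bᵀ G B, which is an orthogonal projection since G L G = G for
-- L = B Bᵀ.  For a row u of B, with d = |u|², the number x = u Q uᵀ is at most d,
-- and at most d Σ u_σ² Q_σσ by the Cauchy–Schwarz inequality.
module GramMatrix {c ℓ₁ ℓ₂ : Level} (F : StableOrderedField c ℓ₁ ℓ₂) where

  open StableOrderedField F
  open OrderedFieldProperties F
  open Relation.Binary.Reasoning.Setoid setoid
  open IntegerRingSolver commutativeRing
  open Sums commutativeRing
  open Matrices commutativeRing
  open FunctionalCalculus commutativeRing
  open SpectralProjection F

  module _ {m p : ℕ} (B : Matrix m p) (B³≈B : ∀ τ σ → B τ σ * B τ σ * B τ σ ≈ B τ σ)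
    {L : Square m} (L≈BBᵀ : L ≈ᴹ B *ᴹ B ᵀ)
    (d : Fin m → ℕ) (L-diagonal : ∀ τ → L τ τ ≈ ι (d τ))
    {μ : Fin m → Carrier} {T : Carrier} (selection : Selection L μ T) where

    open Selection selection

    L-symmetric : Symmetric L
    L-symmetric i j = begin
      L j i             ≈⟨ L≈BBᵀ j i ⟩
      (B *ᴹ B ᵀ) j i    ≈⟨ *ᴹ-transpose B (B ᵀ) i j ⟩
      (B *ᴹ B ᵀ) i j    ≈⟨ L≈BBᵀ i j ⟨
      L i j             ∎

    -- In terms of the projection Q defined below, Y = Q Bᵀ and X = L²G = B Q Bᵀ. Hence column τ of
    -- Y is the projection of row τ of B, and its squared length is `x τ`.
    LG X : Square m
    LG = L *ᴹ G
    X  = L *ᴹ LG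

    Y : Matrix p m
    Y = B ᵀ *ᴹ LG

    Q : Square p
    Q = B ᵀ *ᴹ (G *ᴹ B)

    x : Fin m → Carrier
    x τ = X τ τ

    GLG≈G : G *ᴹ LG ≈ᴹ G
    GLG≈G i j = begin
      (G *ᴹ (L *ᴹ G)) i j    ≈⟨ *ᴹ-assoc G L G i j ⟨
      (G *ᴹ L *ᴹ G) i j      ≈⟨ *ᴹ-congʳ G commutes i j ⟨
      (L *ᴹ G *ᴹ G) i j      ≈⟨ pseudoInverse i j ⟩
      G i j                  ∎

    BY≈X : B *ᴹ Y ≈ᴹ X
    BY≈X i j = trans (sym (*ᴹ-assoc B (B ᵀ) LG i j)) (*ᴹ-congʳ LG (λ i j → sym (L≈BBᵀ i j)) i j)

    YᵀY≈X : Y ᵀ *ᴹ Y ≈ᴹ X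
    YᵀY≈X i j = begin
      (Y ᵀ *ᴹ Y) i j                  ≈⟨ *ᴹ-congʳ Y (*ᴹ-transpose (B ᵀ) LG) i j ⟩
      ((LG ᵀ *ᴹ B) *ᴹ Y) i j          ≈⟨ *ᴹ-assoc (LG ᵀ) B Y i j ⟩
      (LG ᵀ *ᴹ (B *ᴹ Y)) i j          ≈⟨ *ᴹ-cong LGᵀ≈LG BY≈X i j ⟩
      (LG *ᴹ (L *ᴹ LG)) i j           ≈⟨ *ᴹ-congˡ LG L²G≈LGL i j ⟩
      (LG *ᴹ (LG *ᴹ L)) i j           ≈⟨ *ᴹ-assoc LG LG L i j ⟨
      (LG *ᴹ LG *ᴹ L) i j             ≈⟨ *ᴹ-congʳ L LGLG≈LG i j ⟩
      (LG *ᴹ L) i j                   ≈⟨ L²G≈LGL i j ⟨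
      X i j                           ∎
      where
      LGᵀ≈LG : LG ᵀ ≈ᴹ LG
      LGᵀ≈LG i j = trans (*ᴹ-transpose L G i j)
        (trans (*ᴹ-cong symmetric L-symmetric i j) (sym (commutes i j)))
      L²G≈LGL : L *ᴹ LG ≈ᴹ LG *ᴹ L
      L²G≈LGL i j = trans (*ᴹ-congˡ L commutes i j) (sym (*ᴹ-assoc L G L i j))
      LGLG≈LG : LG *ᴹ LG ≈ᴹ LG
      LGLG≈LG i j = trans (*ᴹ-assoc L G LG i j) (*ᴹ-congˡ L GLG≈G i j)

    QBᵀ≈Y : Q *ᴹ B ᵀ ≈ᴹ Y
    QBᵀ≈Y i j = begin
      (B ᵀ *ᴹ (G *ᴹ B) *ᴹ B ᵀ) i j    ≈⟨ *ᴹ-assoc (B ᵀ) (G *ᴹ B) (B ᵀ) i j ⟩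
      (B ᵀ *ᴹ (G *ᴹ B *ᴹ B ᵀ)) i j    ≈⟨ *ᴹ-congˡ (B ᵀ) GBBᵀ≈LG i j ⟩
      Y i j                           ∎
      where
      GBBᵀ≈LG : G *ᴹ B *ᴹ B ᵀ ≈ᴹ LG
      GBBᵀ≈LG i j = begin
        (G *ᴹ B *ᴹ B ᵀ) i j      ≈⟨ *ᴹ-assoc G B (B ᵀ) i j ⟩
        (G *ᴹ (B *ᴹ B ᵀ)) i j    ≈⟨ *ᴹ-congˡ G L≈BBᵀ i j ⟨
        (G *ᴹ L) i j             ≈⟨ commutes i j ⟨
        LG i j                   ∎

    QᵀQ≈Q : Q ᵀ *ᴹ Q ≈ᴹ Q
    QᵀQ≈Q i j = begin
      (Q ᵀ *ᴹ Q) i j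
        ≈⟨ *ᴹ-congʳ Q (λ i j → trans (*ᴹ-transpose (B ᵀ) (G *ᴹ B) i j)
             (trans (*ᴹ-congʳ B (*ᴹ-transpose G B) i j) (*ᴹ-assoc (B ᵀ) (G ᵀ) B i j))) i j ⟩
      (B ᵀ *ᴹ (G ᵀ *ᴹ B) *ᴹ Q) i j                ≈⟨ *ᴹ-assoc (B ᵀ) (G ᵀ *ᴹ B) Q i j ⟩
      (B ᵀ *ᴹ (G ᵀ *ᴹ B *ᴹ Q)) i j                ≈⟨ *ᴹ-congˡ (B ᵀ) middle i j ⟩
      Q i j                                       ∎
      where
      middle : G ᵀ *ᴹ B *ᴹ Q ≈ᴹ G *ᴹ B
      middle i j = begin
        (G ᵀ *ᴹ B *ᴹ (B ᵀ *ᴹ (G *ᴹ B))) i j     ≈⟨ *ᴹ-cong {B = B ᵀ *ᴹ (G *ᴹ B)} (*ᴹ-congʳ B symmetric) (λ _ _ → refl) i j ⟩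
        (G *ᴹ B *ᴹ (B ᵀ *ᴹ (G *ᴹ B))) i j       ≈⟨ *ᴹ-assoc G B (B ᵀ *ᴹ (G *ᴹ B)) i j ⟩
        (G *ᴹ (B *ᴹ (B ᵀ *ᴹ (G *ᴹ B)))) i j     ≈⟨ *ᴹ-congˡ G (λ i j → sym (*ᴹ-assoc B (B ᵀ) (G *ᴹ B) i j)) i j ⟩
        (G *ᴹ (B *ᴹ B ᵀ *ᴹ (G *ᴹ B))) i j       ≈⟨ *ᴹ-congˡ G (*ᴹ-congʳ (G *ᴹ B) L≈BBᵀ) i j ⟨
        (G *ᴹ (L *ᴹ (G *ᴹ B))) i j              ≈⟨ *ᴹ-congˡ G (*ᴹ-assoc L G B) i j ⟨
        (G *ᴹ (LG *ᴹ B)) i j                    ≈⟨ *ᴹ-assoc G LG B i j ⟨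
        (G *ᴹ LG *ᴹ B) i j                      ≈⟨ *ᴹ-congʳ B GLG≈G i j ⟩
        (G *ᴹ B) i j                            ∎

    trace-Q : trace Q ≈ sum w
    trace-Q = begin
      trace (B ᵀ *ᴹ (G *ᴹ B))    ≈⟨ trace-*ᴹ-comm (B ᵀ) (G *ᴹ B) ⟩
      trace (G *ᴹ B *ᴹ B ᵀ)      ≈⟨ sum-cong-≋ {m} (λ i → trans (*ᴹ-assoc G B (B ᵀ) i i)
                                      (*ᴹ-congˡ G (λ i j → sym (L≈BBᵀ i j)) i i)) ⟩
      trace (G *ᴹ L)             ≈⟨ sum-cong-≋ {m} (λ i → commutes i i) ⟨
      trace (L *ᴹ G)             ≈⟨ trace-AG ⟩
      sum w                      ∎

    Q-diagonal≥0 : ∀ σ → 0# ≤ Q σ σ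
    Q-diagonal≥0 σ = ≤-resp refl (QᵀQ≈Q σ σ) (sum-nonneg λ s → square≥0 (Q s σ))

    x≥0 : ∀ τ → 0# ≤ x τ
    x≥0 τ = ≤-resp refl (YᵀY≈X τ τ) (sum-nonneg λ s → square≥0 (Y s τ))

    -- The difference d - x is the squared distance from row τ to its projection.
    x≤d : ∀ τ → x τ ≤ ι (d τ)
    x≤d τ = 0≤y-x⇒x≤y (≤-resp refl expand (sum-nonneg λ s → square≥0 (B τ s + - Y s τ)))
      where
      expand : (sum λ s → (B τ s + - Y s τ) * (B τ s + - Y s τ)) ≈ ι (d τ) + - x τ
      expand = begin
        (sum λ s → (B τ s + - Y s τ) * (B τ s + - Y s τ))
          ≈⟨ sum-cong-≋ (λ s → solve 2 (λ b y → (b :- y) :* (b :- y) := b :* b :+ ((y :* y :- b :* y) :- b :* y)) refl (B τ s) (Y s τ)) ⟩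
        (sum λ s → B τ s * B τ s + ((Y s τ * Y s τ + - (B τ s * Y s τ)) + - (B τ s * Y s τ)))
          ≈⟨ ∑-distrib-+ (λ s → B τ s * B τ s) _ ⟩
        (B *ᴹ B ᵀ) τ τ + (sum λ s → (Y s τ * Y s τ + - (B τ s * Y s τ)) + - (B τ s * Y s τ))
          ≈⟨ +-congˡ (trans (∑-distrib-+ (λ s → Y s τ * Y s τ + - (B τ s * Y s τ)) _)
               (+-congʳ (∑-distrib-+ (λ s → Y s τ * Y s τ) _))) ⟩
        (B *ᴹ B ᵀ) τ τ + (((Y ᵀ *ᴹ Y) τ τ + (sum λ s → - (B τ s * Y s τ))) + (sum λ s → - (B τ s * Y s τ)))
          ≈⟨ +-cong (trans (sym (L≈BBᵀ τ τ)) (L-diagonal τ)) (+-cong (+-cong (YᵀY≈X τ τ) BY) BY) ⟩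
        ι (d τ) + ((x τ + - x τ) + - x τ)
          ≈⟨ solve 2 (λ d x → d :+ ((x :- x) :- x) := d :- x) refl (ι (d τ)) (x τ) ⟩
        ι (d τ) + - x τ ∎
        where
        BY : (sum λ s → - (B τ s * Y s τ)) ≈ - x τ
        BY = trans (sum-neg λ s → B τ s * Y s τ) (-‿cong (BY≈X τ τ))

    -- The squares of the entries of B are 0 or 1, so this is the share of tr Q that lies on the
    -- support of row τ.
    mass : Fin m → Carrier
    mass τ = sum λ σ → B τ σ * B τ σ * Q σ σ

    mass≥0 : ∀ τ → 0# ≤ mass τ
    mass≥0 τ = sum-nonneg λ σ → *-nonneg (square≥0 (B τ σ)) (Q-diagonal≥0 σ)

    -- For fixed s, y = Σ_σ Q_sσ u_σ obeys y² ≤ D Σ_σ u_σ² Q_sσ² by Cauchy-Schwarz, here as a sum of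
    -- squares in which u³ = u lowers the powers. Summing over s gives x on the left and, through
    -- QᵀQ = Q, the mass on the right. The outer factor D remains because D may be 0.
    d*mass-x : ∀ τ → 0# ≤ ι (d τ) * (ι (d τ) * mass τ + - x τ)
    d*mass-x τ = ≤-resp refl expand
      (sum-nonneg λ s → sum-nonneg λ σ → square≥0 (D * (u σ * u σ * Q s σ) + - (Y s τ * u σ)))
      where
      D = ι (d τ)
      u = B τ

      term : ∀ s σ → let v = D * (u σ * u σ * Q s σ) + - (Y s τ * u σ) in
        v * v ≈ D * D * (u σ * u σ * (Q s σ * Q s σ)) +
                ((Y s τ * Y s τ) * (u σ * u σ) + - (D * Y s τ + D * Y s τ) * (Q s σ * u σ))
      term s σ = begin
        (D * (b * b * q) + - (y * b)) * (D * (b * b * q) + - (y * b))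
          ≈⟨ solve 4 (λ D b q y → (D :* (b :* b :* q) :- y :* b) :* (D :* (b :* b :* q) :- y :* b) :=
                D :* D :* ((b :* b :* b) :* b :* (q :* q)) :+
                (y :* y :* (b :* b) :+ :- (D :* y :+ D :* y) :* (q :* (b :* b :* b)))) refl D b q y ⟩
        D * D * (b * b * b * b * (q * q)) + (y * y * (b * b) + - (D * y + D * y) * (q * (b * b * b)))
          ≈⟨ +-cong (*-congˡ (*-congʳ (*-congʳ (B³≈B τ σ)))) (+-congˡ (*-congˡ (*-congˡ (B³≈B τ σ)))) ⟩
        D * D * (b * b * (q * q)) + (y * y * (b * b) + - (D * y + D * y) * (q * b)) ∎
        where
        b = u σ
        q = Q s σ
        y = Y s τ

      row : ∀ s → (sum λ σ → let v = D * (u σ * u σ * Q s σ) + - (Y s τ * u σ) in v * v) ≈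
        D * D * (sum λ σ → u σ * u σ * (Q s σ * Q s σ)) + - D * (Y s τ * Y s τ)
      row s = begin
        (sum λ σ → let v = D * (u σ * u σ * Q s σ) + - (Y s τ * u σ) in v * v)
          ≈⟨ sum-cong-≋ (term s) ⟩
        (sum λ σ → D * D * (u σ * u σ * (Q s σ * Q s σ)) + (y * y * (u σ * u σ) + - (D * y + D * y) * (Q s σ * u σ)))
          ≈⟨ trans (∑-distrib-+ (λ σ → D * D * (u σ * u σ * (Q s σ * Q s σ))) _)
               (+-congˡ (∑-distrib-+ (λ σ → y * y * (u σ * u σ)) _)) ⟩
        (sum λ σ → D * D * (u σ * u σ * (Q s σ * Q s σ))) +
          ((sum λ σ → y * y * (u σ * u σ)) + (sum λ σ → - (D * y + D * y) * (Q s σ * u σ)))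
          ≈⟨ +-cong (sym (*-distribˡ-sum (D * D) λ σ → u σ * u σ * (Q s σ * Q s σ)))
               (+-cong (sym (*-distribˡ-sum (y * y) λ σ → u σ * u σ))
                       (sym (*-distribˡ-sum (- (D * y + D * y)) λ σ → Q s σ * u σ))) ⟩
        D * D * q² + (y * y * (B *ᴹ B ᵀ) τ τ + - (D * y + D * y) * (Q *ᴹ B ᵀ) s τ)
          ≈⟨ +-congˡ (+-cong (*-congˡ (trans (sym (L≈BBᵀ τ τ)) (L-diagonal τ))) (*-congˡ (QBᵀ≈Y s τ))) ⟩
        D * D * q² + (y * y * D + - (D * y + D * y) * y)
          ≈⟨ solve 3 (λ D q y → D :* D :* q :+ (y :* y :* D :+ :- (D :* y :+ D :* y) :* y) :=
                D :* D :* q :+ :- D :* (y :* y)) refl D q² y ⟩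
        D * D * q² + - D * (y * y) ∎
        where
        y = Y s τ
        q² = sum λ σ → u σ * u σ * (Q s σ * Q s σ)

      expand : (sum λ s → sum λ σ → let v = D * (u σ * u σ * Q s σ) + - (Y s τ * u σ) in v * v) ≈
        D * (D * mass τ + - x τ)
      expand = begin
        (sum λ s → sum λ σ → let v = D * (u σ * u σ * Q s σ) + - (Y s τ * u σ) in v * v)
          ≈⟨ sum-cong-≋ row ⟩
        (sum λ s → D * D * (sum λ σ → u σ * u σ * (Q s σ * Q s σ)) + - D * (Y s τ * Y s τ))
          ≈⟨ ∑-distrib-+ (λ s → D * D * (sum λ σ → u σ * u σ * (Q s σ * Q s σ))) _ ⟩
        (sum λ s → D * D * (sum λ σ → u σ * u σ * (Q s σ * Q s σ))) + (sum λ s → - D * (Y s τ * Y s τ))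
          ≈⟨ +-cong (*-distribˡ-sum (D * D) λ s → sum λ σ → u σ * u σ * (Q s σ * Q s σ))
               (*-distribˡ-sum (- D) λ s → Y s τ * Y s τ) ⟨
        D * D * (sum λ s → sum λ σ → u σ * u σ * (Q s σ * Q s σ)) + - D * (Y ᵀ *ᴹ Y) τ τ
          ≈⟨ +-cong (*-congˡ (∑-comm {p} {p} λ s σ → u σ * u σ * (Q s σ * Q s σ))) (*-congˡ (YᵀY≈X τ τ)) ⟩
        D * D * (sum λ σ → sum λ s → u σ * u σ * (Q s σ * Q s σ)) + - D * x τ
          ≈⟨ +-congʳ (*-congˡ (sum-cong-≋ λ σ → trans
               (sym (*-distribˡ-sum (u σ * u σ) λ s → Q s σ * Q s σ)) (*-congˡ (QᵀQ≈Q σ σ)))) ⟩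
        D * D * mass τ + - D * x τ
          ≈⟨ solve 3 (λ D a x → D :* D :* a :+ :- D :* x := D :* (D :* a :- x)) refl D (mass τ) (x τ) ⟩
        D * (D * mass τ + - x τ) ∎

    -- For t ≤ d this is the mean of x ≤ d · mass and x ≤ d with weights t/d and 1 - t/d. For d ≤ t
    -- the first bound already suffices. Both cases are proved multiplied by d, which is then
    -- cancelled.
    x≤t*mass+[d∸t] : ∀ t τ → x τ ≤ ι t * mass τ + ι (d τ ℕ.∸ t)
    x≤t*mass+[d∸t] t τ = bound (d τ) ≡.refl
      where
      bound : ∀ n → n ≡ d τ → x τ ≤ ι t * mass τ + ι (n ℕ.∸ t)
      -- Degree 0 cannot be cancelled, but here x ≤ d = 0 is enough.
      bound zero eq = ≤-trans
        (≤-resp refl (reflexive (≡.cong ι (≡.sym eq))) (x≤d τ))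
        (≤-resp (+-identityʳ 0#) refl (+-mono-≤ (*-nonneg (ι≥0 t) (mass≥0 τ)) (ι≥0 (0 ℕ.∸ t))))
      bound (suc n) eq = 0≤y-x⇒x≤y (ι-cancel-nonneg n _ (case ℕ.≤-total (suc n) t of λ
        { (inj₁ d≤t) → *-nonneg (ι≥0 (suc n)) (≤-resp refl
            (solve 4 (λ t a x e → t :* a :+ e :- x := (t :* a :+ e) :- x) refl _ _ _ _)
            (x≤y⇒0≤y-x (≤-trans (0≤y-x⇒x≤y d*a-x≥0) (≤-resp (+-identityʳ _) refl
              (+-mono-≤ (≤-resp (*-comm _ _) (*-comm _ _) (*-monoˡ-≤ (mass≥0 τ) (ι-mono d≤t))) (ι≥0 (suc n ℕ.∸ t)))))))
        ; (inj₂ t≤d) → ≤-resp refl (begin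
            ι t * (D * mass τ + - x τ) + ι (suc n ℕ.∸ t) * (D + - x τ)
              ≈⟨ solve 5 (λ t D a x e → t :* (D :* a :- x) :+ e :* (D :- x) :=
                   D :* (t :* a :+ e) :- (t :+ e) :* x) refl (ι t) D (mass τ) (x τ) (ι (suc n ℕ.∸ t)) ⟩
            D * (ι t * mass τ + ι (suc n ℕ.∸ t)) + - ((ι t + ι (suc n ℕ.∸ t)) * x τ)
              ≈⟨ +-congˡ (-‿cong (*-congʳ (trans (sym (×-homo-+ 1# t (suc n ℕ.∸ t)))
                   (reflexive (≡.cong ι (ℕ.m+[n∸m]≡n t≤d)))))) ⟩
            D * (ι t * mass τ + ι (suc n ℕ.∸ t)) + - (D * x τ)
              ≈⟨ solve 3 (λ D y x → D :* y :- D :* x := D :* (y :- x)) refl D _ (x τ) ⟩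
            D * (ι t * mass τ + ι (suc n ℕ.∸ t) + - x τ) ∎)
            (+-mono-≤′ (*-nonneg (ι≥0 t) d*a-x≥0)
              (*-nonneg (ι≥0 (suc n ℕ.∸ t)) (x≤y⇒0≤y-x (≤-resp refl (reflexive (≡.cong ι (≡.sym eq))) (x≤d τ)))))
        }))
        where
        D = ι (suc n)
        d*a-x≥0 : 0# ≤ D * mass τ + - x τ
        d*a-x≥0 = ι-cancel-nonneg n _ (≡.subst (λ n → 0# ≤ ι n * (ι n * mass τ + - x τ)) (≡.sym eq) (d*mass-x τ))
        +-mono-≤′ : ∀ {y z} → 0# ≤ y → 0# ≤ z → 0# ≤ y + z
        +-mono-≤′ 0≤y 0≤z = ≤-resp (+-identityˡ 0#) refl (+-mono-≤ 0≤y 0≤z)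

    -- The function χ j plays the indicator of the j-th part. The two hypotheses say that the parts
    -- cover all rows and that a column of B meets each part at most once, which is disjointness of
    -- supports.
    module _ {s : ℕ} (χ : Fin s → Fin m → Carrier) (χ≥0 : ∀ j τ → 0# ≤ χ j τ)
      (covers : ∀ τ → 1# ≤ sum λ j → χ j τ)
      (disjoint : ∀ j σ → (sum λ τ → χ j τ * (B τ σ * B τ σ)) ≤ 1#)
      (t : Fin s → ℕ) where

      excess : Fin s → Carrier
      excess j = sum λ τ → χ j τ * ι (d τ ℕ.∸ t j)

      -- Exchanging the sums weights each diagonal entry of Q by at most 1, and these entries are
      -- nonnegative with total tr Q = Σ w.
      part-mass : ∀ j → (sum λ τ → χ j τ * mass τ) ≤ sum w
      part-mass j = ≤-resp (sym exchange) trace-Q (sum-mono λ σ →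
        ≤-resp refl (*-identityʳ (Q σ σ)) (*-monoˡ-≤ (Q-diagonal≥0 σ) (disjoint j σ)))
        where
        exchange : (sum λ τ → χ j τ * mass τ) ≈ sum λ σ → Q σ σ * sum λ τ → χ j τ * (B τ σ * B τ σ)
        exchange = begin
          (sum λ τ → χ j τ * sum λ σ → B τ σ * B τ σ * Q σ σ)
            ≈⟨ sum-cong-≋ (λ τ → *-distribˡ-sum (χ j τ) λ σ → B τ σ * B τ σ * Q σ σ) ⟩
          (sum λ τ → sum λ σ → χ j τ * (B τ σ * B τ σ * Q σ σ))
            ≈⟨ ∑-comm {m} {p} (λ τ σ → χ j τ * (B τ σ * B τ σ * Q σ σ)) ⟩
          (sum λ σ → sum λ τ → χ j τ * (B τ σ * B τ σ * Q σ σ))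
            ≈⟨ sum-cong-≋ (λ σ → trans
                 (sum-cong-≋ λ τ → solve 3 (λ c b q → c :* (b :* q) := q :* (c :* b)) refl (χ j τ) (B τ σ * B τ σ) (Q σ σ))
                 (sym (*-distribˡ-sum (Q σ σ) λ τ → χ j τ * (B τ σ * B τ σ)))) ⟩
          (sum λ σ → Q σ σ * sum λ τ → χ j τ * (B τ σ * B τ σ)) ∎

      part-bound : ∀ j → (sum λ τ → χ j τ * x τ) ≤ ι (t j) * sum w + excess j
      part-bound j = ≤-trans
        (sum-mono λ τ → *-monoˡ-≤ (χ≥0 j τ) (x≤t*mass+[d∸t] (t j) τ))
        (≤-resp (sym (begin
          (sum λ τ → χ j τ * (ι (t j) * mass τ + ι (d τ ℕ.∸ t j)))
            ≈⟨ sum-cong-≋ (λ τ → solve 4 (λ c t a e → c :* (t :* a :+ e) := t :* (c :* a) :+ c :* e) refl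
                 (χ j τ) (ι (t j)) (mass τ) (ι (d τ ℕ.∸ t j))) ⟩
          (sum λ τ → ι (t j) * (χ j τ * mass τ) + χ j τ * ι (d τ ℕ.∸ t j))
            ≈⟨ ∑-distrib-+ (λ τ → ι (t j) * (χ j τ * mass τ)) _ ⟩
          (sum λ τ → ι (t j) * (χ j τ * mass τ)) + excess j
            ≈⟨ +-congʳ (*-distribˡ-sum (ι (t j)) λ τ → χ j τ * mass τ) ⟨
          ι (t j) * (sum λ τ → χ j τ * mass τ) + excess j ∎)) refl
          (+-mono-≤ (*-monoˡ-≤ (ι≥0 (t j)) (part-mass j)) ≤-refl))

      -- The left side is tr X - T tr Q for T = Σ t_j. Each part contributes at most t_j tr Q plus
      -- its excess, so the multiples of tr Q cancel exactly; this is why T is taken to be the sum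
      -- of the thresholds.
      selected-sum : (sum λ i → w i * (μ i + - sum λ j → ι (t j))) ≤ sum excess
      selected-sum = ≤-resp (sym (begin
        (sum λ i → w i * (μ i + - Σt))
          ≈⟨ sum-cong-≋ (λ i → solve 3 (λ w m t → w :* (m :- t) := m :* w :+ :- t :* w) refl (w i) (μ i) Σt) ⟩
        (sum λ i → μ i * w i + - Σt * w i)
          ≈⟨ ∑-distrib-+ (λ i → μ i * w i) _ ⟩
        (sum λ i → μ i * w i) + (sum λ i → - Σt * w i)
          ≈⟨ +-cong (sym trace-A²G) (sym (*-distribˡ-sum (- Σt) w)) ⟩
        sum x + - Σt * sum w ∎))
        (solve 3 (λ t w e → (t :* w :+ e) :+ :- t :* w := e) refl Σt (sum w) (sum excess))
        (+-mono-≤ (≤-trans each-in-a-part all-parts) ≤-refl)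
        where
        Σt = sum λ j → ι (t j)

        each-in-a-part : sum x ≤ sum λ j → sum λ τ → χ j τ * x τ
        each-in-a-part = ≤-resp refl (begin
          (sum λ τ → x τ * sum λ j → χ j τ)
            ≈⟨ sum-cong-≋ (λ τ → *-distribˡ-sum (x τ) λ j → χ j τ) ⟩
          (sum λ τ → sum λ j → x τ * χ j τ)
            ≈⟨ ∑-comm {m} {s} (λ τ j → x τ * χ j τ) ⟩
          (sum λ j → sum λ τ → x τ * χ j τ)
            ≈⟨ sum-cong-≋ (λ j → sum-cong-≋ λ τ → *-comm (x τ) (χ j τ)) ⟩
          (sum λ j → sum λ τ → χ j τ * x τ) ∎)
          (sum-mono λ τ → ≤-resp (*-identityʳ (x τ)) refl (*-monoˡ-≤ (x≥0 τ) (covers τ)))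

        all-parts : (sum λ j → sum λ τ → χ j τ * x τ) ≤ Σt * sum w + sum excess
        all-parts = ≤-resp refl (trans
          (∑-distrib-+ (λ j → ι (t j) * sum w) excess)
          (+-congʳ (sym (*-distribʳ-sum (sum w) λ j → ι (t j)))))
          (sum-mono part-bound)

      sumFirst-bound : T ≈ (sum λ j → ι (t j)) → ∀ k (k≤m : k ℕ.≤ m) →
        (sum λ i → μ (inject≤ {k} i k≤m)) ≤ sum λ j → ι k * ι (t j) + excess j
      sumFirst-bound T≈Σt k k≤m = ≤-trans
        (sum-mono λ i → ≤-resp
          (solve 2 (λ t m → t :+ (m :- t) := m) refl T (μ (inject≤ i k≤m))) refl
          (+-mono-≤ ≤-refl (w[μ-T]≥μ-T (inject≤ i k≤m))))
        (≤-resp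
          (sym (trans (∑-distrib-+ {k} (λ _ → T) _) (+-congʳ (sum-const k T))))
          (begin
            ι k * T + sum excess
              ≈⟨ +-congʳ (trans (*-congˡ T≈Σt) (*-distribˡ-sum (ι k) λ j → ι (t j))) ⟩
            (sum λ j → ι k * ι (t j)) + sum excess
              ≈⟨ ∑-distrib-+ (λ j → ι k * ι (t j)) excess ⟨
            (sum λ j → ι k * ι (t j) + excess j) ∎)
          (+-mono-≤ ≤-refl (≤-trans (subsum w[μ-T]≥0 k k≤m)
            (≤-resp (sum-cong-≋ {m} λ i → *-congˡ {w i} (+-congˡ {μ i} (-‿cong (sym T≈Σt)))) refl selected-sum))))

-- The ring of Cauchy reals.

module Reals where

  open Defs using (ℝ; seq; cauchy)
  open import Data.Rational.Base using (ℚ; 0ℚ; 1ℚ; ½; ∣_∣)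
  open IntegerRingSolver ℚ.+-*-commutativeRing
  open ℚ.≤-Reasoning

  0<½ : ∀ {ε} → 0ℚ ℚ.< ε → 0ℚ ℚ.< ½ ℚ.* ε
  0<½ {ε} 0<ε = ≡.subst (ℚ._< ½ ℚ.* ε) (ℚ.*-zeroʳ ½) (ℚ.*-monoʳ-<-pos ½ 0<ε)

  ½+½ : ∀ ε → ½ ℚ.* ε ℚ.+ ½ ℚ.* ε ≡ ε
  ½+½ ε = ≡.trans (≡.sym (ℚ.*-distribʳ-+ ε ½ ½)) (ℚ.*-identityˡ ε)

  p-q<r⇒p<q+r : ∀ p q r → p ℚ.- q ℚ.< r → p ℚ.< q ℚ.+ r
  p-q<r⇒p<q+r p q r p-q<r = ≡.subst (ℚ._< q ℚ.+ r)
    (solve 2 (λ p q → q :+ (p :- q) := p) ≡.refl p q) (ℚ.+-monoʳ-< q p-q<r)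

  p<q+r⇒p-q<r : ∀ p q r → p ℚ.< q ℚ.+ r → p ℚ.- q ℚ.< r
  p<q+r⇒p-q<r p q r p<q+r = ≡.subst (p ℚ.- q ℚ.<_)
    (solve 2 (λ q r → q :+ r :- q := r) ≡.refl q r) (ℚ.+-monoˡ-< (ℚ.- q) p<q+r)

  p≤∣p∣ : ∀ p → p ℚ.≤ ∣ p ∣
  p≤∣p∣ p with ℚ.∣p∣≡p∨∣p∣≡-p p
  ... | inj₁ ∣p∣≡p  = ℚ.≤-reflexive (≡.sym ∣p∣≡p)
  ... | inj₂ ∣p∣≡-p = ℚ.≤-trans p≤0 (ℚ.0≤∣p∣ p)
    where
    p≤0 : p ℚ.≤ 0ℚ
    p≤0 = ≡.subst (ℚ._≤ 0ℚ) (solve 1 (λ p → :- :- p := p) ≡.refl p)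
      (ℚ.neg-antimono-≤ (≡.subst (0ℚ ℚ.≤_) ∣p∣≡-p (ℚ.0≤∣p∣ p)))

  ∣p∣<q : ∀ p q → p ℚ.< q → ℚ.- p ℚ.< q → ∣ p ∣ ℚ.< q
  ∣p∣<q p q p<q -p<q with ℚ.∣p∣≡p∨∣p∣≡-p p
  ... | inj₁ ∣p∣≡p  = ≡.subst (ℚ._< q) (≡.sym ∣p∣≡p) p<q
  ... | inj₂ ∣p∣≡-p = ≡.subst (ℚ._< q) (≡.sym ∣p∣≡-p) -p<q

  Eventually : (ℕ → Set) → Set
  Eventually P = ∃[ N ] ∀ n → N ℕ.≤ n → P n

  always : ∀ {P : ℕ → Set} → (∀ n → P n) → Eventually P
  always P = 0 , λ n _ → P n

  eventually-map : ∀ {P Q : ℕ → Set} → (∀ n → P n → Q n) → Eventually P → Eventually Q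
  eventually-map f (N , P) = N , λ n N≤n → f n (P n N≤n)

  eventually-zip : ∀ {P Q R : ℕ → Set} → (∀ n → P n → Q n → R n) →
    Eventually P → Eventually Q → Eventually R
  eventually-zip f (M , P) (N , Q) = M ℕ.⊔ N , λ n M⊔N≤n →
    f n (P n (ℕ.≤-trans (ℕ.m≤m⊔n M N) M⊔N≤n)) (Q n (ℕ.≤-trans (ℕ.m≤n⊔m M N) M⊔N≤n))

  -- Equality of reals is by definition `Null` of the difference of the sequences, so the congruence
  -- laws become closure properties of null sequences.
  Null : (ℕ → ℚ) → Set
  Null z = ∀ ε → 0ℚ ℚ.< ε → Eventually λ n → ∣ z n ∣ ℚ.< ε

  Bounded : (ℕ → ℚ) → Set
  Bounded b = ∃[ B ] 0ℚ ℚ.< B × Eventually λ n → ∣ b n ∣ ℚ.< B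

  null-resp : ∀ {y z} → (∀ n → y n ≡ z n) → Null y → Null z
  null-resp y≡z null ε 0<ε =
    eventually-map (λ n → ≡.subst (λ q → ∣ q ∣ ℚ.< ε) (y≡z n)) (null ε 0<ε)

  null-zero : ∀ {z} → (∀ n → z n ≡ 0ℚ) → Null z
  null-zero z≡0 ε 0<ε = always λ n → ≡.subst (λ q → ∣ q ∣ ℚ.< ε) (≡.sym (z≡0 n)) 0<ε

  null-+ : ∀ {y z} → Null y → Null z → Null (λ n → y n ℚ.+ z n)
  null-+ {y} {z} null-y null-z ε 0<ε = eventually-zip
    (λ n y<½ε z<½ε → begin-strict
      ∣ y n ℚ.+ z n ∣          ≤⟨ ℚ.∣p+q∣≤∣p∣+∣q∣ (y n) (z n) ⟩
      ∣ y n ∣ ℚ.+ ∣ z n ∣      <⟨ ℚ.+-mono-< y<½ε z<½ε ⟩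
      ½ ℚ.* ε ℚ.+ ½ ℚ.* ε      ≡⟨ ½+½ ε ⟩
      ε                        ∎)
    (null-y _ (0<½ 0<ε)) (null-z _ (0<½ 0<ε))

  null-neg : ∀ {z} → Null z → Null (λ n → ℚ.- z n)
  null-neg {z} null ε 0<ε =
    eventually-map (λ n → ≡.subst (ℚ._< ε) (≡.sym (ℚ.∣-p∣≡∣p∣ (z n)))) (null ε 0<ε)

  reciprocal : ∀ B → 0ℚ ℚ.< B → ∃[ I ] 0ℚ ℚ.< I × B ℚ.* I ≡ 1ℚ
  reciprocal B 0<B =
    (ℚ.1/ B) {{nonZero}} ,
    ℚ.positive⁻¹ ((ℚ.1/ B) {{nonZero}}) {{ℚ.1/pos⇒pos B {{ℚ.positive 0<B}}}} ,
    ℚ.*-inverseʳ B {{nonZero}}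
    where
    nonZero : ℚ.NonZero B
    nonZero = ℚ.pos⇒nonZero B {{ℚ.positive 0<B}}

  *-pos : ∀ {p q} → 0ℚ ℚ.< p → 0ℚ ℚ.< q → 0ℚ ℚ.< p ℚ.* q
  *-pos {p} {q} 0<p 0<q = ℚ.positive⁻¹ (p ℚ.* q) {{ℚ.pos*pos⇒pos p {{ℚ.positive 0<p}} q {{ℚ.positive 0<q}}}}

  ∣∣-* : ∀ p q {P Q} → ∣ p ∣ ℚ.≤ P → ∣ q ∣ ℚ.< Q → 0ℚ ℚ.< P → ∣ p ℚ.* q ∣ ℚ.< P ℚ.* Q
  ∣∣-* p q {P} {Q} p≤P q<Q 0<P = begin-strict
    ∣ p ℚ.* q ∣      ≡⟨ ℚ.∣p*q∣≡∣p∣*∣q∣ p q ⟩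
    ∣ p ∣ ℚ.* ∣ q ∣  ≤⟨ ℚ.*-monoʳ-≤-nonNeg ∣ q ∣ {{ℚ.∣-∣-nonNeg q}} p≤P ⟩
    P ℚ.* ∣ q ∣      <⟨ ℚ.*-monoʳ-<-pos P {{ℚ.positive 0<P}} q<Q ⟩
    P ℚ.* Q          ∎

  null-* : ∀ {b z} → Bounded b → Null z → Null (λ n → b n ℚ.* z n)
  null-* {b} {z} (B , 0<B , b<B) null ε 0<ε =
    let I , 0<I , BI≡1 = reciprocal B 0<B
        BIε≡ε = ≡.trans (≡.sym (ℚ.*-assoc B I ε)) (≡.trans (≡.cong (ℚ._* ε) BI≡1) (ℚ.*-identityˡ ε))
    in eventually-zip
      (λ n b<B z<Iε → ≡.subst (∣ b n ℚ.* z n ∣ ℚ.<_) BIε≡ε (∣∣-* (b n) (z n) (ℚ.<⇒≤ b<B) z<Iε 0<B))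
      b<B (null (I ℚ.* ε) (*-pos 0<I 0<ε))

  bounded : ∀ x → Bounded (seq x)
  bounded x = let N , close = cauchy x 1ℚ (ℚ.positive⁻¹ 1ℚ) in
    1ℚ ℚ.+ ∣ seq x N ∣ , ℚ.+-mono-<-≤ (ℚ.positive⁻¹ 1ℚ) (ℚ.0≤∣p∣ (seq x N)) , N , λ n N≤n → begin-strict
      ∣ seq x n ∣
        ≡⟨ ≡.cong ∣_∣ (solve 2 (λ a b → a := (a :- b) :+ b) ≡.refl (seq x n) (seq x N)) ⟩
      ∣ (seq x n ℚ.- seq x N) ℚ.+ seq x N ∣
        ≤⟨ ℚ.∣p+q∣≤∣p∣+∣q∣ (seq x n ℚ.- seq x N) (seq x N) ⟩
      ∣ seq x n ℚ.- seq x N ∣ ℚ.+ ∣ seq x N ∣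
        <⟨ ℚ.+-monoˡ-< ∣ seq x N ∣ (close n N N≤n ℕ.≤-refl) ⟩
      1ℚ ℚ.+ ∣ seq x N ∣ ∎

  bounded-∣∣ : ∀ {b} → Bounded b → Bounded (λ n → ∣ b n ∣)
  bounded-∣∣ {b} (B , 0<B , b<B) =
    B , 0<B , eventually-map (λ n → ≡.subst (ℚ._< B) (≡.sym (ℚ.∣∣p∣∣≡∣p∣ (b n)))) b<B

  pointwise : ∀ {x y} → (∀ n → seq x n ≡ seq y n) → x Defs.≈ y
  pointwise {x} {y} x≡y = null-zero λ n →
    ≡.trans (≡.cong (ℚ._- seq y n) (x≡y n)) (ℚ.+-inverseʳ (seq y n))

  ≈-sym : ∀ {x y} → x Defs.≈ y → y Defs.≈ x
  ≈-sym {x} {y} x≈y = null-resp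
    (λ n → solve 2 (λ a b → :- (a :- b) := b :- a) ≡.refl (seq x n) (seq y n)) (null-neg x≈y)

  ≈-trans : ∀ {x y z} → x Defs.≈ y → y Defs.≈ z → x Defs.≈ z
  ≈-trans {x} {y} {z} x≈y y≈z = null-resp
    (λ n → solve 3 (λ a b c → (a :- b) :+ (b :- c) := a :- c) ≡.refl (seq x n) (seq y n) (seq z n))
    (null-+ x≈y y≈z)

  +-cong : ∀ {w x y z} → w Defs.≈ x → y Defs.≈ z → w Defs.+ y Defs.≈ x Defs.+ z
  +-cong {w} {x} {y} {z} w≈x y≈z = null-resp
    (λ n → solve 4 (λ w x y z → (w :- x) :+ (y :- z) := (w :+ y) :- (x :+ z)) ≡.refl
      (seq w n) (seq x n) (seq y n) (seq z n))
    (null-+ w≈x y≈z)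

  *-cong : ∀ {w x y z} → w Defs.≈ x → y Defs.≈ z → w Defs.* y Defs.≈ x Defs.* z
  *-cong {w} {x} {y} {z} w≈x y≈z = null-resp
    (λ n → solve 4 (λ w x y z → w :* (y :- z) :+ z :* (w :- x) := w :* y :- x :* z) ≡.refl
      (seq w n) (seq x n) (seq y n) (seq z n))
    (null-+ (null-* (bounded w) y≈z) (null-* (bounded z) w≈x))

  -‿cong : ∀ {x y} → x Defs.≈ y → Defs.- x Defs.≈ Defs.- y
  -‿cong {x} {y} x≈y = null-resp
    (λ n → solve 2 (λ a b → :- (a :- b) := (:- a) :- (:- b)) ≡.refl (seq x n) (seq y n)) (null-neg x≈y)

  ℝ-commutativeRing : CommutativeRing 0ℓ 0ℓ
  ℝ-commutativeRing = record
    { Carrier = ℝ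
    ; _≈_ = Defs._≈_
    ; _+_ = Defs._+_
    ; _*_ = Defs._*_
    ; -_  = Defs.-_
    ; 0#  = Defs.0ℝ
    ; 1#  = Defs.1ℝ
    ; isCommutativeRing = record
      { isRing = record
        { +-isAbelianGroup = record
          { isGroup = record
            { isMonoid = record
              { isSemigroup = record
                { isMagma = record
                  { isEquivalence = record
                    { refl  = λ {x} → pointwise {x} {x} λ _ → ≡.refl
                    ; sym   = λ {x} {y} → ≈-sym {x} {y}
                    ; trans = λ {x} {y} {z} → ≈-trans {x} {y} {z}
                    }
                  ; ∙-cong = λ {w} {x} {y} {z} → +-cong {w} {x} {y} {z}
                  }
                ; assoc = λ x y z → pointwise {(x Defs.+ y) Defs.+ z} {x Defs.+ (y Defs.+ z)} λ n → ℚ.+-assoc (seq x n) (seq y n) (seq z n)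
                }
              ; identity = (λ x → pointwise {Defs.0ℝ Defs.+ x} {x} λ n → ℚ.+-identityˡ (seq x n)) ,
                           (λ x → pointwise {x Defs.+ Defs.0ℝ} {x} λ n → ℚ.+-identityʳ (seq x n))
              }
            ; inverse = (λ x → pointwise {(Defs.- x) Defs.+ x} {Defs.0ℝ} λ n → ℚ.+-inverseˡ (seq x n)) ,
                        (λ x → pointwise {x Defs.+ (Defs.- x)} {Defs.0ℝ} λ n → ℚ.+-inverseʳ (seq x n))
            ; ⁻¹-cong = λ {x} {y} → -‿cong {x} {y}
            }
          ; comm = λ x y → pointwise {x Defs.+ y} {y Defs.+ x} λ n → ℚ.+-comm (seq x n) (seq y n)
          }
        ; *-cong = λ {w} {x} {y} {z} → *-cong {w} {x} {y} {z}
        ; *-assoc = λ x y z → pointwise {(x Defs.* y) Defs.* z} {x Defs.* (y Defs.* z)} λ n → ℚ.*-assoc (seq x n) (seq y n) (seq z n)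
        ; *-identity = (λ x → pointwise {Defs.1ℝ Defs.* x} {x} λ n → ℚ.*-identityˡ (seq x n)) ,
                       (λ x → pointwise {x Defs.* Defs.1ℝ} {x} λ n → ℚ.*-identityʳ (seq x n))
        ; distrib = (λ x y z → pointwise {x Defs.* (y Defs.+ z)} {(x Defs.* y) Defs.+ (x Defs.* z)} λ n → ℚ.*-distribˡ-+ (seq x n) (seq y n) (seq z n)) ,
                    (λ x y z → pointwise {(y Defs.+ z) Defs.* x} {(y Defs.* x) Defs.+ (z Defs.* x)} λ n → ℚ.*-distribʳ-+ (seq x n) (seq y n) (seq z n))
        }
      ; *-comm = λ x y → pointwise {x Defs.* y} {y Defs.* x} λ n → ℚ.*-comm (seq x n) (seq y n)
      }
    }

-- Order, stability and inverses of Cauchy reals.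

module RealOrder where

  open import Data.Rational.Base using (ℚ; 0ℚ; 1ℚ; ½; ∣_∣)
  open Defs using (ℝ; mkℝ; seq; cauchy; fromℚ; fromℤ; fromℕ)
  open Reals
  open IntegerRingSolver ℚ.+-*-commutativeRing
  open Algebra.Properties.Semiring.Mult (CommutativeRing.semiring ℝ-commutativeRing) using ()
    renaming (_×_ to _·_)
  open ℚ.≤-Reasoning

  ≤-reflexive : ∀ {x y} → x Defs.≈ y → x Defs.≤ y
  ≤-reflexive {x} {y} x≈y ε 0<ε = eventually-map
    (λ n x-y<ε → p-q<r⇒p<q+r (seq x n) (seq y n) ε (ℚ.≤-<-trans (p≤∣p∣ _) x-y<ε)) (x≈y ε 0<ε)

  ≤-trans : ∀ {x y z} → x Defs.≤ y → y Defs.≤ z → x Defs.≤ z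
  ≤-trans {x} {y} {z} x≤y y≤z ε 0<ε = eventually-zip
    (λ n x<y y<z → begin-strict
      seq x n                                  <⟨ x<y ⟩
      seq y n ℚ.+ ½ ℚ.* ε                      <⟨ ℚ.+-monoˡ-< (½ ℚ.* ε) y<z ⟩
      seq z n ℚ.+ ½ ℚ.* ε ℚ.+ ½ ℚ.* ε          ≡⟨ ℚ.+-assoc (seq z n) _ _ ⟩
      seq z n ℚ.+ (½ ℚ.* ε ℚ.+ ½ ℚ.* ε)        ≡⟨ ≡.cong (seq z n ℚ.+_) (½+½ ε) ⟩
      seq z n ℚ.+ ε                            ∎)
    (x≤y _ (0<½ 0<ε)) (y≤z _ (0<½ 0<ε))

  ≤-antisym : ∀ {x y} → x Defs.≤ y → y Defs.≤ x → x Defs.≈ y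
  ≤-antisym {x} {y} x≤y y≤x ε 0<ε = eventually-zip
    (λ n x<y y<x → ∣p∣<q (seq x n ℚ.- seq y n) ε (p<q+r⇒p-q<r (seq x n) (seq y n) ε x<y)
      (≡.subst (ℚ._< ε) (solve 2 (λ x y → y :- x := :- (x :- y)) ≡.refl (seq x n) (seq y n))
        (p<q+r⇒p-q<r (seq y n) (seq x n) ε y<x)))
    (x≤y ε 0<ε) (y≤x ε 0<ε)

  +-mono-≤ : ∀ {w x y z} → w Defs.≤ x → y Defs.≤ z → w Defs.+ y Defs.≤ x Defs.+ z
  +-mono-≤ {w} {x} {y} {z} w≤x y≤z ε 0<ε = eventually-zip
    (λ n w<x y<z → begin-strict
      seq w n ℚ.+ seq y n
        <⟨ ℚ.+-mono-< w<x y<z ⟩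
      (seq x n ℚ.+ ½ ℚ.* ε) ℚ.+ (seq z n ℚ.+ ½ ℚ.* ε)
        ≡⟨ solve 4 (λ x z a b → (x :+ a) :+ (z :+ b) := x :+ z :+ (a :+ b)) ≡.refl (seq x n) (seq z n) (½ ℚ.* ε) (½ ℚ.* ε) ⟩
      seq x n ℚ.+ seq z n ℚ.+ (½ ℚ.* ε ℚ.+ ½ ℚ.* ε)
        ≡⟨ ≡.cong (seq x n ℚ.+ seq z n ℚ.+_) (½+½ ε) ⟩
      seq x n ℚ.+ seq z n ℚ.+ ε ∎)
    (w≤x _ (0<½ 0<ε)) (y≤z _ (0<½ 0<ε))

  pointwise-≤ : ∀ {x y} → (∀ n → seq x n ℚ.≤ seq y n) → x Defs.≤ y
  pointwise-≤ {x} {y} x≤y ε 0<ε = always λ n → begin-strict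
    seq x n          ≤⟨ x≤y n ⟩
    seq y n          ≡⟨ ℚ.+-identityʳ (seq y n) ⟨
    seq y n ℚ.+ 0ℚ   <⟨ ℚ.+-monoʳ-< (seq y n) 0<ε ⟩
    seq y n ℚ.+ ε    ∎

  square≥0 : ∀ x → Defs.0ℝ Defs.≤ x Defs.* x
  square≥0 x = pointwise-≤ {Defs.0ℝ} {x Defs.* x} λ n → q² (seq x n)
    where
    q² : ∀ q → 0ℚ ℚ.≤ q ℚ.* q
    q² q with ℚ.∣p∣≡p∨∣p∣≡-p q
    ... | inj₁ ∣q∣≡q  = ≡.subst (0ℚ ℚ.≤_) (≡.trans (ℚ.∣p*q∣≡∣p∣*∣q∣ q q) (≡.cong₂ ℚ._*_ ∣q∣≡q ∣q∣≡q))
      (ℚ.0≤∣p∣ (q ℚ.* q))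
    ... | inj₂ ∣q∣≡-q = ≡.subst (0ℚ ℚ.≤_) (≡.trans (ℚ.∣p*q∣≡∣p∣*∣q∣ q q) (≡.trans (≡.cong₂ ℚ._*_ ∣q∣≡-q ∣q∣≡-q)
        (solve 1 (λ q → (:- q) :* (:- q) := q :* q) ≡.refl q)))
      (ℚ.0≤∣p∣ (q ℚ.* q))

  -- A nonnegative real may have negative terms, but their size tends to 0, and |q| - q is 0 or
  -- 2|q|. So x may be replaced by its absolute value term by term.
  abs-defect : ∀ {x} → Defs.0ℝ Defs.≤ x → Null (λ n → ∣ seq x n ∣ ℚ.- seq x n)
  abs-defect {x} 0≤x ε 0<ε = eventually-map bound (0≤x (½ ℚ.* ε) (0<½ 0<ε))
    where
    bound : ∀ n → 0ℚ ℚ.< seq x n ℚ.+ ½ ℚ.* ε → ∣ ∣ seq x n ∣ ℚ.- seq x n ∣ ℚ.< ε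
    bound n 0<x+½ε with ℚ.∣p∣≡p∨∣p∣≡-p (seq x n)
    ... | inj₁ ∣x∣≡x  = ≡.subst (ℚ._< ε)
      (≡.sym (≡.cong ∣_∣ (≡.trans (≡.cong (ℚ._- seq x n) ∣x∣≡x) (ℚ.+-inverseʳ (seq x n))))) 0<ε
    ... | inj₂ ∣x∣≡-x = ∣p∣<q _ ε
      (≡.subst₂ ℚ._<_ (≡.sym eq) (½+½ ε) (ℚ.+-mono-< -x<½ε -x<½ε))
      (ℚ.≤-<-trans (≡.subst (ℚ._≤ 0ℚ) (≡.cong ℚ.-_ (≡.sym eq))
        (ℚ.neg-antimono-≤ {0ℚ} (ℚ.+-mono-≤ {0ℚ} {ℚ.- seq x n} {0ℚ} 0≤-x 0≤-x))) 0<ε)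
      where
      eq : ∣ seq x n ∣ ℚ.- seq x n ≡ (ℚ.- seq x n) ℚ.+ (ℚ.- seq x n)
      eq = ≡.cong (ℚ._- seq x n) ∣x∣≡-x
      0≤-x : 0ℚ ℚ.≤ ℚ.- seq x n
      0≤-x = ≡.subst (0ℚ ℚ.≤_) ∣x∣≡-x (ℚ.0≤∣p∣ (seq x n))
      -x<½ε : ℚ.- seq x n ℚ.< ½ ℚ.* ε
      -x<½ε = ≡.subst₂ ℚ._<_ (ℚ.+-identityˡ (ℚ.- seq x n))
        (solve 2 (λ x e → x :+ e :- x := e) ≡.refl (seq x n) (½ ℚ.* ε))
        (ℚ.+-monoˡ-< (ℚ.- seq x n) 0<x+½ε)

  -- The termwise product may be negative; it is compared with |x| |y|, from which it differs by a
  -- null sequence.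
  *-nonneg : ∀ {x y} → Defs.0ℝ Defs.≤ x → Defs.0ℝ Defs.≤ y → Defs.0ℝ Defs.≤ x Defs.* y
  *-nonneg {x} {y} 0≤x 0≤y ε 0<ε = eventually-map
    (λ n defect<ε → ≡.subst (0ℚ ℚ.<_) (ℚ.+-comm ε (seq x n ℚ.* seq y n)) (begin-strict
      0ℚ
        ≤⟨ ℚ.0≤∣p∣ (seq x n ℚ.* seq y n) ⟩
      ∣ seq x n ℚ.* seq y n ∣
        ≡⟨ ℚ.∣p*q∣≡∣p∣*∣q∣ (seq x n) (seq y n) ⟩
      ∣ seq x n ∣ ℚ.* ∣ seq y n ∣
        ≡⟨ solve 2 (λ p q → p := (p :- q) :+ q) ≡.refl _ (seq x n ℚ.* seq y n) ⟩
      (∣ seq x n ∣ ℚ.* ∣ seq y n ∣ ℚ.- seq x n ℚ.* seq y n) ℚ.+ seq x n ℚ.* seq y n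
        <⟨ ℚ.+-monoˡ-< (seq x n ℚ.* seq y n) (ℚ.≤-<-trans (p≤∣p∣ _) defect<ε) ⟩
      ε ℚ.+ seq x n ℚ.* seq y n ∎))
    (defect ε 0<ε)
    where
    defect : Null (λ n → ∣ seq x n ∣ ℚ.* ∣ seq y n ∣ ℚ.- seq x n ℚ.* seq y n)
    defect = null-resp
      (λ n → solve 4 (λ a b x y → a :* (b :- y) :+ y :* (a :- x) := a :* b :- x :* y) ≡.refl
        (∣ seq x n ∣) (∣ seq y n ∣) (seq x n) (seq y n))
      (null-+ (null-* (bounded-∣∣ (bounded x)) (abs-defect {y} 0≤y))
              (null-* (bounded y) (abs-defect {x} 0≤x)))

  near : ∀ x {ε} → 0ℚ ℚ.< ε → ∃[ N ] ∀ n → N ℕ.≤ n → seq x n ℚ.< seq x N ℚ.+ ε × seq x N ℚ.< seq x n ℚ.+ ε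
  near x {ε} 0<ε = let N , close = cauchy x ε 0<ε in N , λ n N≤n →
    p-q<r⇒p<q+r _ _ ε (ℚ.≤-<-trans (p≤∣p∣ _) (close n N N≤n ℕ.≤-refl)) ,
    p-q<r⇒p<q+r _ _ ε (ℚ.≤-<-trans (p≤∣p∣ _) (close N n ℕ.≤-refl N≤n))

  -- The constructive substitute for trichotomy: one sufficiently late rational term of x - y
  -- decides between two overlapping alternatives.
  compare : ∀ x y {ε} → 0ℚ ℚ.< ε →
    Eventually (λ n → seq x n ℚ.< seq y n ℚ.+ ε) ⊎
    ∃[ q ] 0ℚ ℚ.< q × Eventually (λ n → seq y n ℚ.+ q ℚ.< seq x n)
  compare x y {ε} 0<ε = decide (seq z N ℚ.<? e ℚ.+ e)
    where
    z = x Defs.- y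
    -- With e = ε/4 and later terms within e of the N-th one, a value below 2e stays below 3e < ε,
    -- and a value of at least 2e stays above e, which becomes the gap q.
    e = ½ ℚ.* (½ ℚ.* ε)
    0<e : 0ℚ ℚ.< e
    0<e = 0<½ (0<½ 0<ε)
    N = proj₁ (near z 0<e)
    decide : Dec (seq z N ℚ.< e ℚ.+ e) → _
    decide (yes z<2e) = inj₁ (N , λ n N≤n → p-q<r⇒p<q+r (seq x n) (seq y n) ε (begin-strict
      seq z n                   <⟨ proj₁ (proj₂ (near z 0<e) n N≤n) ⟩
      seq z N ℚ.+ e             <⟨ ℚ.+-mono-< z<2e (≡.subst (ℚ._< e ℚ.+ e) (ℚ.+-identityʳ e) (ℚ.+-monoʳ-< e 0<e)) ⟩
      (e ℚ.+ e) ℚ.+ (e ℚ.+ e)   ≡⟨ ≡.cong₂ ℚ._+_ (½+½ (½ ℚ.* ε)) (½+½ (½ ℚ.* ε)) ⟩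
      ½ ℚ.* ε ℚ.+ ½ ℚ.* ε       ≡⟨ ½+½ ε ⟩
      ε                         ∎))
    decide (no z≮2e) = inj₂ (e , 0<e , N , λ n N≤n → ≡.subst₂ ℚ._<_
      (solve 2 (λ y e → (e :+ e) :+ (y :- e) := y :+ e) ≡.refl (seq y n) e)
      (solve 3 (λ x y e → (x :- y) :+ e :+ (y :- e) := x) ≡.refl (seq x n) (seq y n) e)
      (ℚ.+-monoˡ-< (seq y n ℚ.- e) (ℚ.≤-<-trans (ℚ.≮⇒≥ z≮2e) (proj₂ (proj₂ (near z 0<e) n N≤n)))))

  -- For each ε the comparison either gives the required bound or finds a positive gap, and a gap
  -- refutes x ≤ y outright.
  ≤-stable : ∀ {x y} → ¬ ¬ (x Defs.≤ y) → x Defs.≤ y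
  ≤-stable {x} {y} ¬¬x≤y ε 0<ε with compare x y 0<ε
  ... | inj₁ x<y+ε                 = x<y+ε
  ... | inj₂ (q , 0<q , M , y+q<x) = ⊥-elim (¬¬x≤y λ x≤y →
    let N , x<y+q = x≤y q 0<q in
    ℚ.<-asym (x<y+q (M ℕ.⊔ N) (ℕ.m≤n⊔m M N)) (y+q<x (M ℕ.⊔ N) (ℕ.m≤m⊔n M N)))

  -- Under a refutation k of the disjunction, a gap found at any ε would prove y ≤ x and contradict
  -- k. Hence every comparison gives x < y + ε, which proves x ≤ y after all. The proof of `invert`
  -- has the same pattern.
  ≤-total : ∀ x y → ¬ ¬ (x Defs.≤ y ⊎ y Defs.≤ x)
  ≤-total x y k = k (inj₁ x≤y)
    where
    x≤y : x Defs.≤ y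
    x≤y ε 0<ε with compare x y 0<ε
    ... | inj₁ x<y+ε               = x<y+ε
    ... | inj₂ (q , 0<q , y+q<x) = ⊥-elim (k (inj₂ λ ε 0<ε → eventually-map
      (λ n y+q<x → begin-strict
        seq y n          ≡⟨ ℚ.+-identityʳ (seq y n) ⟨
        seq y n ℚ.+ 0ℚ   <⟨ ℚ.+-monoʳ-< (seq y n) 0<q ⟩
        seq y n ℚ.+ q    <⟨ y+q<x ⟩
        seq x n          ≡⟨ ℚ.+-identityʳ (seq x n) ⟨
        seq x n ℚ.+ 0ℚ   <⟨ ℚ.+-monoʳ-< (seq x n) 0<ε ⟩
        seq x n ℚ.+ ε    ∎) y+q<x))

  -- The value 0 at 0 makes the sequence of inverses total: a real that is eventually bounded away
  -- from 0 may still vanish at early indices.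
  inverse : ℚ → ℚ
  inverse q with q ℚ.≟ 0ℚ
  ... | yes _   = 0ℚ
  ... | no  q≢0 = (ℚ.1/ q) {{ℚ.≢-nonZero q≢0}}

  *-inverse : ∀ q → q ≢ 0ℚ → q ℚ.* inverse q ≡ 1ℚ
  *-inverse q q≢0 with q ℚ.≟ 0ℚ
  ... | yes q≡0  = contradiction q≡0 q≢0
  ... | no  q≢0′ = ℚ.*-inverseʳ q {{ℚ.≢-nonZero q≢0′}}

  module Reciprocal (x : ℝ) {e : ℚ} (0<e : 0ℚ ℚ.< e) (e<∣x∣ : Eventually λ n → e ℚ.< ∣ seq x n ∣) where

    N₀ = proj₁ e<∣x∣
    i = proj₁ (reciprocal e 0<e)
    0<i = proj₁ (proj₂ (reciprocal e 0<e))
    ei≡1 = proj₂ (proj₂ (reciprocal e 0<e))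

    x≢0 : ∀ n → N₀ ℕ.≤ n → seq x n ≢ 0ℚ
    x≢0 n N₀≤n x≡0 = ℚ.<-asym 0<e (≡.subst (e ℚ.<_) (≡.cong ∣_∣ x≡0) (proj₂ e<∣x∣ n N₀≤n))

    ∣inverse∣≤i : ∀ n → N₀ ℕ.≤ n → ∣ inverse (seq x n) ∣ ℚ.≤ i
    ∣inverse∣≤i n N₀≤n = begin
      ∣ y ∣                        ≡⟨ ≡.trans (≡.cong (∣ y ∣ ℚ.*_) ei≡1) (ℚ.*-identityʳ ∣ y ∣) ⟨
      ∣ y ∣ ℚ.* (e ℚ.* i)          ≡⟨ ℚ.*-assoc ∣ y ∣ e i ⟨
      ∣ y ∣ ℚ.* e ℚ.* i            ≤⟨ ℚ.*-monoʳ-≤-nonNeg i {{ℚ.nonNegative (ℚ.<⇒≤ 0<i)}}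
                                       (ℚ.*-monoˡ-≤-nonNeg ∣ y ∣ {{ℚ.∣-∣-nonNeg y}} (ℚ.<⇒≤ (proj₂ e<∣x∣ n N₀≤n))) ⟩
      ∣ y ∣ ℚ.* ∣ seq x n ∣ ℚ.* i  ≡⟨ ≡.cong (ℚ._* i) (≡.trans (≡.sym (ℚ.∣p*q∣≡∣p∣*∣q∣ y (seq x n)))
                                       (≡.cong ∣_∣ (≡.trans (ℚ.*-comm y (seq x n)) (*-inverse (seq x n) (x≢0 n N₀≤n))))) ⟩
      1ℚ ℚ.* i                     ≡⟨ ℚ.*-identityˡ i ⟩
      i                            ∎
      where y = inverse (seq x n)

    inverse-difference : ∀ a b → a ≢ 0ℚ → b ≢ 0ℚ →
      inverse a ℚ.- inverse b ≡ inverse a ℚ.* (inverse b ℚ.* (b ℚ.- a))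
    inverse-difference a b a≢0 b≢0 = ≡.sym (≡.trans
      (solve 4 (λ x y a b → x :* (y :* (b :- a)) := x :* (b :* y) :- y :* (a :* x)) ≡.refl (inverse a) (inverse b) a b)
      (≡.cong₂ ℚ._-_ (≡.trans (≡.cong (inverse a ℚ.*_) (*-inverse b b≢0)) (ℚ.*-identityʳ (inverse a)))
                     (≡.trans (≡.cong (inverse b ℚ.*_) (*-inverse a a≢0)) (ℚ.*-identityʳ (inverse b)))))

    1/x : ℝ
    1/x = mkℝ (λ n → inverse (seq x n)) λ ε 0<ε →
      -- Since 1/a - 1/b = (b - a)/(ab) and both inverses are at most i = 1/e, closeness e² ε of the
      -- terms gives closeness ε of their inverses.
      let M , close = cauchy x (e ℚ.* (e ℚ.* ε)) (*-pos 0<e (*-pos 0<e 0<ε))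
          N₀≤ = λ {n} (N≤n : N₀ ℕ.⊔ M ℕ.≤ n) → ℕ.≤-trans (ℕ.m≤m⊔n N₀ M) N≤n
          M≤  = λ {n} (N≤n : N₀ ℕ.⊔ M ℕ.≤ n) → ℕ.≤-trans (ℕ.m≤n⊔m N₀ M) N≤n
      in N₀ ℕ.⊔ M , λ m n N≤m N≤n → begin-strict
        ∣ inverse (seq x m) ℚ.- inverse (seq x n) ∣
          ≡⟨ ≡.cong ∣_∣ (inverse-difference (seq x m) (seq x n) (x≢0 m (N₀≤ N≤m)) (x≢0 n (N₀≤ N≤n))) ⟩
        ∣ inverse (seq x m) ℚ.* (inverse (seq x n) ℚ.* (seq x n ℚ.- seq x m)) ∣
          <⟨ ∣∣-* (inverse (seq x m)) _ (∣inverse∣≤i m (N₀≤ N≤m))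
               (∣∣-* (inverse (seq x n)) _ (∣inverse∣≤i n (N₀≤ N≤n)) (close n m (M≤ N≤n) (M≤ N≤m)) 0<i) 0<i ⟩
        i ℚ.* (i ℚ.* (e ℚ.* (e ℚ.* ε)))
          ≡⟨ solve 3 (λ i e ε → i :* (i :* (e :* (e :* ε))) := (e :* i) :* ((e :* i) :* ε)) ≡.refl i e ε ⟩
        (e ℚ.* i) ℚ.* ((e ℚ.* i) ℚ.* ε)
          ≡⟨ ≡.cong₂ (λ p q → p ℚ.* (q ℚ.* ε)) ei≡1 ei≡1 ⟩
        1ℚ ℚ.* (1ℚ ℚ.* ε)
          ≡⟨ ≡.trans (ℚ.*-identityˡ (1ℚ ℚ.* ε)) (ℚ.*-identityˡ ε) ⟩
        ε ∎

    x*1/x≈1 : x Defs.* 1/x Defs.≈ Defs.1ℝ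
    x*1/x≈1 ε 0<ε = N₀ , λ n N₀≤n → ≡.subst (λ q → ∣ q ℚ.- 1ℚ ∣ ℚ.< ε)
      (≡.sym (*-inverse (seq x n) (x≢0 n N₀≤n))) 0<ε

  invert : ∀ x → ¬ ¬ (x Defs.≈ Defs.0ℝ ⊎ ∃[ y ] x Defs.* y Defs.≈ Defs.1ℝ)
  invert x k = k (inj₁ x≈0)
    where
    x≈0 : x Defs.≈ Defs.0ℝ
    x≈0 ε 0<ε with compare x Defs.0ℝ 0<ε | compare Defs.0ℝ x 0<ε
    ... | inj₁ x<ε | inj₁ 0<x+ε = eventually-zip
      (λ n x<ε 0<x+ε → ∣p∣<q (seq x n ℚ.- 0ℚ) ε (p<q+r⇒p-q<r (seq x n) 0ℚ ε x<ε)
        (≡.subst (ℚ._< ε) (solve 2 (λ z x → z :- x := :- (x :- z)) ≡.refl 0ℚ (seq x n))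
          (p<q+r⇒p-q<r 0ℚ (seq x n) ε 0<x+ε)))
      x<ε 0<x+ε
    ... | inj₂ (q , 0<q , q<x) | _ = ⊥-elim (k (inj₂ (1/x , x*1/x≈1)))
      where open Reciprocal x 0<q (eventually-map
              (λ n q<x → ℚ.<-≤-trans (≡.subst (ℚ._< seq x n) (ℚ.+-identityˡ q) q<x) (p≤∣p∣ (seq x n))) q<x)
    ... | inj₁ _ | inj₂ (q , 0<q , x+q<0) = ⊥-elim (k (inj₂ (1/x , x*1/x≈1)))
      where open Reciprocal x 0<q (eventually-map
              (λ n x+q<0 → ℚ.<-≤-trans
                (≡.subst₂ ℚ._<_ (solve 2 (λ x q → x :+ q :- x := q) ≡.refl (seq x n) q) (ℚ.+-identityˡ (ℚ.- seq x n))
                  (ℚ.+-monoˡ-< (ℚ.- seq x n) x+q<0))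
                (≡.subst (ℚ.- seq x n ℚ.≤_) (ℚ.∣-p∣≡∣p∣ (seq x n)) (p≤∣p∣ (ℚ.- seq x n)))) x+q<0)

  -- The quotient `_/_` divides by a gcd. Among unnormalised fractions with denominator 1 the
  -- operations are those of the integers, so the identities below are checked there.
  fromℚᵘ-/1 : ∀ a p → ℚ.toℚᵘ p ℚᵘ.≃ ℚᵘ.mkℚᵘ a 0 → a ℚ./ 1 ≡ p
  fromℚᵘ-/1 a p p≃a = ≡.trans (≡.sym (ℚ.fromℚᵘ-cong p≃a)) (ℚ.fromℚᵘ-toℚᵘ p)

  /1-+ : ∀ a b → (a ℤ.+ b) ℚ./ 1 ≡ a ℚ./ 1 ℚ.+ b ℚ./ 1
  /1-+ a b = fromℚᵘ-/1 (a ℤ.+ b) _ (ℚᵘ.≃-trans (ℚ.toℚᵘ-homo-+ (a ℚ./ 1) (b ℚ./ 1))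
    (ℚᵘ.≃-trans (ℚᵘ.+-cong (ℚ.toℚᵘ-fromℚᵘ (ℚᵘ.mkℚᵘ a 0)) (ℚ.toℚᵘ-fromℚᵘ (ℚᵘ.mkℚᵘ b 0)))
      (ℚᵘ.*≡* (≡.cong (ℤ._* ℤ.1ℤ) (≡.cong₂ ℤ._+_ (ℤ.*-identityʳ a) (ℤ.*-identityʳ b))))))

  /1-* : ∀ a b → (a ℤ.* b) ℚ./ 1 ≡ a ℚ./ 1 ℚ.* (b ℚ./ 1)
  /1-* a b = fromℚᵘ-/1 (a ℤ.* b) _ (ℚᵘ.≃-trans (ℚ.toℚᵘ-homo-* (a ℚ./ 1) (b ℚ./ 1))
    (ℚᵘ.≃-trans (ℚᵘ.*-cong (ℚ.toℚᵘ-fromℚᵘ (ℚᵘ.mkℚᵘ a 0)) (ℚ.toℚᵘ-fromℚᵘ (ℚᵘ.mkℚᵘ b 0)))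
      (ℚᵘ.*≡* ≡.refl)))

  fromℤ-* : ∀ a b → fromℤ (a ℤ.* b) Defs.≈ fromℤ a Defs.* fromℤ b
  fromℤ-* a b = pointwise {fromℤ (a ℤ.* b)} {fromℤ a Defs.* fromℤ b} λ _ → /1-* a b

  seq-· : ∀ m n → seq (m · Defs.1ℝ) n ≡ ℤ.+ m ℚ./ 1
  seq-· zero    n = ≡.refl
  seq-· (suc m) n = ≡.trans (≡.cong (1ℚ ℚ.+_) (seq-· m n)) (≡.sym (/1-+ ℤ.1ℤ (ℤ.+ m)))

  fromℕ≈· : ∀ m → fromℕ m Defs.≈ m · Defs.1ℝ
  fromℕ≈· m = pointwise {fromℕ m} {m · Defs.1ℝ} λ n → ≡.sym (seq-· m n)

  invertℕ : ∀ m → ∃[ y ] (suc m · Defs.1ℝ) Defs.* y Defs.≈ Defs.1ℝ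
  invertℕ m = let i , _ , mi≡1 = reciprocal (ℤ.+ suc m ℚ./ 1) (ℚ.positive⁻¹ _ {{ℚ.normalize-pos (suc m) 1}}) in
    fromℚ i , pointwise {(suc m · Defs.1ℝ) Defs.* fromℚ i} {Defs.1ℝ}
      λ n → ≡.trans (≡.cong (ℚ._* i) (seq-· (suc m) n)) mi≡1

  ℝ-stableOrderedField : StableOrderedField 0ℓ 0ℓ 0ℓ
  ℝ-stableOrderedField = record
    { commutativeRing = ℝ-commutativeRing
    ; _≤_         = Defs._≤_
    ; ≤-reflexive = λ {x} {y} → ≤-reflexive {x} {y}
    ; ≤-trans     = λ {x} {y} {z} → ≤-trans {x} {y} {z}
    ; ≤-antisym   = λ {x} {y} → ≤-antisym {x} {y}
    ; ≤-stable    = λ {x} {y} → ≤-stable {x} {y}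
    ; ≤-total     = ≤-total
    ; +-mono-≤    = λ {w} {x} {y} {z} → +-mono-≤ {w} {x} {y} {z}
    ; *-nonneg    = λ {x} {y} → *-nonneg {x} {y}
    ; square≥0    = square≥0
    ; invert      = invert
    ; invertℕ     = invertℕ
    }

-- Finite sets of vertices.

module Subsets where

  open import Data.Fin.Subset using (inside; outside; _∈_; _∉_; _⊆_; _∩_; _∪_; _─_; _-_; ∣_∣; ⁅_⁆)
  open import Data.Fin.Subset.Properties
  open import Data.Vec.Base using (here; there)

  x∈p─q⇒x∉q : ∀ {n} {x : Fin n} (p q : Subset n) → x ∈ p ─ q → x ∉ q
  x∈p─q⇒x∉q (s ∷ p) (outside ∷ q) here        ()
  x∈p─q⇒x∉q (s ∷ p) (outside ∷ q) (there x∈) (there x∈q) = x∈p─q⇒x∉q p q x∈ x∈q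
  x∈p─q⇒x∉q (s ∷ p) (inside ∷ q)  (there x∈) (there x∈q) = x∈p─q⇒x∉q p q x∈ x∈q

  ∣p∪q∣+∣p∩q∣≡∣p∣+∣q∣ : ∀ {n} (p q : Subset n) → ∣ p ∪ q ∣ ℕ.+ ∣ p ∩ q ∣ ≡ ∣ p ∣ ℕ.+ ∣ q ∣
  ∣p∪q∣+∣p∩q∣≡∣p∣+∣q∣ []            []            = ≡.refl
  ∣p∪q∣+∣p∩q∣≡∣p∣+∣q∣ (outside ∷ p) (outside ∷ q) = ∣p∪q∣+∣p∩q∣≡∣p∣+∣q∣ p q
  ∣p∪q∣+∣p∩q∣≡∣p∣+∣q∣ (outside ∷ p) (inside ∷ q)  =
    ≡.trans (≡.cong suc (∣p∪q∣+∣p∩q∣≡∣p∣+∣q∣ p q)) (≡.sym (ℕ.+-suc ∣ p ∣ ∣ q ∣))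
  ∣p∪q∣+∣p∩q∣≡∣p∣+∣q∣ (inside ∷ p)  (outside ∷ q) = ≡.cong suc (∣p∪q∣+∣p∩q∣≡∣p∣+∣q∣ p q)
  ∣p∪q∣+∣p∩q∣≡∣p∣+∣q∣ (inside ∷ p)  (inside ∷ q)  = ≡.cong suc (≡.trans (ℕ.+-suc ∣ p ∪ q ∣ ∣ p ∩ q ∣)
    (≡.trans (≡.cong suc (∣p∪q∣+∣p∩q∣≡∣p∣+∣q∣ p q)) (≡.sym (ℕ.+-suc ∣ p ∣ ∣ q ∣))))

  ∣p∩q∣+∣p─q∣≡∣p∣ : ∀ {n} (p q : Subset n) → ∣ p ∩ q ∣ ℕ.+ ∣ p ─ q ∣ ≡ ∣ p ∣
  ∣p∩q∣+∣p─q∣≡∣p∣ []            []            = ≡.refl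
  ∣p∩q∣+∣p─q∣≡∣p∣ (outside ∷ p) (outside ∷ q) = ∣p∩q∣+∣p─q∣≡∣p∣ p q
  ∣p∩q∣+∣p─q∣≡∣p∣ (outside ∷ p) (inside ∷ q)  = ∣p∩q∣+∣p─q∣≡∣p∣ p q
  ∣p∩q∣+∣p─q∣≡∣p∣ (inside ∷ p)  (outside ∷ q) =
    ≡.trans (ℕ.+-suc ∣ p ∩ q ∣ ∣ p ─ q ∣) (≡.cong suc (∣p∩q∣+∣p─q∣≡∣p∣ p q))
  ∣p∩q∣+∣p─q∣≡∣p∣ (inside ∷ p)  (inside ∷ q)  = ≡.cong suc (∣p∩q∣+∣p─q∣≡∣p∣ p q)

  ⊆∧∣∣≥⇒≡ : ∀ {n} {p q : Subset n} → p ⊆ q → ∣ q ∣ ℕ.≤ ∣ p ∣ → p ≡ q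
  ⊆∧∣∣≥⇒≡ {p = p} {q} p⊆q ∣q∣≤∣p∣ = ⊆-antisym p⊆q q⊆p
    where
    q⊆p : q ⊆ p
    q⊆p {x} x∈q with x ∈? p
    ... | yes x∈p = x∈p
    ... | no  x∉p = contradiction ∣q∣≤∣p∣ (ℕ.<⇒≱ (p⊂q⇒∣p∣<∣q∣ (p⊆q , x , x∈q , x∉p)))

  -- The vertex of τ outside ρ, described by membership alone. It can then be given explicitly when
  -- it is known, as for the two facets of a union, or extracted from cardinalities by `facet-apex`.
  record Apex {n : ℕ} (τ ρ : Subset n) : Set where
    field
      apex   : Fin n
      apex∈τ : apex ∈ τ
      apex∉ρ : apex ∉ ρ
      split  : ∀ {v} → v ∈ τ → v ∈ ρ ⊎ v ≡ apex

  facet-apex : ∀ {n} {τ ρ : Subset n} → ρ ⊆ τ → ∣ τ ∣ ≡ suc ∣ ρ ∣ → Apex τ ρ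
  facet-apex {τ = τ} {ρ} ρ⊆τ ∣τ∣≡1+∣ρ∣ with nonempty? (τ ─ ρ)
  ... | no empty = contradiction
    (≡.trans (≡.sym ∣τ∣≡1+∣ρ∣) (≡.cong ∣_∣ (⊆-antisym {i = τ} τ⊆ρ ρ⊆τ))) ℕ.1+n≢n
    where
    τ⊆ρ : τ ⊆ ρ
    τ⊆ρ {v} v∈τ with v ∈? ρ
    ... | yes v∈ρ = v∈ρ
    ... | no  v∉ρ = contradiction (v , x∈p∧x∉q⇒x∈p─q v∈τ v∉ρ) empty
  ... | yes (a , a∈τ─ρ) = record
    { apex   = a
    ; apex∈τ = a∈τ
    ; apex∉ρ = a∉ρ
    ; split  = λ {v} v∈τ → case x∈p∪q⁻ ρ ⁅ a ⁆ (≡.subst (v ∈_) (≡.sym ρ∪a≡τ) v∈τ) of λ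
      { (inj₁ v∈ρ) → inj₁ v∈ρ
      ; (inj₂ v∈a) → inj₂ (x∈⁅y⁆⇒x≡y a v∈a)
      }
    }
    where
    a∈τ : a ∈ τ
    a∈τ = p─q⊆p τ ρ a∈τ─ρ

    a∉ρ : a ∉ ρ
    a∉ρ = x∈p─q⇒x∉q τ ρ a∈τ─ρ

    ρ∪a≡τ : ρ ∪ ⁅ a ⁆ ≡ τ
    ρ∪a≡τ = ⊆∧∣∣≥⇒≡
      (λ v∈ → case x∈p∪q⁻ ρ ⁅ a ⁆ v∈ of λ
        { (inj₁ v∈ρ) → ρ⊆τ v∈ρ
        ; (inj₂ v∈a) → ≡.subst (_∈ τ) (≡.sym (x∈⁅y⁆⇒x≡y a v∈a)) a∈τ
        })
      (ℕ.≤-trans (ℕ.≤-reflexive ∣τ∣≡1+∣ρ∣)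
        (p⊂q⇒∣p∣<∣q∣ (p⊆p∪q ⁅ a ⁆ , a , x∈p∪q⁺ (inj₂ (x∈⁅x⁆ a)) , a∉ρ)))

  injection⇒≤∣∣ : ∀ {m n} (p : Subset n) (f : Fin m → Fin n) →
    (∀ {i j} → f i ≡ f j → i ≡ j) → (∀ i → f i ∈ p) → m ℕ.≤ ∣ p ∣
  injection⇒≤∣∣ {zero}  p f f-inj f∈p = ℕ.z≤n
  injection⇒≤∣∣ {suc m} p f f-inj f∈p = ℕ.≤-trans
    (ℕ.s≤s (injection⇒≤∣∣ (p - f zero) (f ∘ suc) (Fin.suc-injective ∘ f-inj) λ i →
      x∈p∧x≢y⇒x∈p-y (f∈p (suc i)) λ fᵢ≡f₀ → case f-inj fᵢ≡f₀ of λ ()))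
    (x∈p⇒∣p-x∣<∣p∣ (f∈p zero))

  transversal⇒∣∣≤ : ∀ {n} s (V : Fin s → Subset n) (p : Subset n) →
    (∀ {v} → v ∈ p → ∃[ j ] v ∈ V j) → (∀ j → ∣ p ∩ V j ∣ ℕ.≤ 1) → ∣ p ∣ ℕ.≤ s
  transversal⇒∣∣≤ {n} zero V p covers _ with nonempty? p
  ... | yes (v , v∈p) = case covers v∈p of λ ()
  ... | no empty      = ℕ.≤-reflexive (≡.trans (≡.cong ∣_∣ (Empty-unique empty)) (∣⊥∣≡0 n))
  transversal⇒∣∣≤ (suc s) V p covers ≤1 = ≡.subst (ℕ._≤ suc s) (∣p∩q∣+∣p─q∣≡∣p∣ p (V zero))
    (ℕ.+-mono-≤ (≤1 zero) (transversal⇒∣∣≤ s (V ∘ suc) (p ─ V zero)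
      (λ {v} v∈ → case covers (p─q⊆p p (V zero) v∈) of λ
        { (zero  , v∈V₀) → contradiction v∈V₀ (x∈p─q⇒x∉q p (V zero) v∈)
        ; (suc j , v∈Vⱼ) → j , v∈Vⱼ
        })
      (λ j → ℕ.≤-trans (p⊆q⇒∣p∣≤∣q∣ (λ v∈ →
          let v∈p─V₀ , v∈Vⱼ = x∈p∩q⁻ (p ─ V zero) (V (suc j)) v∈
          in x∈p∩q⁺ (p─q⊆p p (V zero) v∈p─V₀ , v∈Vⱼ)))
        (≤1 (suc j)))))

-- Counting in lists and the largest entries.

module Lists where

  open import Data.List.Base using (filter; lookup; take)
  open import Data.List.Membership.Propositional using (_∈_)
  open import Data.List.Membership.Propositional.Properties using (∈-lookup)
  open import Data.List.Properties using (filter-accept; filter-reject)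
  open import Data.List.Relation.Unary.All as All using (All; []; _∷_)
  open import Data.List.Relation.Unary.AllPairs using (AllPairs; []; _∷_)
  open import Data.List.Relation.Unary.Any using (here; there)
  open import Data.List.Relation.Unary.Unique.Propositional using (Unique)
  open import Relation.Unary using (Pred; Decidable)
  import Data.Nat.ListAction as ℕ

  length-filter-insert : ∀ {A : Set} {P Q : Pred A 0ℓ} (P? : Decidable P) (Q? : Decidable Q) {a} →
    (∀ {x} → P x → Q x ⊎ x ≡ a) → (∀ {x} → Q x → P x) → P a → ¬ Q a →
    ∀ {xs} → Unique xs → a ∈ xs → length (filter P? xs) ≡ suc (length (filter Q? xs))
  length-filter-insert P? Q? {a} P⇒Q Q⇒P Pa ¬Qa {x ∷ xs} (x∉xs ∷ xs!) (here ≡.refl)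
    rewrite filter-accept P? {a} {xs} Pa | filter-reject Q? {a} {xs} ¬Qa =
    ≡.cong suc (go x∉xs)
    where
    go : ∀ {xs} → All (a ≢_) xs → length (filter P? xs) ≡ length (filter Q? xs)
    go {[]}     []            = ≡.refl
    go {y ∷ ys} (a≢y ∷ a∉ys) with P? y | Q? y
    ... | yes _  | yes _  = ≡.cong suc (go a∉ys)
    ... | no _   | no _   = go a∉ys
    ... | no ¬Py | yes Qy = contradiction (Q⇒P Qy) ¬Py
    ... | yes Py | no ¬Qy with P⇒Q Py
    ...   | inj₁ Qy  = contradiction Qy ¬Qy
    ...   | inj₂ y≡a = contradiction (≡.sym y≡a) a≢y
  length-filter-insert P? Q? P⇒Q Q⇒P Pa ¬Qa {x ∷ xs} (x∉xs ∷ xs!) (there a∈xs)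
    with ih ← length-filter-insert P? Q? P⇒Q Q⇒P Pa ¬Qa xs! a∈xs | P? x | Q? x
  ... | yes _  | yes _  = ≡.cong suc ih
  ... | no _   | no _   = ih
  ... | no ¬Px | yes Qx = contradiction (Q⇒P Qx) ¬Px
  ... | yes Px | no ¬Qx with P⇒Q Px
  ...   | inj₁ Qx     = contradiction Qx ¬Qx
  ...   | inj₂ ≡.refl = contradiction ≡.refl (All.lookup x∉xs a∈xs)

  lookup-injective : ∀ {A : Set} {xs : List A} → Unique xs → ∀ i j → lookup xs i ≡ lookup xs j → i ≡ j
  lookup-injective {xs = x ∷ xs} (x∉xs ∷ xs!) zero    zero    eq = ≡.refl
  lookup-injective {xs = x ∷ xs} (x∉xs ∷ xs!) zero    (suc j) eq = contradiction eq (All.lookup x∉xs (∈-lookup j))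
  lookup-injective {xs = x ∷ xs} (x∉xs ∷ xs!) (suc i) zero    eq = contradiction (≡.sym eq) (All.lookup x∉xs (∈-lookup i))
  lookup-injective {xs = x ∷ xs} (x∉xs ∷ xs!) (suc i) (suc j) eq = ≡.cong suc (lookup-injective xs! i j eq)

  -- The threshold t is the k-th largest entry, or 0 if there are fewer.
  sum-largest : ∀ k {ds} → AllPairs ℕ._≥_ ds → ∃[ t ] (∀ {u} → All (ℕ._≤ u) ds → t ℕ.≤ u) ×
    k ℕ.* t ℕ.+ ℕ.sum (map (ℕ._∸ t) ds) ℕ.≤ ℕ.sum (take (k ℕ.⊓ length ds) ds)
  sum-largest zero {[]} [] = 0 , (λ _ → ℕ.z≤n) , ℕ.z≤n
  -- After the k largest entries have been passed, the head of the rest becomes the threshold. It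
  -- bounds everything that follows, so truncated subtraction leaves no excess there.
  sum-largest zero {d ∷ ds} (d≥ds ∷ _) = d , (λ { (d≤u ∷ _) → d≤u }) , ℕ.≤-reflexive (no-excess (ℕ.≤-refl ∷ d≥ds))
    where
    no-excess : ∀ {ds} → All (ℕ._≤ d) ds → ℕ.sum (map (ℕ._∸ d) ds) ≡ 0
    no-excess []            = ≡.refl
    no-excess (e≤d ∷ ds≤d) = ≡.cong₂ ℕ._+_ (ℕ.m≤n⇒m∸n≡0 e≤d) (no-excess ds≤d)
  sum-largest (suc k) {[]} [] = 0 , (λ _ → ℕ.z≤n) , ℕ.≤-reflexive (≡.trans (ℕ.+-identityʳ _) (ℕ.*-zeroʳ k))
  sum-largest (suc k) {d ∷ ds} (d≥ds ∷ ds↘) =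
    let t , t≤ , bound = sum-largest k ds↘
        t≤d = t≤ d≥ds
    in t , (λ { (d≤u ∷ _) → ℕ.≤-trans t≤d d≤u }) , (begin
      (t ℕ.+ k ℕ.* t) ℕ.+ (d ℕ.∸ t ℕ.+ ℕ.sum (map (ℕ._∸ t) ds))
        ≡⟨ ℕ.+-assoc t (k ℕ.* t) _ ⟩
      t ℕ.+ (k ℕ.* t ℕ.+ (d ℕ.∸ t ℕ.+ ℕ.sum (map (ℕ._∸ t) ds)))
        ≡⟨ ≡.cong (t ℕ.+_) (≡.trans (≡.sym (ℕ.+-assoc (k ℕ.* t) (d ℕ.∸ t) _))
             (≡.trans (≡.cong (ℕ._+ ℕ.sum (map (ℕ._∸ t) ds)) (ℕ.+-comm (k ℕ.* t) (d ℕ.∸ t))) (ℕ.+-assoc (d ℕ.∸ t) (k ℕ.* t) _))) ⟩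
      t ℕ.+ (d ℕ.∸ t ℕ.+ (k ℕ.* t ℕ.+ ℕ.sum (map (ℕ._∸ t) ds)))
        ≡⟨ ℕ.+-assoc t (d ℕ.∸ t) _ ⟨
      t ℕ.+ (d ℕ.∸ t) ℕ.+ (k ℕ.* t ℕ.+ ℕ.sum (map (ℕ._∸ t) ds))
        ≡⟨ ≡.cong (ℕ._+ _) (ℕ.m+[n∸m]≡n t≤d) ⟩
      d ℕ.+ (k ℕ.* t ℕ.+ ℕ.sum (map (ℕ._∸ t) ds))
        ≤⟨ ℕ.+-monoʳ-≤ d bound ⟩
      d ℕ.+ ℕ.sum (take (k ℕ.⊓ length ds) ds) ∎)
    where open ℕ.≤-Reasoning

-- Incidence signs and the boundary matrix.

module Boundary {n : ℕ} {_<_ : Rel (Fin n) 0ℓ} (<-sto : IsStrictTotalOrder _≡_ _<_) where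

  open import Data.Fin.Subset using (_∈_; _⊆_; _∩_; _∪_; _─_; ∣_∣)
  open import Data.Fin.Subset.Properties
  open import Data.Integer.Base using (ℤ; +_; -_; -1ℤ; 0ℤ; 1ℤ; _*_; _^_)
  open import Data.List.Base using (filter; allFin)
  open import Data.List.Membership.Propositional.Properties using (∈-allFin)
  open import Data.List.Properties using (filter-≐)
  open import Data.List.Relation.Unary.Unique.Propositional.Properties using (allFin⁺)
  open Defs using (incidence)
  open Subsets
  open Lists
  open IsStrictTotalOrder <-sto using (_<?_; compare)
  open ≡-Reasoning

  below : Subset n → Fin n → ℕ
  below τ a = length (filter (λ v → (v ∈? τ) ×-dec (v <? a)) (allFin n))

  -- The vertex that `incidence` obtains from its search in τ ─ ρ must be the apex, because the apex
  -- is the only vertex there.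
  incidence-apex : ∀ {τ ρ} (A : Apex τ ρ) → incidence <-sto τ ρ ≡ -1ℤ ^ below τ (Apex.apex A)
  incidence-apex {τ} {ρ} A with nonempty? (τ ─ ρ)
  ... | no empty = contradiction (apex , x∈p∧x∉q⇒x∈p─q apex∈τ apex∉ρ) empty
    where open Apex A
  ... | yes (u , u∈τ─ρ) with Apex.split A (p─q⊆p τ ρ u∈τ─ρ)
  ...   | inj₁ u∈ρ    = contradiction u∈ρ (x∈p─q⇒x∉q τ ρ u∈τ─ρ)
  ...   | inj₂ ≡.refl = ≡.refl

  -- Adding the apex to η raises the position of b by one exactly when the apex precedes b; the next
  -- lemma is the other case.
  below-apex< : ∀ {σ η} → η ⊆ σ → (A : Apex σ η) → ∀ {b} → Apex.apex A < b → below σ b ≡ suc (below η b)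
  below-apex< η⊆σ A {b} a<b = length-filter-insert _ _
    (λ (v∈σ , v<b) → case split v∈σ of λ
      { (inj₁ v∈η) → inj₁ (v∈η , v<b)
      ; (inj₂ v≡a) → inj₂ v≡a
      })
    (λ (v∈η , v<b) → η⊆σ v∈η , v<b)
    (apex∈τ , a<b) (λ (a∈η , _) → apex∉ρ a∈η)
    (allFin⁺ n) (∈-allFin apex)
    where open Apex A

  below-apex≮ : ∀ {σ η} → η ⊆ σ → (A : Apex σ η) → ∀ {b} → ¬ (Apex.apex A < b) → below σ b ≡ below η b
  below-apex≮ η⊆σ A {b} a≮b = ≡.cong length (filter-≐ _ _
    ( (λ (v∈σ , v<b) → case Apex.split A v∈σ of λ
        { (inj₁ v∈η)    → v∈η , v<b
        ; (inj₂ ≡.refl) → contradiction v<b a≮b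
        })
    , (λ (v∈η , v<b) → η⊆σ v∈η , v<b))
    (allFin n))

  -- The sign rule behind ∂∂ = 0. Let a and b be the vertices of τ and η outside τ ∩ η. The
  -- exponents of (σ : τ) and (η : τ ∩ η) are the positions of b in σ and in σ without a, which
  -- differ by one exactly if a < b. Those of (σ : η) and (τ : τ ∩ η) concern a and differ exactly
  -- if b < a. One of the two happens, so the product changes sign once.
  incidence-union : ∀ (τ η : Subset n) → ∣ τ ∣ ≡ suc ∣ τ ∩ η ∣ → ∣ η ∣ ≡ suc ∣ τ ∩ η ∣ →
    incidence <-sto (τ ∪ η) τ * incidence <-sto (τ ∪ η) η ≡
    - (incidence <-sto τ (τ ∩ η) * incidence <-sto η (τ ∩ η))
  incidence-union τ η ∣τ∣ ∣η∣ = begin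
    incidence <-sto σ τ * incidence <-sto σ η      ≡⟨ ≡.cong₂ _*_ (incidence-apex σ/τ) (incidence-apex σ/η) ⟩
    -1ℤ ^ below σ b * -1ℤ ^ below σ a              ≡⟨ signs ⟩
    - (-1ℤ ^ below τ a * -1ℤ ^ below η b)          ≡⟨ ≡.cong -_ (≡.cong₂ _*_ (incidence-apex A) (incidence-apex B)) ⟨
    - (incidence <-sto τ (τ ∩ η) * incidence <-sto η (τ ∩ η)) ∎
    where
    σ = τ ∪ η
    A = facet-apex (p∩q⊆p τ η) ∣τ∣
    B = facet-apex (p∩q⊆q τ η) ∣η∣
    open Apex A using () renaming (apex to a)
    open Apex B using () renaming (apex to b)
    τ⊆σ : τ ⊆ σ
    τ⊆σ = p⊆p∪q η
    η⊆σ : η ⊆ σ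
    η⊆σ = q⊆p∪q τ η

    σ/τ : Apex σ τ
    σ/τ = record
      { apex   = b
      ; apex∈τ = η⊆σ (Apex.apex∈τ B)
      ; apex∉ρ = λ b∈τ → Apex.apex∉ρ B (x∈p∩q⁺ (b∈τ , Apex.apex∈τ B))
      ; split  = λ v∈σ → case x∈p∪q⁻ τ η v∈σ of λ
        { (inj₁ v∈τ) → inj₁ v∈τ
        ; (inj₂ v∈η) → case Apex.split B v∈η of λ
          { (inj₁ v∈ρ) → inj₁ (p∩q⊆p τ η v∈ρ)
          ; (inj₂ v≡b) → inj₂ v≡b
          }
        }
      }

    σ/η : Apex σ η
    σ/η = record
      { apex   = a
      ; apex∈τ = τ⊆σ (Apex.apex∈τ A)
      ; apex∉ρ = λ a∈η → Apex.apex∉ρ A (x∈p∩q⁺ (Apex.apex∈τ A , a∈η))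
      ; split  = λ v∈σ → case x∈p∪q⁻ τ η v∈σ of λ
        { (inj₂ v∈η) → inj₁ v∈η
        ; (inj₁ v∈τ) → case Apex.split A v∈τ of λ
          { (inj₁ v∈ρ) → inj₁ (p∩q⊆q τ η v∈ρ)
          ; (inj₂ v≡a) → inj₂ v≡a
          }
        }
      }

    signs : -1ℤ ^ below σ b * -1ℤ ^ below σ a ≡ - (-1ℤ ^ below τ a * -1ℤ ^ below η b)
    signs with compare a b
    ... | tri≈ _ a≡b _ = contradiction
      (x∈p∩q⁺ (Apex.apex∈τ A , ≡.subst (_∈ η) (≡.sym a≡b) (Apex.apex∈τ B))) (Apex.apex∉ρ A)
    ... | tri< a<b _ b≮a = begin
      -1ℤ ^ below σ b * -1ℤ ^ below σ a            ≡⟨ ≡.cong₂ (λ x y → -1ℤ ^ x * -1ℤ ^ y) (below-apex< η⊆σ σ/η a<b) (below-apex≮ τ⊆σ σ/τ b≮a) ⟩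
      -1ℤ * -1ℤ ^ below η b * -1ℤ ^ below τ a      ≡⟨ ≡.cong (_* (-1ℤ ^ below τ a)) (ℤ.-1*i≡-i (-1ℤ ^ below η b)) ⟩
      - (-1ℤ ^ below η b) * -1ℤ ^ below τ a        ≡⟨ ℤ.neg-distribˡ-* (-1ℤ ^ below η b) (-1ℤ ^ below τ a) ⟨
      - (-1ℤ ^ below η b * -1ℤ ^ below τ a)        ≡⟨ ≡.cong -_ (ℤ.*-comm (-1ℤ ^ below η b) (-1ℤ ^ below τ a)) ⟩
      - (-1ℤ ^ below τ a * -1ℤ ^ below η b)        ∎
    ... | tri> a≮b _ b<a = begin
      -1ℤ ^ below σ b * -1ℤ ^ below σ a            ≡⟨ ≡.cong₂ (λ x y → -1ℤ ^ x * -1ℤ ^ y) (below-apex≮ η⊆σ σ/η a≮b) (below-apex< τ⊆σ σ/τ b<a) ⟩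
      -1ℤ ^ below η b * (-1ℤ * -1ℤ ^ below τ a)    ≡⟨ ≡.cong ((-1ℤ ^ below η b) *_) (ℤ.-1*i≡-i (-1ℤ ^ below τ a)) ⟩
      -1ℤ ^ below η b * - (-1ℤ ^ below τ a)        ≡⟨ ℤ.neg-distribʳ-* (-1ℤ ^ below η b) (-1ℤ ^ below τ a) ⟨
      - (-1ℤ ^ below η b * -1ℤ ^ below τ a)        ≡⟨ ≡.cong -_ (ℤ.*-comm (-1ℤ ^ below η b) (-1ℤ ^ below τ a)) ⟩
      - (-1ℤ ^ below τ a * -1ℤ ^ below η b)        ∎

  incidence² : ∀ τ ρ → incidence <-sto τ ρ * incidence <-sto τ ρ ≡ 1ℤ
  incidence² τ ρ with nonempty? (τ ─ ρ)
  ... | no _        = ≡.refl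
  ... | yes (u , _) = -1^m² (below τ u)
    where
    -1^m² : ∀ m → -1ℤ ^ m * -1ℤ ^ m ≡ 1ℤ
    -1^m² zero    = ≡.refl
    -1^m² (suc m) = begin
      -1ℤ * -1ℤ ^ m * (-1ℤ * -1ℤ ^ m)  ≡⟨ ≡.cong₂ _*_ (ℤ.-1*i≡-i (-1ℤ ^ m)) (ℤ.-1*i≡-i (-1ℤ ^ m)) ⟩
      - (-1ℤ ^ m) * - (-1ℤ ^ m)        ≡⟨ ℤ.neg-distribˡ-* (-1ℤ ^ m) (- (-1ℤ ^ m)) ⟨
      - (-1ℤ ^ m * - (-1ℤ ^ m))        ≡⟨ ≡.cong -_ (ℤ.neg-distribʳ-* (-1ℤ ^ m) (-1ℤ ^ m)) ⟨
      - - (-1ℤ ^ m * -1ℤ ^ m)          ≡⟨ ℤ.neg-involutive _ ⟩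
      -1ℤ ^ m * -1ℤ ^ m                ≡⟨ -1^m² m ⟩
      1ℤ                               ∎

  ∂ : Subset n → Subset n → ℤ
  ∂ ρ τ with ρ ⊆? τ
  ... | yes _ = incidence <-sto τ ρ
  ... | no _  = 0ℤ

  ∂-⊆ : ∀ {ρ τ} → ρ ⊆ τ → ∂ ρ τ ≡ incidence <-sto τ ρ
  ∂-⊆ {ρ} {τ} ρ⊆τ with ρ ⊆? τ
  ... | yes _   = ≡.refl
  ... | no  ρ⊈τ = contradiction (λ {x} → ρ⊆τ {x}) ρ⊈τ

  ∂-⊈ : ∀ {ρ τ} → ¬ (ρ ⊆ τ) → ∂ ρ τ ≡ 0ℤ
  ∂-⊈ {ρ} {τ} ρ⊈τ with ρ ⊆? τ
  ... | yes ρ⊆τ = contradiction (λ {x} → ρ⊆τ {x}) ρ⊈τ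
  ... | no  _   = ≡.refl

  ∂³ : ∀ ρ τ → ∂ ρ τ * ∂ ρ τ * ∂ ρ τ ≡ ∂ ρ τ
  ∂³ ρ τ with ρ ⊆? τ
  ... | yes _ = ≡.trans (≡.cong (_* incidence <-sto τ ρ) (incidence² τ ρ)) (ℤ.*-identityˡ _)
  ... | no _  = ≡.refl

  -- Two distinct r-sets have a union of more than r elements, which therefore fills any set of r +
  -- 1 elements containing both.
  ⊆-union : ∀ {r} {τ η σ : Subset n} → τ ⊆ σ → η ⊆ σ → τ ≢ η → ∣ τ ∣ ≡ r → ∣ η ∣ ≡ r → ∣ σ ∣ ≡ suc r →
    τ ∪ η ≡ σ
  ⊆-union {r} {τ} {η} {σ} τ⊆σ η⊆σ τ≢η ∣τ∣ ∣η∣ ∣σ∣ = ⊆∧∣∣≥⇒≡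
    (λ v∈ → case x∈p∪q⁻ τ η v∈ of λ { (inj₁ v∈τ) → τ⊆σ v∈τ ; (inj₂ v∈η) → η⊆σ v∈η })
    (≡.subst₂ ℕ._≤_ (≡.trans (≡.cong suc ∣τ∣) (≡.sym ∣σ∣)) ≡.refl (ℕ.≰⇒> λ ∣τ∪η∣≤∣τ∣ → τ≢η
      (≡.sym (⊆∧∣∣≥⇒≡
        (λ v∈η → ≡.subst (_ ∈_) (≡.sym (⊆∧∣∣≥⇒≡ (p⊆p∪q η) ∣τ∪η∣≤∣τ∣)) (q⊆p∪q τ η v∈η))
        (ℕ.≤-reflexive (≡.trans ∣τ∣ (≡.sym ∣η∣)))))))

  ∣∩∣⇔∣∪∣ : ∀ {r} (τ η : Subset n) → ∣ τ ∣ ≡ r → ∣ η ∣ ≡ r →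
    (∣ τ ∪ η ∣ ≡ suc r → suc ∣ τ ∩ η ∣ ≡ r) × (suc ∣ τ ∩ η ∣ ≡ r → ∣ τ ∪ η ∣ ≡ suc r)
  ∣∩∣⇔∣∪∣ {r} τ η ∣τ∣ ∣η∣ =
    (λ ∣∪∣ → ℕ.+-cancelˡ-≡ r _ _ (begin
      r ℕ.+ suc ∣ τ ∩ η ∣        ≡⟨ ℕ.+-suc r ∣ τ ∩ η ∣ ⟩
      suc r ℕ.+ ∣ τ ∩ η ∣        ≡⟨ ≡.cong (ℕ._+ ∣ τ ∩ η ∣) ∣∪∣ ⟨
      ∣ τ ∪ η ∣ ℕ.+ ∣ τ ∩ η ∣    ≡⟨ total ⟩
      r ℕ.+ r                    ∎)) ,
    (λ 1+∣∩∣ → ℕ.+-cancelʳ-≡ ∣ τ ∩ η ∣ _ _ (begin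
      ∣ τ ∪ η ∣ ℕ.+ ∣ τ ∩ η ∣    ≡⟨ total ⟩
      r ℕ.+ r                    ≡⟨ ≡.cong (r ℕ.+_) 1+∣∩∣ ⟨
      r ℕ.+ suc ∣ τ ∩ η ∣        ≡⟨ ℕ.+-suc r ∣ τ ∩ η ∣ ⟩
      suc r ℕ.+ ∣ τ ∩ η ∣        ∎))
    where
    total : ∣ τ ∪ η ∣ ℕ.+ ∣ τ ∩ η ∣ ≡ r ℕ.+ r
    total = ≡.trans (∣p∪q∣+∣p∩q∣≡∣p∣+∣q∣ τ η) (≡.cong₂ ℕ._+_ ∣τ∣ ∣η∣)

-- Facets and partite sets.

module Partite {n : ℕ} (X : Defs.SimplicialComplex n) {r : ℕ} {V : Fin (suc r) → Subset n}
  (partite : Defs.IsPartite X r V) where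

  open import Data.Fin.Subset using (_∈_; _⊆_; _∩_; ∣_∣; Nonempty)
  open import Data.Fin.Subset.Properties
  open Defs using (IsFace)
  open Defs.IsPartite partite
  open Subsets

  -- Otherwise τ would contain one vertex from each of r + 1 disjoint sets.
  facet-avoids : ∀ {τ} → ∣ τ ∣ ≡ r → ∃[ j ] ¬ Nonempty (τ ∩ V j)
  facet-avoids {τ} ∣τ∣≡r with Fin.any? (λ j → ¬? (nonempty? (τ ∩ V j)))
  ... | yes avoided = avoided
  ... | no meets-all = contradiction (≡.subst (suc r ℕ.≤_) ∣τ∣≡r
      (injection⇒≤∣∣ τ (λ j → proj₁ (meets j))
        (λ {i} {j} vᵢ≡vⱼ → disjoint (∈V i) (≡.subst (_∈ V j) (≡.sym vᵢ≡vⱼ) (∈V j)))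
        (λ j → proj₁ (x∈p∩q⁻ τ (V j) (proj₂ (meets j))))))
    ℕ.1+n≰n
    where
    meets : ∀ j → Nonempty (τ ∩ V j)
    meets j with nonempty? (τ ∩ V j)
    ... | yes meet  = meet
    ... | no avoids = contradiction (j , avoids) meets-all

    ∈V : ∀ j → proj₁ (meets j) ∈ V j
    ∈V j = proj₂ (x∈p∩q⁻ τ (V j) (proj₂ (meets j)))

  -- If σ missed V j, its vertices would lie in the other r parts, at most one in each, and σ would
  -- have at most r of them.
  simplex-meets : ∀ {σ} → IsFace X σ → ∣ σ ∣ ≡ suc r → ∀ j → Nonempty (σ ∩ V j)
  simplex-meets {σ} face ∣σ∣ j with nonempty? (σ ∩ V j)
  ... | yes meet  = meet
  ... | no avoids = contradiction (≡.subst (ℕ._≤ r) ∣σ∣ (transversal⇒∣∣≤ r (V ∘ punchIn j) σ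
      (λ {v} v∈σ → let i , v∈Vᵢ = covers v
                       j≢i j≡i = avoids (v , x∈p∩q⁺ (v∈σ , ≡.subst (λ i → v ∈ V i) (≡.sym j≡i) v∈Vᵢ))
                   in punchOut j≢i , ≡.subst (λ i → v ∈ V i) (≡.sym (Fin.punchIn-punchOut j≢i)) v∈Vᵢ)
      (λ i → rainbow face (punchIn j i))))
    ℕ.1+n≰n

  -- The simplex σ has a vertex v in V j, and a facet of σ that avoids V j omits v. So it can only
  -- be σ without v.
  facet-unique : ∀ {σ τ η} j → IsFace X σ → ∣ σ ∣ ≡ suc r → τ ⊆ σ → η ⊆ σ → ∣ τ ∣ ≡ r → ∣ η ∣ ≡ r →
    ¬ Nonempty (τ ∩ V j) → ¬ Nonempty (η ∩ V j) → τ ≡ η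
  facet-unique {σ} {τ} {η} j face ∣σ∣ τ⊆σ η⊆σ ∣τ∣ ∣η∣ τ∩V η∩V =
    ⊆-antisym (half τ⊆σ η⊆σ ∣η∣ τ∩V η∩V) (half η⊆σ τ⊆σ ∣τ∣ η∩V τ∩V)
    where
    v = proj₁ (simplex-meets face ∣σ∣ j)
    v∈σ∩Vⱼ = x∈p∩q⁻ σ (V j) (proj₂ (simplex-meets face ∣σ∣ j))

    half : ∀ {τ η} → τ ⊆ σ → η ⊆ σ → ∣ η ∣ ≡ r → ¬ Nonempty (τ ∩ V j) → ¬ Nonempty (η ∩ V j) → τ ⊆ η
    half {τ} {η} τ⊆σ η⊆σ ∣η∣ τ∩V η∩V {w} w∈τ with split (τ⊆σ w∈τ) | split (proj₁ v∈σ∩Vⱼ)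
      where open Apex (facet-apex η⊆σ (≡.trans ∣σ∣ (≡.cong suc (≡.sym ∣η∣))))
    ... | inj₁ w∈η | _        = w∈η
    ... | inj₂ _   | inj₁ v∈η = contradiction (v , x∈p∩q⁺ (v∈η , proj₂ v∈σ∩Vⱼ)) η∩V
    ... | inj₂ w≡a | inj₂ v≡a = contradiction
      (w , x∈p∩q⁺ (w∈τ , ≡.subst (_∈ V j) (≡.trans v≡a (≡.sym w≡a)) (proj₂ v∈σ∩Vⱼ))) τ∩V

-- The Laplacian as a Gram matrix, and the eigenvalue bound.

module PartiteBound {c ℓ₁ ℓ₂ : Level} (F : StableOrderedField c ℓ₁ ℓ₂)
  (φ : ℤ.ℤ → StableOrderedField.Carrier F)
  (φ-* : ∀ a b → StableOrderedField._≈_ F (φ (a ℤ.* b)) (StableOrderedField._*_ F (φ a) (φ b)))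
  (φ-ℕ : ∀ m → StableOrderedField._≈_ F (φ (ℤ.+ m)) (OrderedFieldProperties.ι F m))
  where

  open import Data.Fin.Subset using (_∩_; _∪_; _⊆_; ∣_∣; Nonempty)
  open import Data.Fin.Subset.Properties using (_⊆?_; nonempty?; p⊆p∪q; q⊆p∪q)
  open import Data.Integer.Base using (+_)
  open import Data.List.Base using (filter; lookup; take; allFin; tabulate)
  open import Data.List.Membership.Propositional using (_∈_)
  open import Data.List.Membership.Propositional.Properties
    using (∈-lookup; ∈-filter⁺; ∈-filter⁻; ∈-map⁺; ∈-map⁻; ∈-++⁺ˡ; ∈-++⁺ʳ)
  open import Data.List.Properties using (map-tabulate; map-∘; length-map)
  import Data.List.Relation.Binary.Permutation.Propositional.Properties as ↭
  open import Data.List.Relation.Unary.Any using (here; index)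
  open import Data.List.Relation.Unary.Any.Properties using (lookup-index)
  open import Data.List.Relation.Unary.Linked.Properties using (Linked⇒AllPairs)
  open import Data.List.Relation.Unary.Unique.Propositional using (Unique)
  import Data.List.Relation.Unary.Unique.Propositional.Properties as Unique
  open import Data.List.Relation.Unary.AllPairs using ([]; _∷_)
  open import Data.List.Relation.Unary.All using ([]; _∷_)
  import Data.List.Sort
  import Data.Bool.Properties as Bool
  import Data.Nat.ListAction as ℕ
  open import Data.Nat.ListAction.Properties using (sum-↭)
  open import Data.Vec.Properties using (≡-dec; ∷-injectiveʳ)
  import Relation.Binary.Construct.Flip.EqAndOrd as Flip
  open import Relation.Unary using (Pred; Decidable)

  open Defs using (SimplicialComplex; IsFace; isFace?; IsPartite; subsets; simplices; faceCount;
    deg; simplicesAvoiding; sumLargestDegrees; laplacianEntry; incidence)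
  open StableOrderedField F
  open OrderedFieldProperties F
  open Relation.Binary.Reasoning.Setoid setoid
  open Sums commutativeRing
  open Matrices commutativeRing
  open Determinant commutativeRing using (det)
  open Polynomials commutativeRing using (charPoly⇒trace-^)
  open FunctionalCalculus commutativeRing
  open Subsets
  open Lists

  indicator : {P : Set} → Dec P → Carrier
  indicator (yes _) = 1#
  indicator (no _)  = 0#

  indicator≥0 : {P : Set} (P? : Dec P) → 0# ≤ indicator P?
  indicator≥0 (yes _) = 0≤1
  indicator≥0 (no _)  = ≤-refl

  indicator-yes : {P : Set} (P? : Dec P) → P → indicator P? ≈ 1#
  indicator-yes (yes _) p = refl
  indicator-yes (no ¬p) p = contradiction p ¬p

  indicator-no : {P : Set} (P? : Dec P) → ¬ P → indicator P? ≈ 0#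
  indicator-no (yes p) ¬p = contradiction p ¬p
  indicator-no (no _)  ¬p = refl

  sum-filter : ∀ {A : Set} {P : Pred A 0ℓ} (P? : Decidable P) (f : A → ℕ) xs →
    (sum λ i → indicator (P? (lookup xs i)) * ι (f (lookup xs i))) ≈ ι (ℕ.sum (map f (filter P? xs)))
  sum-filter P? f []       = refl
  sum-filter P? f (x ∷ xs) with P? x
  ... | yes _ = trans (+-cong (*-identityˡ (ι (f x))) (sum-filter P? f xs)) (sym (×-homo-+ 1# (f x) _))
  ... | no _  = trans (+-cong (zeroˡ (ι (f x))) (sum-filter P? f xs)) (+-identityˡ _)

  sum-indicator : ∀ {A : Set} {P : Pred A 0ℓ} (P? : Decidable P) xs →
    (sum λ i → indicator (P? (lookup xs i))) ≈ ι (length (filter P? xs))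
  sum-indicator P? []       = refl
  sum-indicator P? (x ∷ xs) with P? x
  ... | yes _ = +-congˡ (sum-indicator P? xs)
  ... | no _  = trans (+-congˡ (sum-indicator P? xs)) (+-identityˡ _)

  sum-allFin : ∀ {n} (f : Fin n → ℕ) → (sum λ j → ι (f j)) ≈ ι (ℕ.sum (map f (allFin n)))
  sum-allFin {n} f = trans (go f) (reflexive (≡.cong (ι ∘ ℕ.sum) (≡.sym (map-tabulate id f))))
    where
    go : ∀ {n} (f : Fin n → ℕ) → (sum λ j → ι (f j)) ≈ ι (ℕ.sum (tabulate f))
    go {zero}  f = refl
    go {suc n} f = trans (+-congˡ (go (f ∘ suc))) (sym (×-homo-+ 1# (f zero) _))

  ∈-subsets : ∀ {n} (σ : Subset n) → σ ∈ subsets n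
  ∈-subsets []          = here ≡.refl
  ∈-subsets (false ∷ σ) = ∈-++⁺ˡ (∈-map⁺ (false ∷_) (∈-subsets σ))
  ∈-subsets (true ∷ σ)  = ∈-++⁺ʳ _ (∈-map⁺ (true ∷_) (∈-subsets σ))

  subsets-unique : ∀ n → Unique (subsets n)
  subsets-unique zero    = [] ∷ []
  subsets-unique (suc n) = Unique.++⁺
    (Unique.map⁺ ∷-injectiveʳ (subsets-unique n))
    (Unique.map⁺ ∷-injectiveʳ (subsets-unique n))
    λ (σ∈outside , σ∈inside) → case ∈-map⁻ (false ∷_) σ∈outside of λ
      { (_ , _ , ≡.refl) → case ∈-map⁻ (true ∷_) σ∈inside of λ () }

  module _ {n : ℕ} (X : SimplicialComplex n) (s : ℕ) where

    simplices-unique : Unique (simplices X s)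
    simplices-unique = Unique.filter⁺ _ (subsets-unique n)

    ∈-simplices⁺ : ∀ {σ} → IsFace X σ → ∣ σ ∣ ≡ s → σ ∈ simplices X s
    ∈-simplices⁺ {σ} face ∣σ∣≡s = ∈-filter⁺ _ (∈-subsets σ) (face , ∣σ∣≡s)

    simplex : Fin (faceCount X s) → Subset n
    simplex = lookup (simplices X s)

    simplex-face : ∀ i → IsFace X (simplex i) × ∣ simplex i ∣ ≡ s
    simplex-face i = proj₂ (∈-filter⁻ (λ σ → isFace? X σ ×-dec (∣ σ ∣ ℕ.≟ s)) {xs = subsets n} (∈-lookup i))

  largest-degrees : ∀ {n} (X : SimplicialComplex n) k r W → ∃[ t ]
    k ℕ.* t ℕ.+ ℕ.sum (map (λ τ → deg X r τ ℕ.∸ t) (simplicesAvoiding X r W)) ℕ.≤ sumLargestDegrees X k r W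
  largest-degrees X k r W =
    let t , _ , bound = sum-largest k (Linked⇒AllPairs (λ i≥j j≥k → ℕ.≤-trans j≥k i≥j) (sort-↗ ds))
    in t , ≡.subst₂ ℕ._≤_
      (≡.cong (k ℕ.* t ℕ.+_) (≡.trans (sum-↭ (↭.map⁺ (ℕ._∸ t) (sort-↭ ds)))
        (≡.cong ℕ.sum (≡.sym (map-∘ (simplicesAvoiding X r W))))))
      (≡.cong (λ l → ℕ.sum (take (k ℕ.⊓ l) (sort ds)))
        (≡.trans (↭.↭-length (sort-↭ ds)) (length-map (deg X r) (simplicesAvoiding X r W))))
      bound
    where
    open Data.List.Sort (Flip.decTotalOrder ℕ.≤-decTotalOrder) using (sort; sort-↗; sort-↭)
    ds = map (deg X r) (simplicesAvoiding X r W)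

  module _ {n : ℕ} {_<_ : Rel (Fin n) 0ℓ} (<-sto : IsStrictTotalOrder _≡_ _<_)
    (X : SimplicialComplex n) (r : ℕ) where

    open Boundary <-sto

    B : Matrix (faceCount X r) (faceCount X (suc r))
    B i s = φ (∂ (simplex X r i) (simplex X (suc r) s))

    B-⊆ : ∀ i s → simplex X r i ⊆ simplex X (suc r) s → B i s * B i s ≈ 1#
    B-⊆ i s τ⊆σ = trans (sym (φ-* _ _)) (trans (reflexive (≡.cong φ
      (≡.trans (≡.cong (λ z → z ℤ.* z) (∂-⊆ (λ {x} → τ⊆σ {x}))) (incidence² _ _))))
      (trans (φ-ℕ 1) (+-identityʳ 1#)))

    B-⊈ : ∀ i s → ¬ (simplex X r i ⊆ simplex X (suc r) s) → B i s ≈ 0#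
    B-⊈ i s τ⊈σ = trans (reflexive (≡.cong φ (∂-⊈ τ⊈σ))) (φ-ℕ 0)

    B³≈B : ∀ i s → B i s * B i s * B i s ≈ B i s
    B³≈B i s = begin
      φ b * φ b * φ b    ≈⟨ *-congʳ (φ-* b b) ⟨
      φ (b ℤ.* b) * φ b      ≈⟨ φ-* (b ℤ.* b) b ⟨
      φ (b ℤ.* b ℤ.* b)          ≈⟨ reflexive (≡.cong φ (∂³ (simplex X r i) (simplex X (suc r) s))) ⟩
      φ b                        ∎
      where b = ∂ (simplex X r i) (simplex X (suc r) s)

    degree-sum : ∀ i → ι (deg X r (simplex X r i)) ≈ (B *ᴹ B ᵀ) i i
    degree-sum i = trans
      (sym (sum-indicator (simplex X r i ⊆?_) (simplices X (suc r))))
      (sum-cong-≋ λ s → sym (square s (simplex X r i ⊆? simplex X (suc r) s)))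
      where
      square : ∀ s (τ⊆?σ : Dec (simplex X r i ⊆ simplex X (suc r) s)) → B i s * B i s ≈ indicator τ⊆?σ
      square s (yes τ⊆σ) = B-⊆ i s τ⊆σ
      square s (no  τ⊈σ) = trans (*-congʳ (B-⊈ i s τ⊈σ)) (zeroˡ _)

    common-coface : ∀ i j → i ≢ j → ∀ s → simplex X r i ⊆ simplex X (suc r) s → simplex X r j ⊆ simplex X (suc r) s →
      simplex X r i ∪ simplex X r j ≡ simplex X (suc r) s
    common-coface i j i≢j s τ⊆σ η⊆σ = ⊆-union τ⊆σ η⊆σ
      (λ τ≡η → i≢j (lookup-injective (simplices-unique X r) i j τ≡η))
      (proj₂ (simplex-face X r i)) (proj₂ (simplex-face X r j)) (proj₂ (simplex-face X (suc r) s))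

    product-zero : ∀ i j s → ¬ (simplex X r i ⊆ simplex X (suc r) s × simplex X r j ⊆ simplex X (suc r) s) →
      B i s * B j s ≈ 0#
    product-zero i j s no-coface = case simplex X r i ⊆? simplex X (suc r) s of λ
      { (no τ⊈σ)  → trans (*-congʳ (B-⊈ i s τ⊈σ)) (zeroˡ _)
      ; (yes τ⊆σ) → trans (*-congˡ (B-⊈ j s (λ η⊆σ → no-coface (τ⊆σ , η⊆σ)))) (zeroʳ _)
      }

    laplacian : Square (faceCount X r)
    laplacian i j = φ (laplacianEntry <-sto X r (simplex X r i) (simplex X r j))

    -- On the diagonal, the squares in a row count the cofaces. Off it, the only possible common
    -- coface of τ and η is τ ∪ η, so the sum has at most one nonzero term, whose sign is given by
    -- `incidence-union`. If τ ∪ η is not a simplex of the right size, every term vanishes.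
    gram : laplacian ≈ᴹ B *ᴹ B ᵀ
    gram i j with ≡-dec Bool._≟_ (simplex X r i) (simplex X r j)
    ... | yes τ≡η with ≡.refl ← lookup-injective (simplices-unique X r) i j τ≡η =
      trans (φ-ℕ (deg X r (simplex X r i))) (degree-sum i)
    ... | no τ≢η with (suc ∣ simplex X r i ∩ simplex X r j ∣ ℕ.≟ r) ×-dec isFace? X (simplex X r i ∪ simplex X r j)
    ...   | no ¬adjacent = trans (φ-ℕ 0) (sym (sum-zero λ s → product-zero i j s λ (τ⊆σ , η⊆σ) →
      let τ∪η≡σ = common-coface i j (λ { ≡.refl → τ≢η ≡.refl }) s (λ {x} → τ⊆σ {x}) (λ {x} → η⊆σ {x})
          face , ∣σ∣ = simplex-face X (suc r) s
      in ¬adjacent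
        ( proj₁ (∣∩∣⇔∣∪∣ (simplex X r i) (simplex X r j) (proj₂ (simplex-face X r i)) (proj₂ (simplex-face X r j))) (≡.trans (≡.cong ∣_∣ τ∪η≡σ) ∣σ∣)
        , ≡.subst (IsFace X) (≡.sym τ∪η≡σ) face)))
    ...   | yes (1+∣τ∩η∣≡r , face) = sym (begin
      (sum λ s → B i s * B j s)
        ≈⟨ sum-single (λ s → B i s * B j s) s₀ (λ s s≢s₀ → product-zero i j s λ (τ⊆σ , η⊆σ) →
             s≢s₀ (lookup-injective (simplices-unique X (suc r)) s s₀
               (≡.trans (≡.sym (common-coface i j (λ { ≡.refl → τ≢η ≡.refl }) s (λ {x} → τ⊆σ {x}) (λ {x} → η⊆σ {x}))) σ₀≡))) ⟩
      B i s₀ * B j s₀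
        ≈⟨ φ-* _ _ ⟨
      φ (∂ τ (simplex X (suc r) s₀) ℤ.* ∂ η (simplex X (suc r) s₀))
        ≈⟨ reflexive (≡.cong φ (≡.subst
             (λ σ → ∂ τ σ ℤ.* ∂ η σ ≡ ℤ.- (incidence <-sto τ (τ ∩ η) ℤ.* incidence <-sto η (τ ∩ η))) σ₀≡
             (≡.trans (≡.cong₂ ℤ._*_ (∂-⊆ (p⊆p∪q η)) (∂-⊆ (q⊆p∪q τ η)))
               (incidence-union τ η (≡.trans ∣τ∣ (≡.sym 1+∣τ∩η∣≡r)) (≡.trans ∣η∣ (≡.sym 1+∣τ∩η∣≡r)))))) ⟩
      φ (ℤ.- (incidence <-sto τ (τ ∩ η) ℤ.* incidence <-sto η (τ ∩ η))) ∎)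
      where
      τ = simplex X r i
      η = simplex X r j
      ∣τ∣ = proj₂ (simplex-face X r i)
      ∣η∣ = proj₂ (simplex-face X r j)
      σ₀∈ : τ ∪ η ∈ simplices X (suc r)
      σ₀∈ = ∈-simplices⁺ X (suc r) face (proj₂ (∣∩∣⇔∣∪∣ τ η ∣τ∣ ∣η∣) 1+∣τ∩η∣≡r)
      s₀ = index σ₀∈
      σ₀≡ : τ ∪ η ≡ simplex X (suc r) s₀
      σ₀≡ = lookup-index σ₀∈

    module _ {V : Fin (suc r) → Subset n} (partite : IsPartite X r V) where

      open Partite X partite

      avoids? : ∀ j τ → Dec (¬ Nonempty (τ ∩ V j))
      avoids? j τ = ¬? (nonempty? (τ ∩ V j))

      χ : Fin (suc r) → Fin (faceCount X r) → Carrier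
      χ j i = indicator (avoids? j (simplex X r i))

      χ-covers : ∀ i → 1# ≤ sum λ j → χ j i
      χ-covers i = let j , avoids = facet-avoids (proj₂ (simplex-face X r i)) in
        ≤-trans (≤-reflexive (sym (indicator-yes (avoids? j (simplex X r i)) avoids)))
          (term≤sum (λ j → indicator≥0 (avoids? j (simplex X r i))) j)

      -- A nonzero term comes from a facet of σ avoiding V j. By `facet-unique` there is at most
      -- one, and its term is 1.
      χ-disjoint : ∀ j s → (sum λ i → χ j i * (B i s * B i s)) ≤ 1#
      χ-disjoint j s = bound (Fin.any? λ i → (simplex X r i ⊆? σ) ×-dec avoids? j (simplex X r i))
        where
        σ = simplex X (suc r) s

        term-zero : ∀ i → ¬ (simplex X r i ⊆ σ × ¬ Nonempty (simplex X r i ∩ V j)) →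
          χ j i * (B i s * B i s) ≈ 0#
        term-zero i none = case simplex X r i ⊆? σ of λ
          { (no τ⊈σ)  → trans (*-congˡ (trans (*-congʳ (B-⊈ i s τ⊈σ)) (zeroˡ _))) (zeroʳ _)
          ; (yes τ⊆σ) → trans (*-congʳ (indicator-no (avoids? j (simplex X r i)) (λ avoids → none (τ⊆σ , avoids)))) (zeroˡ _)
          }

        bound : Dec (∃[ i ] simplex X r i ⊆ σ × ¬ Nonempty (simplex X r i ∩ V j)) →
          (sum λ i → χ j i * (B i s * B i s)) ≤ 1#
        bound (no none) = ≤-resp (sym (sum-zero λ i → term-zero i λ facet → none (i , facet))) refl 0≤1
        bound (yes (i , τ⊆σ , avoids)) = ≤-reflexive (begin
          (sum λ i → χ j i * (B i s * B i s))
            ≈⟨ sum-single (λ i → χ j i * (B i s * B i s)) i (λ i′ i′≢i → term-zero i′ λ (η⊆σ , avoids′) →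
                 i′≢i (lookup-injective (simplices-unique X r) i′ i
                   (facet-unique j (proj₁ (simplex-face X (suc r) s)) (proj₂ (simplex-face X (suc r) s))
                     η⊆σ τ⊆σ (proj₂ (simplex-face X r i′)) (proj₂ (simplex-face X r i)) avoids′ avoids))) ⟩
          χ j i * (B i s * B i s)
            ≈⟨ *-cong (indicator-yes (avoids? j (simplex X r i)) avoids) (B-⊆ i s τ⊆σ) ⟩
          1# * 1#
            ≈⟨ *-identityˡ 1# ⟩
          1# ∎)

      eigenvalue-bound : ∀ k (k≤f : k ℕ.≤ faceCount X r) (μ : Fin (faceCount X r) → Carrier) →
        (∀ x → det (λ i j → x * 1ᴹ i j + - laplacian i j) ≈ product λ i → x + - μ i) →
        (sum λ i → μ (inject≤ {k} i k≤f)) ≤ φ (+ ℕ.sum (map (λ j → sumLargestDegrees X k r (V j)) (allFin (suc r))))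
      -- The goal is a stable inequality, so the selection may be used although it exists only under
      -- a double negation.
      eigenvalue-bound k k≤f μ charPoly = ≤-stable λ unbounded →
        SpectralProjection.select F laplacian μ
          (λ i j → trans (gram j i) (trans (*ᴹ-transpose B (B ᵀ) i j) (sym (gram i j))))
          (charPoly⇒trace-^ ι-separated (λ m → proj₂ (invertℕ m)) laplacian μ charPoly)
          (sum λ j → ι (t j)) (sum-nonneg λ j → ι≥0 (t j))
          λ selection → unbounded (≤-trans
            (GramMatrix.sumFirst-bound F B B³≈B gram d L-diagonal selection
              χ (λ j i → indicator≥0 (avoids? j (simplex X r i))) χ-covers χ-disjoint t refl k k≤f)
            (≤-trans (sum-mono part) (≤-reflexive (trans (sum-allFin S) (sym (φ-ℕ _))))))
        where
        S = λ j → sumLargestDegrees X k r (V j)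
        t = λ j → proj₁ (largest-degrees X k r (V j))
        d = λ i → deg X r (simplex X r i)

        L-diagonal : ∀ i → laplacian i i ≈ ι (d i)
        L-diagonal i = trans (gram i i) (sym (degree-sum i))

        part : ∀ j → ι k * ι (t j) + (sum λ i → χ j i * ι (d i ℕ.∸ t j)) ≤ ι (S j)
        part j = ≤-resp
          (trans (×-homo-+ 1# (k ℕ.* t j) _) (+-cong (×1-homo-* k (t j))
            (sym (sum-filter (avoids? j) (λ τ → deg X r τ ℕ.∸ t j) (simplices X r)))))
          refl
          (ι-mono (proj₂ (largest-degrees X k r (V j))))

-- The characteristic polynomial over the Cauchy reals.

module RealCharPoly where

  open Defs using (ℝ; fromℤ)
  open Reals
  open RealOrder using (fromℤ-*)
  open CommutativeRing ℝ-commutativeRing hiding (_-_; zero)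
  open Sums ℝ-commutativeRing
  open Matrices ℝ-commutativeRing
  open Determinant ℝ-commutativeRing using (sgn; det)

  sum-cong : ∀ {n} (f g : Fin n → ℝ) → (∀ i → f i ≈ g i) → sum f ≈ sum g
  sum-cong f g f≈g = sum-cong-≋ {_} {f} {g} f≈g

  sign≈sgn : ∀ m → Defs.sign m ≈ sgn m
  sign≈sgn zero    = pointwise {Defs.sign 0} {1#} λ _ → ≡.refl
  sign≈sgn (suc m) = ≈-trans {Defs.sign (suc m)} {fromℤ ℤ.-1ℤ * Defs.sign m} {sgn (suc m)}
    (fromℤ-* ℤ.-1ℤ (ℤ.-1ℤ ℤ.^ m))
    (≈-trans {fromℤ ℤ.-1ℤ * Defs.sign m} { - Defs.sign m} {sgn (suc m)}
      (pointwise {fromℤ ℤ.-1ℤ * Defs.sign m} { - Defs.sign m} λ n →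
        Algebra.Properties.Ring.-1*x≈-x (CommutativeRing.ring ℚ.+-*-commutativeRing) _)
      (Reals.-‿cong {Defs.sign m} {sgn m} (sign≈sgn m)))

  det≈ : ∀ {n} (M N : Fin n → Fin n → ℝ) → (∀ i j → M i j ≈ N i j) → Defs.det M ≈ det N
  det≈ {zero}  M N M≈N = refl {1#}
  det≈ {suc n} M N M≈N = sum-cong
    (λ j → Defs.sign (toℕ j) * M zero j * Defs.det λ i k → M (suc i) (punchIn j k))
    (λ j → sgn (toℕ j) * N zero j * det λ i k → N (suc i) (punchIn j k))
    λ j → Reals.*-cong {Defs.sign (toℕ j) * M zero j} {sgn (toℕ j) * N zero j}
      {Defs.det λ i k → M (suc i) (punchIn j k)} {det λ i k → N (suc i) (punchIn j k)}
      (Reals.*-cong {Defs.sign (toℕ j)} {sgn (toℕ j)} {M zero j} {N zero j} (sign≈sgn (toℕ j)) (M≈N zero j))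
      (det≈ (λ i k → M (suc i) (punchIn j k)) (λ i k → N (suc i) (punchIn j k)) λ i k → M≈N (suc i) (punchIn j k))

  scalar≈ : ∀ {n} t (i j : Fin n) → Defs.scalar t i j ≈ t * 1ᴹ i j
  scalar≈ t zero    zero    = ≈-sym {t * 1#} {t} (*-identityʳ t)
  scalar≈ t zero    (suc j) = ≈-sym {t * 0#} {0#} (zeroʳ t)
  scalar≈ t (suc i) zero    = ≈-sym {t * 0#} {0#} (zeroʳ t)
  scalar≈ t (suc i) (suc j) = scalar≈ t i j

  charPoly≈ : ∀ {n} (M : Fin n → Fin n → ℝ) t → Defs.charPoly M t ≈ det λ i j → t * 1ᴹ i j + - M i j
  charPoly≈ M t = det≈ (λ i j → Defs.scalar t i j + - M i j) (λ i j → t * 1ᴹ i j + - M i j) λ i j →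
    Reals.+-cong {Defs.scalar t i j} {t * 1ᴹ i j} { - M i j} { - M i j} (scalar≈ t i j) (refl { - M i j})

open import Defs
open import Data.List.Base using (allFin)
import Data.Nat.ListAction as ℕ

theorem1p9 : ∀ {n : ℕ} {_<_ : Rel (Fin n) 0ℓ} (<-sto : IsStrictTotalOrder _≡_ _<_)
    (r : ℕ) → 1 ℕ.≤ r →
    (X : SimplicialComplex n) (V : Fin (suc r) → Subset n) → IsPartite X r V →
    (k : ℕ) → 1 ℕ.≤ k → (k≤f : k ℕ.≤ faceCount X r) →
    (μ : Fin (faceCount X r) → ℝ) → IsEigenvalueList (upperLaplacian <-sto X r) μ →
    sumFirst k≤f μ ≤ fromℕ (ℕ.sum (map (λ j → sumLargestDegrees X k r (V j)) (allFin (suc r))))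
theorem1p9 <-sto r _ X V partite k _ k≤f μ eigenvalues =
  PartiteBound.eigenvalue-bound RealOrder.ℝ-stableOrderedField fromℤ RealOrder.fromℤ-* RealOrder.fromℕ≈·
    <-sto X r partite k k≤f μ λ t →
      Reals.≈-trans {det′ t} {charPoly L t} {product λ i → t - μ i}
        (Reals.≈-sym {charPoly L t} {det′ t} (RealCharPoly.charPoly≈ L t))
        (IsEigenvalueList.splits eigenvalues t)
  where
  L = upperLaplacian <-sto X r
  det′ = λ t → Determinant.det Reals.ℝ-commutativeRing λ i j → t * Matrices.1ᴹ Reals.ℝ-commutativeRing i j + - L i j
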